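{- Every Pisot number $q \in (1, 1.933]$ satisfies $|q'| \geq \frac{\sqrt5-1}{2}$ for all Galois conjugates $q'$ of $q$.
   Context: A Pisot number is a real algebraic integer $q>1$ all of whose other Galois conjugates have absolute value strictly less than $1$. -}

module Defs where

open import Data.Nat.Base as ℕ using (ℕ; zero; suc; s≤s; z≤n)
import Data.Nat.Properties as ℕ
open import Data.Nat.Solver renaming (module +-*-Solver to ℕ-Solver)
open import Data.Integer.Base as ℤ using (ℤ; +_; -[1+_])
import Data.Integer.Properties as ℤ
open import Data.Rational.Base as ℚ using (ℚ; mkℚ; 0ℚ; 1ℚ; ½; toℚᵘ)
import Data.Rational.Properties as ℚ
open import Data.Rational.Solver renaming (module +-*-Solver to ℚ-Solver)
open import Data.Rational.Unnormalised.Base as ℚᵘ using (mkℚᵘ)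
import Data.Rational.Unnormalised.Properties as ℚᵘ
open import Data.Product.Base using (∃; _×_; _,_; proj₁; proj₂)
open import Data.Sum.Base using (_⊎_; inj₁; inj₂)
open import Data.Vec.Base using (Vec; []; _∷_; map)
open import Relation.Nullary using (¬_; yes; no; contradiction)
open import Relation.Binary.PropositionalEquality
  using (_≡_; refl; sym; trans; cong; cong₂; subst; subst₂)

private
  half>0 : ∀ {ε} → 0ℚ ℚ.< ε → 0ℚ ℚ.< ½ ℚ.* ε
  half>0 {ε} 0<ε = subst (ℚ._< ½ ℚ.* ε) (ℚ.*-zeroʳ ½) (ℚ.*-monoʳ-<-pos ½ 0<ε)

  half+half : ∀ ε → ½ ℚ.* ε ℚ.+ ½ ℚ.* ε ≡ ε
  half+half = solve 1 (λ ε → con ½ :* ε :+ con ½ :* ε := ε) refl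
    where open ℚ-Solver

  0≤-+ : ∀ {p q} → 0ℚ ℚ.≤ p → 0ℚ ℚ.≤ q → 0ℚ ℚ.≤ p ℚ.+ q
  0≤-+ = ℚ.+-mono-≤

  *-mono-≤ : ∀ {p q r s} → 0ℚ ℚ.≤ q → 0ℚ ℚ.≤ r → p ℚ.≤ q → r ℚ.≤ s →
             p ℚ.* r ℚ.≤ q ℚ.* s
  *-mono-≤ {q = q} {r = r} 0≤q 0≤r p≤q r≤s = ℚ.≤-trans
    (ℚ.*-monoʳ-≤-nonNeg r {{ℚ.nonNegative 0≤r}} p≤q)
    (ℚ.*-monoˡ-≤-nonNeg q {{ℚ.nonNegative 0≤q}} r≤s)

  0≤-* : ∀ {p q} → 0ℚ ℚ.≤ p → 0ℚ ℚ.≤ q → 0ℚ ℚ.≤ p ℚ.* q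
  0≤-* {p} {q} 0≤p 0≤q = subst (ℚ._≤ p ℚ.* q) (ℚ.*-zeroˡ 0ℚ) (*-mono-≤ 0≤p ℚ.≤-refl 0≤p 0≤q)

  <-by-diff : ∀ {p q r} → p ℚ.- q ℚ.< r → p ℚ.< q ℚ.+ r
  <-by-diff {p} {q} {r} p-q<r = subst (ℚ._< q ℚ.+ r)
    (solve 2 (λ p q → q :+ (p :- q) := p) refl p q) (ℚ.+-monoʳ-< q p-q<r)
    where open ℚ-Solver

  diff-by-< : ∀ {p q r} → p ℚ.< q ℚ.+ r → p ℚ.- q ℚ.< r
  diff-by-< {p} {q} {r} p<q+r = subst (p ℚ.- q ℚ.<_)
    (solve 2 (λ q r → (q :+ r) :- q := r) refl q r) (ℚ.+-monoˡ-< (ℚ.- q) p<q+r)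
    where open ℚ-Solver

  p≤∣p∣ : ∀ p → p ℚ.≤ ℚ.∣ p ∣
  p≤∣p∣ p with ℚ.≤-total 0ℚ p
  ... | inj₁ 0≤p = ℚ.≤-reflexive (sym (ℚ.0≤p⇒∣p∣≡p 0≤p))
  ... | inj₂ p≤0 = ℚ.≤-trans p≤0 (ℚ.0≤∣p∣ p)

  ∣-∣-comm : ∀ p q → ℚ.∣ p ℚ.- q ∣ ≡ ℚ.∣ q ℚ.- p ∣
  ∣-∣-comm p q = trans (sym (ℚ.∣-p∣≡∣p∣ (p ℚ.- q))) (cong ℚ.∣_∣
    (solve 2 (λ p q → :- (p :- q) := q :- p) refl p q))
    where open ℚ-Solver

  triangle : ∀ {x p q a b ε} → p ℚ.+ q ≡ x → a ℚ.+ b ≡ ε →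
             ℚ.∣ p ∣ ℚ.< a → ℚ.∣ q ∣ ℚ.< b → ℚ.∣ x ∣ ℚ.< ε
  triangle {p = p} {q = q} refl refl p<a q<b =
    ℚ.≤-<-trans (ℚ.∣p+q∣≤∣p∣+∣q∣ p q) (ℚ.+-mono-< p<a q<b)

  ∣-∣<-intro : ∀ p q {ε} → p ℚ.- q ℚ.< ε → q ℚ.- p ℚ.< ε → ℚ.∣ p ℚ.- q ∣ ℚ.< ε
  ∣-∣<-intro p q {ε} p-q<ε q-p<ε with ℚ.∣p∣≡p∨∣p∣≡-p (p ℚ.- q)
  ... | inj₁ eq = subst (ℚ._< ε) (sym eq) p-q<ε
  ... | inj₂ eq = subst (ℚ._< ε) (sym (trans eq
    (solve 2 (λ p q → :- (p :- q) := q :- p) refl p q))) q-p<ε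
    where open ℚ-Solver

-- The real line is the setoid (ℝ , _≈_): Cauchy sequences of rationals,
-- carrying their modulus, up to having difference tending to 0.
IsCauchy : (ℕ → ℚ) → Set
IsCauchy f = ∀ ε → 0ℚ ℚ.< ε →
  ∃ λ N → ∀ m n → N ℕ.≤ m → N ℕ.≤ n → ℚ.∣ f m ℚ.- f n ∣ ℚ.< ε

record ℝ : Set where
  constructor mkℝ
  field
    seq    : ℕ → ℚ
    cauchy : IsCauchy seq

open ℝ public

infix 4 _≈_ _<_ _≤_

_≈_ : ℝ → ℝ → Set
x ≈ y = ∀ ε → 0ℚ ℚ.< ε →
  ∃ λ N → ∀ n → N ℕ.≤ n → ℚ.∣ seq x n ℚ.- seq y n ∣ ℚ.< ε

_<_ : ℝ → ℝ → Set
x < y = ∃ λ ε → 0ℚ ℚ.< ε ×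
  (∃ λ N → ∀ n → N ℕ.≤ n → seq x n ℚ.+ ε ℚ.≤ seq y n)

-- For Cauchy reals with a modulus this is equivalent to
-- ∀ ε > 0, eventually xₙ ≤ yₙ + ε.
_≤_ : ℝ → ℝ → Set
x ≤ y = ¬ (y < x)

private
  +-cauchy : ∀ f g → IsCauchy f → IsCauchy g → IsCauchy (λ n → f n ℚ.+ g n)
  +-cauchy f g cf cg ε 0<ε
    with cf (½ ℚ.* ε) (half>0 0<ε) | cg (½ ℚ.* ε) (half>0 0<ε)
  ... | M , hM | N , hN = M ℕ.⊔ N , λ m n M⊔N≤m M⊔N≤n →
    triangle (rearrange (f m) (g m) (f n) (g n)) (half+half ε)
      (hM m n (ℕ.m⊔n≤o⇒m≤o M N M⊔N≤m) (ℕ.m⊔n≤o⇒m≤o M N M⊔N≤n))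
      (hN m n (ℕ.m⊔n≤o⇒n≤o M N M⊔N≤m) (ℕ.m⊔n≤o⇒n≤o M N M⊔N≤n))
    where
    open ℚ-Solver
    rearrange : ∀ a b c d → (a ℚ.- c) ℚ.+ (b ℚ.- d) ≡ (a ℚ.+ b) ℚ.- (c ℚ.+ d)
    rearrange = solve 4 (λ a b c d → (a :- c) :+ (b :- d) := (a :+ b) :- (c :+ d)) refl

  neg-cauchy : ∀ f → IsCauchy f → IsCauchy (λ n → ℚ.- f n)
  neg-cauchy f cf ε 0<ε with cf ε 0<ε
  ... | N , hN = N , λ m n N≤m N≤n →
    subst (ℚ._< ε) (trans (∣-∣-comm (f m) (f n)) (cong ℚ.∣_∣ (rearrange (f m) (f n))))
      (hN m n N≤m N≤n)
    where
    open ℚ-Solver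
    rearrange : ∀ a b → b ℚ.- a ≡ (ℚ.- a) ℚ.- (ℚ.- b)
    rearrange = solve 2 (λ a b → b :- a := (:- a) :- (:- b)) refl

  eventually-bounded : ∀ {f} → IsCauchy f →
    ∃ λ B → 0ℚ ℚ.< B × ∃ λ N → ∀ n → N ℕ.≤ n → ℚ.∣ f n ∣ ℚ.≤ B
  eventually-bounded {f} cf with cf 1ℚ (ℚ.positive⁻¹ 1ℚ)
  ... | N , hN = 1ℚ ℚ.+ ℚ.∣ f N ∣
    , ℚ.<-≤-trans (ℚ.positive⁻¹ 1ℚ)
        (subst (ℚ._≤ 1ℚ ℚ.+ ℚ.∣ f N ∣) (ℚ.+-identityʳ 1ℚ) (ℚ.+-monoʳ-≤ 1ℚ (ℚ.0≤∣p∣ (f N))))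
    , N , λ n N≤n → ℚ.≤-trans
        (ℚ.≤-reflexive (cong ℚ.∣_∣ (sym (rearrange (f n) (f N)))))
        (ℚ.≤-trans (ℚ.∣p+q∣≤∣p∣+∣q∣ (f n ℚ.- f N) (f N))
          (ℚ.+-monoˡ-≤ ℚ.∣ f N ∣ (ℚ.<⇒≤ (hN n N N≤n ℕ.≤-refl))))
    where
    open ℚ-Solver
    rearrange : ∀ a b → (a ℚ.- b) ℚ.+ b ≡ a
    rearrange = solve 2 (λ a b → (a :- b) :+ b := a) refl

  divide : ∀ {B ε} → 0ℚ ℚ.< B → 0ℚ ℚ.< ε → ∃ λ δ → 0ℚ ℚ.< δ × B ℚ.* δ ≡ ε
  divide {B} {ε} 0<B 0<ε = B⁻¹ ℚ.* ε
    , ℚ.positive⁻¹ (B⁻¹ ℚ.* ε)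
        {{ℚ.pos*pos⇒pos B⁻¹ {{ℚ.1/pos⇒pos B {{B>0}}}} ε {{ℚ.positive 0<ε}}}}
    , trans (sym (ℚ.*-assoc B B⁻¹ ε))
        (trans (cong (ℚ._* ε) (ℚ.*-inverseʳ B {{B≢0}})) (ℚ.*-identityˡ ε))
    where
    B>0 : ℚ.Positive B
    B>0 = ℚ.positive 0<B
    B≢0 : ℚ.NonZero B
    B≢0 = ℚ.pos⇒nonZero B {{B>0}}
    B⁻¹ : ℚ
    B⁻¹ = (ℚ.1/ B) {{B≢0}}

  *-cauchy : ∀ f g → IsCauchy f → IsCauchy g → IsCauchy (λ n → f n ℚ.* g n)
  *-cauchy f g cf cg ε 0<ε = combine
    (eventually-bounded cf) (eventually-bounded cg)
    where
    open ℚ-Solver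
    rearrange : ∀ a b c d →
      a ℚ.* (b ℚ.- d) ℚ.+ d ℚ.* (a ℚ.- c) ≡ a ℚ.* b ℚ.- c ℚ.* d
    rearrange = solve 4 (λ a b c d →
      a :* (b :- d) :+ d :* (a :- c) := a :* b :- c :* d) refl

    product< : ∀ {p q r s} → 0ℚ ℚ.< q → ℚ.∣ p ∣ ℚ.≤ q → ℚ.∣ r ∣ ℚ.< s →
               ℚ.∣ p ℚ.* r ∣ ℚ.< q ℚ.* s
    product< {p} {q} {r} {s} 0<q p≤q r<s = subst (ℚ._< q ℚ.* s) (sym (ℚ.∣p*q∣≡∣p∣*∣q∣ p r))
      (ℚ.≤-<-trans (ℚ.*-monoʳ-≤-nonNeg ℚ.∣ r ∣ {{ℚ.∣-∣-nonNeg r}} p≤q)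
        (ℚ.*-monoʳ-<-pos q {{ℚ.positive 0<q}} r<s))

    Goal : Set
    Goal = ∃ λ N → ∀ m n → N ℕ.≤ m → N ℕ.≤ n →
      ℚ.∣ f m ℚ.* g m ℚ.- f n ℚ.* g n ∣ ℚ.< ε

    Close : (ℕ → ℚ) → ℚ → Set
    Close h δ = ∃ λ N → ∀ m n → N ℕ.≤ m → N ℕ.≤ n → ℚ.∣ h m ℚ.- h n ∣ ℚ.< δ

    Bounded : (ℕ → ℚ) → ℚ → Set
    Bounded h B = ∃ λ N → ∀ n → N ℕ.≤ n → ℚ.∣ h n ∣ ℚ.≤ B

    conclude : ∀ {B C δ γ} → 0ℚ ℚ.< B → 0ℚ ℚ.< C → Bounded f B → Bounded g C →
      B ℚ.* δ ≡ ½ ℚ.* ε → C ℚ.* γ ≡ ½ ℚ.* ε → Close f γ → Close g δ → Goal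
    conclude 0<B 0<C (K , hK) (L , hL) Bδ≡ Cγ≡ (M , hM) (N , hN) =
      (K ℕ.⊔ L) ℕ.⊔ (M ℕ.⊔ N) , λ m n ≤m ≤n →
      let K⊔L≤m = ℕ.m⊔n≤o⇒m≤o (K ℕ.⊔ L) (M ℕ.⊔ N) ≤m
          M⊔N≤m = ℕ.m⊔n≤o⇒n≤o (K ℕ.⊔ L) (M ℕ.⊔ N) ≤m
          K⊔L≤n = ℕ.m⊔n≤o⇒m≤o (K ℕ.⊔ L) (M ℕ.⊔ N) ≤n
          M⊔N≤n = ℕ.m⊔n≤o⇒n≤o (K ℕ.⊔ L) (M ℕ.⊔ N) ≤n
          Δf = hM m n (ℕ.m⊔n≤o⇒m≤o M N M⊔N≤m) (ℕ.m⊔n≤o⇒m≤o M N M⊔N≤n)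
          Δg = hN m n (ℕ.m⊔n≤o⇒n≤o M N M⊔N≤m) (ℕ.m⊔n≤o⇒n≤o M N M⊔N≤n)
          fm≤B = hK m (ℕ.m⊔n≤o⇒m≤o K L K⊔L≤m)
          gn≤C = hL n (ℕ.m⊔n≤o⇒n≤o K L K⊔L≤n)
      in triangle (rearrange (f m) (g m) (f n) (g n))
         (trans (cong₂ ℚ._+_ Bδ≡ Cγ≡) (half+half ε))
         (product< 0<B fm≤B Δg) (product< 0<C gn≤C Δf)

    combine : (∃ λ B → 0ℚ ℚ.< B × Bounded f B) → (∃ λ C → 0ℚ ℚ.< C × Bounded g C) → Goal
    combine (B , 0<B , hB) (C , 0<C , hC) =
      let δ , 0<δ , Bδ≡ = divide 0<B (half>0 0<ε)
          γ , 0<γ , Cγ≡ = divide 0<C (half>0 0<ε)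
      in conclude 0<B 0<C hB hC Bδ≡ Cγ≡ (cf γ 0<γ) (cg δ 0<δ)

infixl 6 _+_ _-_
infixl 7 _*_
infix  8 -_

fromℚ : ℚ → ℝ
fromℚ p = mkℝ (λ _ → p) λ ε 0<ε → 0 , λ _ _ _ _ →
  subst (λ r → ℚ.∣ r ∣ ℚ.< ε) (sym (ℚ.+-inverseʳ p)) 0<ε

0ℝ 1ℝ : ℝ
0ℝ = fromℚ 0ℚ
1ℝ = fromℚ 1ℚ

_+_ : ℝ → ℝ → ℝ
x + y = mkℝ (λ n → seq x n ℚ.+ seq y n) (+-cauchy (seq x) (seq y) (cauchy x) (cauchy y))

-_ : ℝ → ℝ
- x = mkℝ (λ n → ℚ.- seq x n) (neg-cauchy (seq x) (cauchy x))

_-_ : ℝ → ℝ → ℝ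
x - y = x + (- y)

_*_ : ℝ → ℝ → ℝ
x * y = mkℝ (λ n → seq x n ℚ.* seq y n) (*-cauchy (seq x) (seq y) (cauchy x) (cauchy y))

isqrt : ℕ → ℕ
isqrt zero    = zero
isqrt (suc n) with suc (isqrt n) ℕ.* suc (isqrt n) ℕ.≤? suc n
... | yes _ = suc (isqrt n)
... | no  _ = isqrt n

isqrt-lower : ∀ n → isqrt n ℕ.* isqrt n ℕ.≤ n
isqrt-lower zero    = z≤n
isqrt-lower (suc n) with suc (isqrt n) ℕ.* suc (isqrt n) ℕ.≤? suc n
... | yes r²≤ = r²≤
... | no  _   = ℕ.≤-trans (isqrt-lower n) (ℕ.n≤1+n n)

isqrt-upper : ∀ n → n ℕ.< suc (isqrt n) ℕ.* suc (isqrt n)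
isqrt-upper zero    = s≤s z≤n
isqrt-upper (suc n) with suc (isqrt n) ℕ.* suc (isqrt n) ℕ.≤? suc n
... | yes _  = ℕ.≤-<-trans (isqrt-upper n)
  (ℕ.*-mono-< (ℕ.n<1+n (suc (isqrt n))) (ℕ.n<1+n (suc (isqrt n))))
... | no  r² = ℕ.≰⇒> r²

-- For p/d ≥ 0 this is ⌊(n+1) √(p d)⌋ / ((n+1) d), an approximation of √(p/d)
-- from below with error at most 1/(n+1).  Negative rationals are sent to 0.
sqrtApprox : ℕ → ℚ → ℚ
sqrtApprox n (mkℚ (+ p)    d-1 _) =
  + isqrt (p ℕ.* suc d-1 ℕ.* (suc n ℕ.* suc n)) ℚ./ (suc n ℕ.* suc d-1)
sqrtApprox n (mkℚ -[1+ _ ] _   _) = 0ℚ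

precision : ℕ → ℚ
precision n = + 1 ℚ./ suc n

private
  toℚᵘ-/ : ∀ i d-1 → toℚᵘ (i ℚ./ suc d-1) ℚᵘ.≃ mkℚᵘ i d-1
  toℚᵘ-/ i d-1 = ℚ.toℚᵘ-fromℚᵘ (mkℚᵘ i d-1)

  0≤/ : ∀ k d-1 → 0ℚ ℚ.≤ + k ℚ./ suc d-1
  0≤/ k d-1 = ℚ.nonNegative⁻¹ _ {{ℚ.normalize-nonNeg k (suc d-1)}}

precision-small : ∀ {ε} → 0ℚ ℚ.< ε → ∃ λ N → ∀ n → N ℕ.≤ n → precision n ℚ.≤ ε
precision-small {mkℚ (+ zero) d-1 _} 0<ε =
  contradiction (ℚ.positive 0<ε) λ ()
precision-small {mkℚ -[1+ _ ] d-1 _} 0<ε =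
  contradiction (ℚ.positive 0<ε) λ ()
precision-small {mkℚ (+ suc k) d-1 c} 0<ε = d-1 , λ n d-1≤n →
  ℚ.toℚᵘ-cancel-≤ (ℚᵘ.≤-respˡ-≃ (ℚᵘ.≃-sym (toℚᵘ-/ (+ 1) n))
    (ℚᵘ.*≤* (ℤ.+≤+ (ℕ.*-mono-≤ (s≤s (z≤n {k})) (s≤s d-1≤n)))))

sqrtApprox-nonNeg : ∀ n a → 0ℚ ℚ.≤ sqrtApprox n a
sqrtApprox-nonNeg n (mkℚ (+ p)    d-1 _) =
  0≤/ (isqrt (p ℕ.* suc d-1 ℕ.* (suc n ℕ.* suc n))) (d-1 ℕ.+ n ℕ.* suc d-1)
sqrtApprox-nonNeg n (mkℚ -[1+ _ ] d-1 _) = ℚ.≤-refl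

sqrtApprox-lower : ∀ n a →
  sqrtApprox n a ≡ 0ℚ ⊎ sqrtApprox n a ℚ.* sqrtApprox n a ℚ.≤ a
sqrtApprox-lower n (mkℚ -[1+ _ ] d-1 _)   = inj₁ refl
sqrtApprox-lower n a@(mkℚ (+ p)  d-1 _) = inj₂ (ℚ.toℚᵘ-cancel-≤
  (ℚᵘ.≤-respˡ-≃
    (ℚᵘ.≃-sym (ℚᵘ.≃-trans (ℚ.toℚᵘ-homo-* s s) (ℚᵘ.*-cong (toℚᵘ-/ (+ r) _) (toℚᵘ-/ (+ r) _))))
    (ℚᵘ.*≤* (subst₂ ℤ._≤_
      (trans (ℤ.pos-* (r ℕ.* r) d) (cong (ℤ._* + d) (ℤ.pos-* r r)))
      (ℤ.pos-* p (N ℕ.* d ℕ.* (N ℕ.* d)))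
      (ℤ.+≤+ key)))))
  where
  d N r : ℕ
  d = suc d-1
  N = suc n
  r = isqrt (p ℕ.* d ℕ.* (N ℕ.* N))
  s : ℚ
  s = sqrtApprox n a
  rearrange : ∀ p d N → p ℕ.* d ℕ.* (N ℕ.* N) ℕ.* d ≡ p ℕ.* (N ℕ.* d ℕ.* (N ℕ.* d))
  rearrange = solve 3 (λ p d N →
    p :* d :* (N :* N) :* d := p :* (N :* d :* (N :* d))) refl
    where open ℕ-Solver
  key : r ℕ.* r ℕ.* d ℕ.≤ p ℕ.* (N ℕ.* d ℕ.* (N ℕ.* d))
  key = subst (r ℕ.* r ℕ.* d ℕ.≤_) (rearrange p d N)
    (ℕ.*-monoˡ-≤ d (isqrt-lower (p ℕ.* d ℕ.* (N ℕ.* N))))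

sqrtApprox-upper : ∀ n a →
  a ℚ.≤ (sqrtApprox n a ℚ.+ precision n) ℚ.* (sqrtApprox n a ℚ.+ precision n)
sqrtApprox-upper n a@(mkℚ -[1+ _ ] d-1 _) = ℚ.≤-trans
  (ℚ.<⇒≤ (ℚ.negative⁻¹ a))
  (0≤-* (0≤-+ ℚ.≤-refl (0≤/ 1 n)) (0≤-+ ℚ.≤-refl (0≤/ 1 n)))
sqrtApprox-upper n a@(mkℚ (+ p) d-1 _) = ℚ.≤-trans a≤u²
  (*-mono-≤ (0≤-+ (0≤/ r _) (0≤/ 1 n)) (0≤/ (suc r) _) u≤ u≤)
  where
  d N r : ℕ
  d = suc d-1
  N = suc n
  r = isqrt (p ℕ.* d ℕ.* (N ℕ.* N))
  u : ℚ
  u = + suc r ℚ./ (N ℕ.* d)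

  rearrange : ∀ p d N → p ℕ.* d ℕ.* (N ℕ.* N) ℕ.* d ≡ p ℕ.* (N ℕ.* d ℕ.* (N ℕ.* d))
  rearrange = solve 3 (λ p d N →
    p :* d :* (N :* N) :* d := p :* (N :* d :* (N :* d))) refl
    where open ℕ-Solver

  key : p ℕ.* (N ℕ.* d ℕ.* (N ℕ.* d)) ℕ.≤ suc r ℕ.* suc r ℕ.* d
  key = subst (ℕ._≤ suc r ℕ.* suc r ℕ.* d) (rearrange p d N)
    (ℕ.*-monoˡ-≤ d (ℕ.<⇒≤ (isqrt-upper (p ℕ.* d ℕ.* (N ℕ.* N)))))

  a≤u² : a ℚ.≤ u ℚ.* u
  a≤u² = ℚ.toℚᵘ-cancel-≤
    (ℚᵘ.≤-respʳ-≃
      (ℚᵘ.≃-sym (ℚᵘ.≃-trans (ℚ.toℚᵘ-homo-* u u)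
        (ℚᵘ.*-cong (toℚᵘ-/ (+ suc r) _) (toℚᵘ-/ (+ suc r) _))))
      (ℚᵘ.*≤* (subst₂ ℤ._≤_
        (ℤ.pos-* p (N ℕ.* d ℕ.* (N ℕ.* d)))
        (ℤ.pos-* (suc r ℕ.* suc r) d)
        (ℤ.+≤+ key))))

  rearrange′ : ∀ r D N → (1 ℕ.+ r) ℕ.* (D ℕ.* N) ≡ (r ℕ.* N ℕ.+ N) ℕ.* D
  rearrange′ = solve 3 (λ r D N → (con 1 :+ r) :* (D :* N) := (r :* N :+ N) :* D) refl
    where open ℕ-Solver

  key′ : suc r ℕ.* (N ℕ.* d ℕ.* N) ℕ.≤ (r ℕ.* N ℕ.+ 1 ℕ.* (N ℕ.* d)) ℕ.* (N ℕ.* d)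
  key′ = subst (ℕ._≤ (r ℕ.* N ℕ.+ 1 ℕ.* (N ℕ.* d)) ℕ.* (N ℕ.* d))
    (sym (rearrange′ r (N ℕ.* d) N))
    (ℕ.*-monoˡ-≤ (N ℕ.* d) (ℕ.+-monoʳ-≤ (r ℕ.* N)
      (ℕ.≤-trans (ℕ.m≤m*n N d) (ℕ.≤-reflexive (sym (ℕ.*-identityˡ (N ℕ.* d)))))))

  u≤ : u ℚ.≤ sqrtApprox n a ℚ.+ precision n
  u≤ = ℚ.toℚᵘ-cancel-≤
    (ℚᵘ.≤-respˡ-≃ (ℚᵘ.≃-sym (toℚᵘ-/ (+ suc r) _))
      (ℚᵘ.≤-respʳ-≃
        (ℚᵘ.≃-sym (ℚᵘ.≃-trans (ℚ.toℚᵘ-homo-+ (sqrtApprox n a) (precision n))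
          (ℚᵘ.+-cong (toℚᵘ-/ (+ r) _) (toℚᵘ-/ (+ 1) n))))
        (ℚᵘ.*≤* (subst₂ ℤ._≤_
          (ℤ.pos-* (suc r) (N ℕ.* d ℕ.* N))
          (trans (ℤ.pos-* (r ℕ.* N ℕ.+ 1 ℕ.* (N ℕ.* d)) (N ℕ.* d))
            (cong (ℤ._* + (N ℕ.* d)) (trans (ℤ.pos-+ (r ℕ.* N) (1 ℕ.* (N ℕ.* d)))
              (cong₂ ℤ._+_ (ℤ.pos-* r N) (ℤ.pos-* 1 (N ℕ.* d))))))
          (ℤ.+≤+ key′)))))

private
  square-cancel-< : ∀ {s t} → 0ℚ ℚ.≤ s → 0ℚ ℚ.≤ t → s ℚ.* s ℚ.< t ℚ.* t → s ℚ.< t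
  square-cancel-< {s} {t} 0≤s 0≤t s²<t² with t ℚ.≤? s
  ... | no  t≰s = ℚ.≰⇒> t≰s
  ... | yes t≤s = contradiction
    (ℚ.<-≤-trans s²<t² (*-mono-≤ 0≤s 0≤t t≤s t≤s)) (ℚ.<-irrefl refl)

  sqrtApprox-< : ∀ m n a b ε → 0ℚ ℚ.< ε → precision n ℚ.≤ ½ ℚ.* ε →
    a ℚ.- b ℚ.< (½ ℚ.* ε) ℚ.* (½ ℚ.* ε) →
    sqrtApprox m a ℚ.< sqrtApprox n b ℚ.+ ε
  sqrtApprox-< m n a b ε 0<ε η≤h a-b<h² with sqrtApprox-lower m a
  ... | inj₁ s≡0 = subst (ℚ._< sqrtApprox n b ℚ.+ ε) (sym s≡0)
    (ℚ.+-mono-≤-< (sqrtApprox-nonNeg n b) 0<ε)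
  ... | inj₂ s²≤a = square-cancel-< (sqrtApprox-nonNeg m a) (0≤-+ 0≤t (ℚ.<⇒≤ 0<ε))
    (ℚ.≤-<-trans s²≤a (ℚ.<-≤-trans (<-by-diff a-b<h²) b+h²≤))
    where
    t h c : ℚ
    t = sqrtApprox n b
    h = ½ ℚ.* ε
    c = (t ℚ.+ h) ℚ.* (t ℚ.+ h) ℚ.+ h ℚ.* h
    0≤t : 0ℚ ℚ.≤ t
    0≤t = sqrtApprox-nonNeg n b
    0≤h : 0ℚ ℚ.≤ h
    0≤h = ℚ.<⇒≤ (half>0 0<ε)

    b≤ : b ℚ.≤ (t ℚ.+ h) ℚ.* (t ℚ.+ h)
    b≤ = ℚ.≤-trans (sqrtApprox-upper n b)
      (*-mono-≤ (0≤-+ 0≤t 0≤h) (0≤-+ 0≤t (0≤/ 1 n))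
        (ℚ.+-monoʳ-≤ t η≤h) (ℚ.+-monoʳ-≤ t η≤h))

    expand : ∀ t h → (t ℚ.+ h) ℚ.* (t ℚ.+ h) ℚ.+ h ℚ.* h
                       ℚ.+ (h ℚ.* (t ℚ.+ h) ℚ.+ h ℚ.* (t ℚ.+ h))
                   ≡ (t ℚ.+ (h ℚ.+ h)) ℚ.* (t ℚ.+ (h ℚ.+ h))
    expand = solve 2 (λ t h →
      (t :+ h) :* (t :+ h) :+ h :* h :+ (h :* (t :+ h) :+ h :* (t :+ h))
        := (t :+ (h :+ h)) :* (t :+ (h :+ h))) refl
      where open ℚ-Solver

    0≤slack : 0ℚ ℚ.≤ h ℚ.* (t ℚ.+ h) ℚ.+ h ℚ.* (t ℚ.+ h)
    0≤slack = 0≤-+ (0≤-* 0≤h (0≤-+ 0≤t 0≤h)) (0≤-* 0≤h (0≤-+ 0≤t 0≤h))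

    b+h²≤ : b ℚ.+ h ℚ.* h ℚ.≤ (t ℚ.+ ε) ℚ.* (t ℚ.+ ε)
    b+h²≤ = ℚ.≤-trans (ℚ.+-monoˡ-≤ (h ℚ.* h) b≤)
      (ℚ.≤-trans
        (ℚ.≤-reflexive (sym (ℚ.+-identityʳ c)))
        (ℚ.≤-trans (ℚ.+-monoʳ-≤ c 0≤slack)
          (ℚ.≤-reflexive (trans (expand t h)
            (cong (λ e → (t ℚ.+ e) ℚ.* (t ℚ.+ e)) (half+half ε))))))

  sqrt-cauchy : ∀ f → IsCauchy f → IsCauchy (λ n → sqrtApprox n (f n))
  sqrt-cauchy f cf ε 0<ε = conclude (precision-small 0<h) (cf (h ℚ.* h) 0<h²)
    where
    h : ℚ
    h = ½ ℚ.* ε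
    0<h : 0ℚ ℚ.< h
    0<h = half>0 0<ε
    0<h² : 0ℚ ℚ.< h ℚ.* h
    0<h² = ℚ.positive⁻¹ (h ℚ.* h)
      {{ℚ.pos*pos⇒pos h {{ℚ.positive 0<h}} h {{ℚ.positive 0<h}}}}

    conclude : (∃ λ M → ∀ n → M ℕ.≤ n → precision n ℚ.≤ h) →
      (∃ λ N → ∀ m n → N ℕ.≤ m → N ℕ.≤ n → ℚ.∣ f m ℚ.- f n ∣ ℚ.< h ℚ.* h) →
      ∃ λ N → ∀ m n → N ℕ.≤ m → N ℕ.≤ n →
        ℚ.∣ sqrtApprox m (f m) ℚ.- sqrtApprox n (f n) ∣ ℚ.< ε
    conclude (M , hM) (N , hN) = M ℕ.⊔ N , λ m n ≤m ≤n →
      ∣-∣<-intro (sqrtApprox m (f m)) (sqrtApprox n (f n))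
        (one-sided m n ≤m ≤n) (one-sided n m ≤n ≤m)
      where
      one-sided : ∀ m n → M ℕ.⊔ N ℕ.≤ m → M ℕ.⊔ N ℕ.≤ n →
        sqrtApprox m (f m) ℚ.- sqrtApprox n (f n) ℚ.< ε
      one-sided m n ≤m ≤n = diff-by-< (sqrtApprox-< m n (f m) (f n) ε 0<ε
        (hM n (ℕ.m⊔n≤o⇒m≤o M N ≤n))
        (ℚ.≤-<-trans (p≤∣p∣ (f m ℚ.- f n))
          (hN m n (ℕ.m⊔n≤o⇒n≤o M N ≤m) (ℕ.m⊔n≤o⇒n≤o M N ≤n))))

-- The principal square root, with the junk value 0 on negative arguments.
sqrt : ℝ → ℝ
sqrt x = mkℝ (λ n → sqrtApprox n (seq x n)) (sqrt-cauchy (seq x) (cauchy x))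

infix  4 _≈ᶜ_
infixl 6 _+ᶜ_
infixl 7 _*ᶜ_

record ℂ : Set where
  constructor _+i_
  field
    re im : ℝ

open ℂ public

_≈ᶜ_ : ℂ → ℂ → Set
z ≈ᶜ w = re z ≈ re w × im z ≈ im w

fromℝ : ℝ → ℂ
fromℝ x = x +i 0ℝ

0ℂ 1ℂ : ℂ
0ℂ = fromℝ 0ℝ
1ℂ = fromℝ 1ℝ

_+ᶜ_ : ℂ → ℂ → ℂ
z +ᶜ w = (re z + re w) +i (im z + im w)

_*ᶜ_ : ℂ → ℂ → ℂ
z *ᶜ w = (re z * re w - im z * im w) +i (re z * im w + im z * re w)

∣_∣ : ℂ → ℝ
∣ z ∣ = sqrt (re z * re z + im z * im z)

-- A vector (a₀ , … , aₙ₋₁) stands for the monic polynomial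
-- xⁿ + aₙ₋₁xⁿ⁻¹ + … + a₁x + a₀.
evalMonic : ∀ {n} → Vec ℚ n → ℂ → ℂ
evalMonic []       z = 1ℂ
evalMonic (a ∷ as) z = fromℝ (fromℚ a) +ᶜ z *ᶜ evalMonic as z

IsRoot : ∀ {n} → Vec ℚ n → ℂ → Set
IsRoot p z = evalMonic p z ≈ᶜ 0ℂ

IsAlgebraicInteger : ℂ → Set
IsAlgebraicInteger z = ∃ λ n → ∃ λ (p : Vec ℤ n) → IsRoot (map (ℚ._/ 1) p) z

-- The monic polynomial of least degree over ℚ that vanishes at z.
IsMinimalPolynomial : ∀ {n} → Vec ℚ n → ℂ → Set
IsMinimalPolynomial {n} p z =
  IsRoot p z × (∀ {m} → m ℕ.< n → (f : Vec ℚ m) → ¬ IsRoot f z)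

_IsConjugateOf_ : ℂ → ℂ → Set
w IsConjugateOf z =
  ∃ λ n → ∃ λ (p : Vec ℚ n) → IsMinimalPolynomial p z × IsRoot p w

IsPisot : ℝ → Set
IsPisot q =
  1ℝ < q
  × IsAlgebraicInteger (fromℝ q)
  × (∀ z → z IsConjugateOf fromℝ q → ¬ (z ≈ᶜ fromℝ q) → ∣ z ∣ < 1ℝ)

module Submission where

-- Let θ run over the roots of the minimal polynomial P of q, suppose that the conjugate α has
-- |α| < (√5 - 1)/2 and let w run over the remaining roots, so that |w| < 1.  If α is not real,
-- then |P(0)| ≤ q |α|² < 1, which is impossible because P is integral and irreducible.  If α is
-- real, then |P(0)| ≤ q |α| < 2 makes α a unit, and τ = Σ (θ - 1/θ) is an integer.  With
-- s = q + α and p = q α, Schwarz–Pick for the Blaschke product with zeros w bounds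
-- |Σ (w - 1/w)| by |p| - 1/|p|, that is |p τ - s (p - 1)| ≤ p² - 1.  For q < 2 this leaves no
-- integer τ: if α < 0 it forces 2 < τ < 3, if α > 0 and |p| > 1 it forces 0 < τ < 1, and if
-- p = 1 then q + 1/q would be an integer between 2 and 3.
--
-- The roots come from the fundamental theorem of algebra for Cauchy reals.  The mean of 1/f over
-- z ± δ, z ± iδ is 1/f(z) + O(δ³), so ‖1/f‖ + ε|z|² can be increased step by step until f is
-- nearly zero; approximate factorizations over the Gaussian rationals then refine each other.

-- Since `x ≤ y` on these reals means `¬ (y < x)`, the theorem is a refutation: the assumption
-- supplies rational margins, and the goal `⊥` permits case distinctions that are undecidable for
-- Cauchy reals, such as whether α is real, or its sign. The margins have to be carried along
-- because limits turn strict inequalities into weak ones; the contradictions for real α are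
-- polynomial identities, valid term by term, that make a sum of products of nonnegative limits
-- equal to a negative constant. The degree of P is arbitrary, so the estimate of Σ (w - 1/w) must
-- depend on the product of the w alone. Schwarz-Pick provides this, and its induction over the
-- zeros is pure algebra on three coefficients. Conjugacy supplies P over ℚ only, so the integrality
-- of P has to be extracted from some monic integral polynomial with root q, by division and Gauss's
-- lemma.

open import Algebra.Bundles using (CommutativeRing)
import Algebra.Solver.Ring.AlmostCommutativeRing as ACR
import Algebra.Solver.Ring.Simple
open import Data.Empty using (⊥)
open import Data.Fin.Base using (zero; suc)
open import Data.Integer.Base as ℤ using (ℤ; 0ℤ)
import Data.Integer.Properties as ℤ
import Data.Integer.Solver as ℤ
open import Data.List.Base as List using (List; []; _∷_)
import Data.List.Properties as List
open import Data.Nat.Base as ℕ using (ℕ; zero; suc; s≤s; z≤n)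
import Data.Nat.Coprimality as ℕ
import Data.Nat.Divisibility as ℕ
import Data.Nat.ListAction as ℕ
open import Data.Nat.Primality using (Prime; prime⇒nonZero; prime⇒nonTrivial; euclidsLemma)
open import Data.Nat.Primality.Factorisation using (PrimeFactorisation; factorise)
import Data.Nat.Properties as ℕ
open import Data.Product.Base using (∃; _×_; _,_; proj₁; proj₂)
open import Data.Rational.Base as ℚ using (ℚ; mkℚ; 0ℚ; 1ℚ; ½; toℚᵘ)
import Data.Rational.Properties as ℚ
import Data.Rational.Solver as ℚ
import Data.Rational.Unnormalised.Base as ℚᵘ
import Data.Rational.Unnormalised.Properties as ℚᵘ
open import Data.Sum.Base using (_⊎_; inj₁; inj₂)
open import Data.Vec.Base as Vec using (Vec; []; _∷_; map; lookup; toList)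
open import Data.Vec.Relation.Unary.All using (All; []; _∷_)
open import Level using (0ℓ)
open import Relation.Nullary using (¬_; Dec; yes; no; contradiction)
open import Relation.Binary.PropositionalEquality
  using (_≡_; _≢_; refl; sym; trans; cong; cong₂; subst; subst₂; isEquivalence; module ≡-Reasoning)

-- Order in the rationals.

module RationalOrder where

  open import Data.Rational.Base using (ℚ; 0ℚ; 1ℚ; _+_; _-_; _*_; -_; 1/_; _≤_; _<_; positive; nonNegative)
  open import Data.Rational.Properties
  open import Data.Rational.Solver
  open +-*-Solver

  0<1 : 0ℚ < 1ℚ
  0<1 = positive⁻¹ 1ℚ

  0≤1 : 0ℚ ≤ 1ℚ
  0≤1 = nonNegative⁻¹ 1ℚ

  0≤+ : ∀ {x y} → 0ℚ ≤ x → 0ℚ ≤ y → 0ℚ ≤ x + y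
  0≤+ = +-mono-≤

  *-mono : ∀ {a b c d} → 0ℚ ≤ b → 0ℚ ≤ c → a ≤ b → c ≤ d → a * c ≤ b * d
  *-mono {b = b} {c = c} 0≤b 0≤c a≤b c≤d = ≤-trans
    (*-monoʳ-≤-nonNeg c {{nonNegative 0≤c}} a≤b)
    (*-monoˡ-≤-nonNeg b {{nonNegative 0≤b}} c≤d)

  0≤* : ∀ {x y} → 0ℚ ≤ x → 0ℚ ≤ y → 0ℚ ≤ x * y
  0≤* {x} {y} 0≤x 0≤y = subst (_≤ x * y) (*-zeroˡ 0ℚ) (*-mono 0≤x ≤-refl 0≤x 0≤y)

  0<* : ∀ {x y} → 0ℚ < x → 0ℚ < y → 0ℚ < x * y
  0<* {x} {y} 0<x 0<y = positive⁻¹ (x * y)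
    {{pos*pos⇒pos x {{positive 0<x}} y {{positive 0<y}}}}

  0<+ : ∀ {x y} → 0ℚ < x → 0ℚ ≤ y → 0ℚ < x + y
  0<+ = +-mono-<-≤

  0<+′ : ∀ {x y} → 0ℚ ≤ x → 0ℚ < y → 0ℚ < x + y
  0<+′ = +-mono-≤-<

  0≤x² : ∀ x → 0ℚ ≤ x * x
  0≤x² x with 0ℚ ≤? x
  ... | yes 0≤x = 0≤* 0≤x 0≤x
  ... | no  0≰x = subst (0ℚ ≤_) (solve 1 (λ x → (:- x) :* (:- x) := x :* x) refl x)
    (0≤* (neg-antimono-≤ (<⇒≤ (≰⇒> 0≰x))) (neg-antimono-≤ (<⇒≤ (≰⇒> 0≰x))))

  private
    shift : ∀ {x y d} → y - x ≡ d → x + d ≡ y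
    shift {x} {y} refl = solve 2 (λ x y → x :+ (y :- x) := y) refl x y

  -- The format of most inequalities below: the difference of the two sides is given as a visibly
  -- nonnegative expression `d`, and the equation is left to the ring solver.
  ≤-from : ∀ {x y d} → 0ℚ ≤ d → y - x ≡ d → x ≤ y
  ≤-from {x} 0≤d eq = subst₂ _≤_ (+-identityʳ x) (shift eq) (+-monoʳ-≤ x 0≤d)

  <-from : ∀ {x y d} → 0ℚ < d → y - x ≡ d → x < y
  <-from {x} 0<d eq = subst₂ _<_ (+-identityʳ x) (shift eq) (+-monoʳ-< x 0<d)

  ≤⇒0≤- : ∀ {x y} → x ≤ y → 0ℚ ≤ y - x
  ≤⇒0≤- {x} {y} x≤y = subst (_≤ y - x) (+-inverseʳ x) (+-monoˡ-≤ (- x) x≤y)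

  <⇒0<- : ∀ {x y} → x < y → 0ℚ < y - x
  <⇒0<- {x} {y} x<y = subst (_< y - x) (+-inverseʳ x) (+-monoˡ-< (- x) x<y)

  reciprocal : ∀ {x} → 0ℚ < x → ∃ λ y → 0ℚ < y × x * y ≡ 1ℚ
  reciprocal {x} 0<x = (1/ x) {{x≢0}} , positive⁻¹ _ {{1/pos⇒pos x {{positive 0<x}}}}
    , *-inverseʳ x {{x≢0}}
    where
    x≢0 = pos⇒nonZero x {{positive 0<x}}

  quotient : ∀ {b e} → 0ℚ < b → 0ℚ < e → ∃ λ d → 0ℚ < d × b * d ≡ e
  quotient {b} {e} 0<b 0<e with reciprocal 0<b
  ... | b⁻¹ , 0<b⁻¹ , bb⁻¹≡1 = b⁻¹ * e , 0<* 0<b⁻¹ 0<e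
    , trans (sym (*-assoc b b⁻¹ e)) (trans (cong (_* e) bb⁻¹≡1) (*-identityˡ e))

  ≤-cancelˡ : ∀ {r x y} → 0ℚ < r → r * x ≤ r * y → x ≤ y
  ≤-cancelˡ {r} 0<r = *-cancelˡ-≤-pos r {{positive 0<r}}

  half+half : ∀ x → ½ * x + ½ * x ≡ x
  half+half = solve 1 (λ x → con ½ :* x :+ con ½ :* x := x) refl

  0<half : ∀ {x} → 0ℚ < x → 0ℚ < ½ * x
  0<half 0<x = 0<* (positive⁻¹ ½) 0<x

  sum< : ∀ {ε} a b → a < ½ * ε → b < ½ * ε → a + b < ε
  sum< {ε} a b a< b< = subst (a + b <_) (half+half ε) (+-mono-< a< b<)

  smaller : ∀ {a b} → 0ℚ < a → 0ℚ < b → ∃ λ c → 0ℚ < c × c ≤ a × c ≤ b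
  smaller {a} {b} 0<a 0<b with ≤-total a b
  ... | inj₁ a≤b = a , 0<a , ≤-refl , a≤b
  ... | inj₂ b≤a = b , 0<b , b≤a , ≤-refl

  square-cancel-≤ : ∀ {s t} → 0ℚ ≤ t → s * s ≤ t * t → s ≤ t
  square-cancel-≤ {s} {t} 0≤t s²≤t² with s ≤? t
  ... | yes s≤t = s≤t
  ... | no  s≰t = contradiction (≤-<-trans s²≤t² (<-from
      (0<* (<⇒0<- t<s) (0<+ (≤-<-trans 0≤t t<s) 0≤t))
      (solve 2 (λ s t → s :* s :- t :* t := (s :- t) :* (s :+ t)) refl s t)))
    (<-irrefl refl)
    where
    t<s = ≰⇒> s≰t

-- The Archimedean property and powers of 1/2.

module Archimedean where

  open import Data.Integer.Base using (+_; -[1+_])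
  open import Data.Rational.Base
  open import Data.Rational.Properties
  open import Data.Rational.Solver
  open RationalOrder
  open +-*-Solver

  -- Repeated addition, so that a walk gaining a fixed amount per step can consume one summand per
  -- recursive call.
  multiple : ℕ → ℚ → ℚ
  multiple zero    x = 0ℚ
  multiple (suc k) x = x + multiple k x

  multiple-* : ∀ k x y → multiple k x * y ≡ multiple k (x * y)
  multiple-* zero    x y = *-zeroˡ y
  multiple-* (suc k) x y = trans (*-distribʳ-+ y x (multiple k x)) (cong (λ t → x * y + t) (multiple-* k x y))

  0≤multiple : ∀ k {x} → 0ℚ ≤ x → 0ℚ ≤ multiple k x
  0≤multiple zero    0≤x = ≤-refl
  0≤multiple (suc k) 0≤x = 0≤+ 0≤x (0≤multiple k 0≤x)

  private
    whole : ℕ → ℚ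
    whole k = mkℚ (+ k) 0 (ℕ.sym (ℕ.1-coprimeTo k))

    whole≡multiple : ∀ k → whole k ≡ multiple k 1ℚ
    whole≡multiple zero    = refl
    whole≡multiple (suc k) = trans
      (toℚᵘ-injective (ℚᵘ.≃-trans
        (ℚᵘ.*≡* (cong (ℤ._* + 1) (cong (λ t → + 1 ℤ.+ t) (sym (ℤ.*-identityʳ (+ k))))))
        (ℚᵘ.≃-sym (toℚᵘ-homo-+ 1ℚ (whole k)))))
      (cong (λ t → 1ℚ + t) (whole≡multiple k))

    below-whole : ∀ x → ∃ λ k → x < whole k
    below-whole (mkℚ (+ n) d-1 _) = suc n , *<* (subst₂ ℤ._<_
      (ℤ.pos-* n 1) (ℤ.pos-* (suc n) (suc d-1))
      (ℤ.+<+ (subst (ℕ._< suc n ℕ.* suc d-1) (sym (ℕ.*-identityʳ n))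
        (ℕ.<-≤-trans (ℕ.n<1+n n) (ℕ.m≤m*n (suc n) (suc d-1))))))
    below-whole x@(mkℚ -[1+ n ] d-1 _) = 0 , negative⁻¹ x

  archimedean : ∀ {x} → 0ℚ < x → ∀ b → ∃ λ k → b < multiple k x
  archimedean {x} 0<x b with reciprocal 0<x
  ... | x⁻¹ , 0<x⁻¹ , xx⁻¹≡1 with below-whole (b * x⁻¹)
  ... | k , bx⁻¹<k = k , subst₂ _<_
    (trans (*-assoc b x⁻¹ x) (trans (cong (b *_) (trans (*-comm x⁻¹ x) xx⁻¹≡1)) (*-identityʳ b)))
    (trans (cong (_* x) (whole≡multiple k))
      (trans (multiple-* k 1ℚ x) (cong (multiple k) (*-identityˡ x))))
    (*-monoˡ-<-pos x {{positive 0<x}} bx⁻¹<k)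

  halving : ℕ → ℚ
  halving zero    = 1ℚ
  halving (suc j) = ½ * halving j

  0<halving : ∀ j → 0ℚ < halving j
  0<halving zero    = 0<1
  0<halving (suc j) = 0<* (positive⁻¹ ½) (0<halving j)

  halving≤1 : ∀ j → halving j ≤ 1ℚ
  halving≤1 zero    = ≤-refl
  halving≤1 (suc j) = ≤-trans (*-mono {a = ½} 0≤1 (<⇒≤ (0<halving j))
    (≤-from {d = ½} (nonNegative⁻¹ ½) refl) (halving≤1 j)) (≤-reflexive (*-identityˡ 1ℚ))

  halving-antitone : ∀ k j → halving (k ℕ.+ j) ≤ halving j
  halving-antitone zero    j = ≤-refl
  halving-antitone (suc k) j = ≤-trans (≤-from {d = ½ * halving (k ℕ.+ j)}
      (<⇒≤ (0<* (positive⁻¹ ½) (0<halving (k ℕ.+ j))))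
      (solve 1 (λ x → x :- con ½ :* x := con ½ :* x) refl (halving (k ℕ.+ j))))
    (halving-antitone k j)

  private
    -- The bound j/2ʲ ≤ 1 turns the Archimedean property into convergence: if 1 < J ε, then J/2ᴶ ≤ 1
    -- < J ε and hence 2⁻ᴶ < ε.
    multiple*halving≤1 : ∀ j → multiple j 1ℚ * halving j ≤ 1ℚ
    multiple*halving≤1 zero    = subst (_≤ 1ℚ) (sym (*-zeroˡ 1ℚ)) 0≤1
    multiple*halving≤1 (suc j) = ≤-from
      (0≤+ (0≤* (nonNegative⁻¹ ½) (≤⇒0≤- (halving≤1 j)))
           (0≤* (nonNegative⁻¹ ½) (≤⇒0≤- (multiple*halving≤1 j))))
      (solve 2 (λ m h → con 1ℚ :- (con 1ℚ :+ m) :* (con ½ :* h)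
        := con ½ :* (con 1ℚ :- h) :+ con ½ :* (con 1ℚ :- m :* h)) refl (multiple j 1ℚ) (halving j))

  halving-small : ∀ {ε} → 0ℚ < ε → ∃ λ J → ∀ j → J ℕ.≤ j → halving j < ε
  halving-small {ε} 0<ε with archimedean 0<ε 1ℚ
  ... | J , 1<Jε = J , λ j J≤j → ≤-<-trans
      (subst (λ i → halving i ≤ halving J) (ℕ.m∸n+n≡m J≤j) (halving-antitone (j ℕ.∸ J) J))
      (small J 1<Jε)
    where
    small : ∀ J → 1ℚ < multiple J ε → halving J < ε
    small J 1<Jε = *-cancelˡ-<-nonNeg (multiple J 1ℚ)
      {{nonNegative (0≤multiple J 0≤1)}}
      (≤-<-trans (multiple*halving≤1 J) (subst (1ℚ <_)
        (sym (trans (multiple-* J 1ℚ ε) (cong (multiple J) (*-identityˡ ε)))) 1<Jε))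

-- Gaussian rationals and their norms.

module Gaussian where

  open import Data.Rational.Base using (_≤_; _<_; ∣_∣)
  open RationalOrder

  -- Without eta, and with operations defined by matching, compound terms stay folded instead of
  -- expanding into pairs of rational expressions.
  record 𝔾 : Set where
    no-eta-equality
    pattern
    constructor _⊹_
    field
      re im : ℚ

  open 𝔾 public

  infix  8 -_ _̄
  infixl 7 _*_
  infixl 6 _+_ _-_
  infix  4 _≟_

  _+_ _*_ : 𝔾 → 𝔾 → 𝔾
  (a ⊹ b) + (c ⊹ d) = (a ℚ.+ c) ⊹ (b ℚ.+ d)
  (a ⊹ b) * (c ⊹ d) = (a ℚ.* c ℚ.- b ℚ.* d) ⊹ (a ℚ.* d ℚ.+ b ℚ.* c)

  -_ _̄ : 𝔾 → 𝔾
  - (a ⊹ b) = (ℚ.- a) ⊹ (ℚ.- b)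
  (a ⊹ b) ̄ = a ⊹ (ℚ.- b)

  _-_ : 𝔾 → 𝔾 → 𝔾
  z - w = z + (- w)

  real : ℚ → 𝔾
  real a = a ⊹ 0ℚ

  0𝔾 1𝔾 i𝔾 : 𝔾
  0𝔾 = real 0ℚ
  1𝔾 = real 1ℚ
  i𝔾 = 0ℚ ⊹ 1ℚ

  _≟_ : (z w : 𝔾) → Dec (z ≡ w)
  (a ⊹ b) ≟ (c ⊹ d) with a ℚ.≟ c | b ℚ.≟ d
  ... | yes refl | yes refl = yes refl
  ... | no  a≢c  | _        = no λ { refl → a≢c refl }
  ... | _        | no b≢d   = no λ { refl → b≢d refl }

  open ℚ.+-*-Solver using (solve; con; _:+_; _:*_; _:-_; :-_; _:=_)

  𝔾-commutativeRing : CommutativeRing 0ℓ 0ℓ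
  𝔾-commutativeRing = record
    { _≈_ = _≡_
    ; _+_ = _+_
    ; _*_ = _*_
    ; -_  = λ z → - z
    ; 0#  = 0𝔾
    ; 1#  = 1𝔾
    ; isCommutativeRing = record
      { isRing = record
        { +-isAbelianGroup = record
          { isGroup = record
            { isMonoid = record
              { isSemigroup = record
                { isMagma = record { isEquivalence = isEquivalence ; ∙-cong = cong₂ _+_ }
                ; assoc = λ { (a ⊹ b) (c ⊹ d) (e ⊹ f) → cong₂ _⊹_ (ℚ.+-assoc a c e) (ℚ.+-assoc b d f) }
                }
              ; identity = (λ { (a ⊹ b) → cong₂ _⊹_ (ℚ.+-identityˡ a) (ℚ.+-identityˡ b) })
                         , (λ { (a ⊹ b) → cong₂ _⊹_ (ℚ.+-identityʳ a) (ℚ.+-identityʳ b) })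
              }
            ; inverse = (λ { (a ⊹ b) → cong₂ _⊹_ (ℚ.+-inverseˡ a) (ℚ.+-inverseˡ b) })
                      , (λ { (a ⊹ b) → cong₂ _⊹_ (ℚ.+-inverseʳ a) (ℚ.+-inverseʳ b) })
            ; ⁻¹-cong = cong (λ z → - z)
            }
          ; comm = λ { (a ⊹ b) (c ⊹ d) → cong₂ _⊹_ (ℚ.+-comm a c) (ℚ.+-comm b d) }
          }
        ; *-cong = cong₂ _*_
        ; *-assoc = λ { (a ⊹ b) (c ⊹ d) (e ⊹ f) → cong₂ _⊹_
            (solve 6 (λ a b c d e f →
              (a :* c :- b :* d) :* e :- (a :* d :+ b :* c) :* f
              := a :* (c :* e :- d :* f) :- b :* (c :* f :+ d :* e)) refl a b c d e f)
            (solve 6 (λ a b c d e f →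
              (a :* c :- b :* d) :* f :+ (a :* d :+ b :* c) :* e
              := a :* (c :* f :+ d :* e) :+ b :* (c :* e :- d :* f)) refl a b c d e f) }
        ; *-identity = identityˡ , λ z → trans (*-comm z 1𝔾) (identityˡ z)
        ; distrib = distribˡ , λ z w v → trans (*-comm (w + v) z)
            (trans (distribˡ z w v) (cong₂ _+_ (*-comm z w) (*-comm z v)))
        }
      ; *-comm = *-comm
      }
    }
    where
    *-comm : ∀ z w → z * w ≡ w * z
    *-comm (a ⊹ b) (c ⊹ d) = cong₂ _⊹_
      (solve 4 (λ a b c d → a :* c :- b :* d := c :* a :- d :* b) refl a b c d)
      (solve 4 (λ a b c d → a :* d :+ b :* c := c :* b :+ d :* a) refl a b c d)
    identityˡ : ∀ z → 1𝔾 * z ≡ z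
    identityˡ (a ⊹ b) = cong₂ _⊹_
      (solve 2 (λ a b → con 1ℚ :* a :- con 0ℚ :* b := a) refl a b)
      (solve 2 (λ a b → con 1ℚ :* b :+ con 0ℚ :* a := b) refl a b)
    distribˡ : ∀ z w v → z * (w + v) ≡ z * w + z * v
    distribˡ (a ⊹ b) (c ⊹ d) (e ⊹ f) = cong₂ _⊹_
      (solve 6 (λ a b c d e f →
        a :* (c :+ e) :- b :* (d :+ f) := (a :* c :- b :* d) :+ (a :* e :- b :* f)) refl a b c d e f)
      (solve 6 (λ a b c d e f →
        a :* (d :+ f) :+ b :* (c :+ e) := (a :* d :+ b :* c) :+ (a :* f :+ b :* e)) refl a b c d e f)

  open CommutativeRing 𝔾-commutativeRing public using
    (+-assoc; +-comm; +-identityˡ; +-identityʳ; -‿inverseˡ; -‿inverseʳ; *-assoc; *-comm;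
     *-identityˡ; *-identityʳ; distribˡ; distribʳ; zeroˡ; zeroʳ)

  module 𝔾-Solver = Algebra.Solver.Ring.Simple (ACR.fromCommutativeRing 𝔾-commutativeRing) _≟_

  -- The modulus of a Gaussian rational may be irrational. The ℓ¹ norm `‖_‖` replaces it in
  -- estimates; the squared modulus `N` is exactly multiplicative. They are tied by N ≤ ‖ ‖² ≤ 2 N.
  ‖_‖ N : 𝔾 → ℚ
  ‖ a ⊹ b ‖ = ∣ a ∣ ℚ.+ ∣ b ∣
  N (a ⊹ b) = a ℚ.* a ℚ.+ b ℚ.* b

  0≤‖_‖ : ∀ z → 0ℚ ≤ ‖ z ‖
  0≤‖ a ⊹ b ‖ = 0≤+ (ℚ.0≤∣p∣ a) (ℚ.0≤∣p∣ b)

  ‖0‖≡0 : ‖ 0𝔾 ‖ ≡ 0ℚ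
  ‖0‖≡0 = refl

  ‖-‖ : ∀ z → ‖ - z ‖ ≡ ‖ z ‖
  ‖-‖ (a ⊹ b) = cong₂ ℚ._+_ (ℚ.∣-p∣≡∣p∣ a) (ℚ.∣-p∣≡∣p∣ b)

  ‖̄‖ : ∀ z → ‖ z ̄ ‖ ≡ ‖ z ‖
  ‖̄‖ (a ⊹ b) = cong (∣ a ∣ ℚ.+_) (ℚ.∣-p∣≡∣p∣ b)

  ‖real‖ : ∀ a → ‖ real a ‖ ≡ ∣ a ∣
  ‖real‖ a = ℚ.+-identityʳ ∣ a ∣

  ‖+‖ : ∀ z w → ‖ z + w ‖ ≤ ‖ z ‖ ℚ.+ ‖ w ‖
  ‖+‖ (a ⊹ b) (c ⊹ d) = ℚ.≤-trans
    (ℚ.+-mono-≤ (ℚ.∣p+q∣≤∣p∣+∣q∣ a c) (ℚ.∣p+q∣≤∣p∣+∣q∣ b d))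
    (ℚ.≤-reflexive (solve 4 (λ a b c d → (a :+ c) :+ (b :+ d) := (a :+ b) :+ (c :+ d))
      refl (∣ a ∣) (∣ b ∣) (∣ c ∣) (∣ d ∣)))

  ‖*‖ : ∀ z w → ‖ z * w ‖ ≤ ‖ z ‖ ℚ.* ‖ w ‖
  ‖*‖ (a ⊹ b) (c ⊹ d) = ℚ.≤-trans
    (ℚ.+-mono-≤
      (ℚ.≤-trans (ℚ.∣p-q∣≤∣p∣+∣q∣ (a ℚ.* c) (b ℚ.* d))
        (ℚ.≤-reflexive (cong₂ ℚ._+_ (ℚ.∣p*q∣≡∣p∣*∣q∣ a c) (ℚ.∣p*q∣≡∣p∣*∣q∣ b d))))
      (ℚ.≤-trans (ℚ.∣p+q∣≤∣p∣+∣q∣ (a ℚ.* d) (b ℚ.* c))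
        (ℚ.≤-reflexive (cong₂ ℚ._+_ (ℚ.∣p*q∣≡∣p∣*∣q∣ a d) (ℚ.∣p*q∣≡∣p∣*∣q∣ b c)))))
    (ℚ.≤-reflexive (solve 4 (λ a b c d →
      (a :* c :+ b :* d) :+ (a :* d :+ b :* c) := (a :+ b) :* (c :+ d))
      refl (∣ a ∣) (∣ b ∣) (∣ c ∣) (∣ d ∣)))

  ∣_∣² : ∀ a → ∣ a ∣ ℚ.* ∣ a ∣ ≡ a ℚ.* a
  ∣ a ∣² = trans (sym (ℚ.∣p*q∣≡∣p∣*∣q∣ a a)) (ℚ.0≤p⇒∣p∣≡p (0≤x² a))

  2ℚ : ℚ
  2ℚ = 1ℚ ℚ.+ 1ℚ

  N-* : ∀ z w → N (z * w) ≡ N z ℚ.* N w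
  N-* (a ⊹ b) (c ⊹ d) = solve 4 (λ a b c d →
    (a :* c :- b :* d) :* (a :* c :- b :* d) :+ (a :* d :+ b :* c) :* (a :* d :+ b :* c)
    := (a :* a :+ b :* b) :* (c :* c :+ d :* d)) refl a b c d

  N-neg : ∀ z → N (- z) ≡ N z
  N-neg (a ⊹ b) = solve 2 (λ a b → (:- a) :* (:- a) :+ (:- b) :* (:- b) := a :* a :+ b :* b) refl a b

  re²≤N : ∀ z → re z ℚ.* re z ≤ N z
  re²≤N (a ⊹ b) = ≤-from (0≤x² b) (solve 2 (λ a b → (a :* a :+ b :* b) :- a :* a := b :* b) refl a b)

  0≤N : ∀ z → 0ℚ ≤ N z
  0≤N (a ⊹ b) = 0≤+ (0≤x² a) (0≤x² b)

  N≤‖‖² : ∀ z → N z ≤ ‖ z ‖ ℚ.* ‖ z ‖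
  N≤‖‖² (a ⊹ b) = subst (_≤ ‖ a ⊹ b ‖ ℚ.* ‖ a ⊹ b ‖) (cong₂ ℚ._+_ ∣ a ∣² ∣ b ∣²)
    (≤-from (0≤* (ℚ.nonNegative⁻¹ 2ℚ) (0≤* (ℚ.0≤∣p∣ a) (ℚ.0≤∣p∣ b)))
      (solve 2 (λ a b → (a :+ b) :* (a :+ b) :- (a :* a :+ b :* b) := con 2ℚ :* (a :* b))
        refl (∣ a ∣) (∣ b ∣)))

  ‖‖²≤2N : ∀ z → ‖ z ‖ ℚ.* ‖ z ‖ ≤ 2ℚ ℚ.* N z
  ‖‖²≤2N (a ⊹ b) = subst (λ n → ‖ a ⊹ b ‖ ℚ.* ‖ a ⊹ b ‖ ≤ 2ℚ ℚ.* n)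
    (cong₂ ℚ._+_ ∣ a ∣² ∣ b ∣²)
    (≤-from (0≤x² (∣ a ∣ ℚ.- ∣ b ∣))
      (solve 2 (λ a b → con 2ℚ :* (a :* a :+ b :* b) :- (a :+ b) :* (a :+ b)
        := (a :- b) :* (a :- b)) refl (∣ a ∣) (∣ b ∣)))

  -- After squaring: ‖z‖² ‖w‖² ≤ 4 N z N w = 4 N (z w) ≤ 4 ‖z w‖². This reverse of
  -- submultiplicativity is what allows cancelling factors and bounding inverses in the ℓ¹ norm.
  ‖‖‖‖≤2‖*‖ : ∀ z w → ‖ z ‖ ℚ.* ‖ w ‖ ≤ 2ℚ ℚ.* ‖ z * w ‖
  ‖‖‖‖≤2‖*‖ z w = square-cancel-≤ (0≤* (ℚ.nonNegative⁻¹ 2ℚ) 0≤‖ z * w ‖) (begin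
    (‖ z ‖ ℚ.* ‖ w ‖) ℚ.* (‖ z ‖ ℚ.* ‖ w ‖)
      ≡⟨ solve 2 (λ z w → (z :* w) :* (z :* w) := (z :* z) :* (w :* w)) refl (‖ z ‖) (‖ w ‖) ⟩
    (‖ z ‖ ℚ.* ‖ z ‖) ℚ.* (‖ w ‖ ℚ.* ‖ w ‖)
      ≤⟨ *-mono (0≤* 0≤2 (0≤N z)) (0≤x² ‖ w ‖) (‖‖²≤2N z) (‖‖²≤2N w) ⟩
    (2ℚ ℚ.* N z) ℚ.* (2ℚ ℚ.* N w)
      ≡⟨ solve 2 (λ z w → (con 2ℚ :* z) :* (con 2ℚ :* w) := con (2ℚ ℚ.* 2ℚ) :* (z :* w))
           refl (N z) (N w) ⟩
    2ℚ ℚ.* 2ℚ ℚ.* (N z ℚ.* N w)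
      ≡⟨ cong (2ℚ ℚ.* 2ℚ ℚ.*_) (sym (N-* z w)) ⟩
    2ℚ ℚ.* 2ℚ ℚ.* N (z * w)
      ≤⟨ *-mono {a = 2ℚ ℚ.* 2ℚ} (0≤* 0≤2 0≤2) (0≤N (z * w)) ℚ.≤-refl (N≤‖‖² (z * w)) ⟩
    2ℚ ℚ.* 2ℚ ℚ.* (‖ z * w ‖ ℚ.* ‖ z * w ‖)
      ≡⟨ solve 1 (λ v → con (2ℚ ℚ.* 2ℚ) :* (v :* v) := (con 2ℚ :* v) :* (con 2ℚ :* v))
           refl ‖ z * w ‖ ⟩
    (2ℚ ℚ.* ‖ z * w ‖) ℚ.* (2ℚ ℚ.* ‖ z * w ‖) ∎)
    where
    open ℚ.≤-Reasoning
    0≤2 : 0ℚ ≤ 2ℚ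
    0≤2 = ℚ.nonNegative⁻¹ 2ℚ

  ‖z-w‖-sym : ∀ z w → ‖ z - w ‖ ≡ ‖ w - z ‖
  ‖z-w‖-sym z w = trans (sym (‖-‖ (z - w))) (cong ‖_‖
    (𝔾-Solver.solve 2 (λ z w → G.:- (z G.:- w) G.:= w G.:- z) refl z w))
    where module G = 𝔾-Solver

  infix 4 _≼_
  -- A record in place of the bare inequality lets unification recover `z` and `b` when bounds of
  -- compound expressions are assembled.
  record _≼_ (z : 𝔾) (b : ℚ) : Set where
    constructor bounded
    field
      bound : ‖ z ‖ ≤ b

  open _≼_ public

  ≼-refl : ∀ {z} → z ≼ ‖ z ‖
  ≼-refl = bounded ℚ.≤-refl

  ≼-weaken : ∀ {z b c} → z ≼ b → b ≤ c → z ≼ c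
  ≼-weaken z≼b b≤c = bounded (ℚ.≤-trans (bound z≼b) b≤c)

  +-≼ : ∀ {z w b c} → z ≼ b → w ≼ c → z + w ≼ b ℚ.+ c
  +-≼ {z} {w} z≼b w≼c = bounded (ℚ.≤-trans (‖+‖ z w) (ℚ.+-mono-≤ (bound z≼b) (bound w≼c)))

  neg-≼ : ∀ {z b} → z ≼ b → - z ≼ b
  neg-≼ {z} {b} (bounded z≤b) = bounded (subst (_≤ b) (sym (‖-‖ z)) z≤b)

  *-≼ : ∀ {z w b c} → z ≼ b → w ≼ c → z * w ≼ b ℚ.* c
  *-≼ {z} {w} (bounded z≤b) (bounded w≤c) = bounded (ℚ.≤-trans (‖*‖ z w)
    (*-mono (ℚ.≤-trans 0≤‖ z ‖ z≤b) 0≤‖ w ‖ z≤b w≤c))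

  ∣re∣≤‖_‖ : ∀ z → ∣ re z ∣ ≤ ‖ z ‖
  ∣re∣≤‖ a ⊹ b ‖ = subst (_≤ ∣ a ∣ ℚ.+ ∣ b ∣) (ℚ.+-identityʳ ∣ a ∣) (ℚ.+-monoʳ-≤ ∣ a ∣ (ℚ.0≤∣p∣ b))

  ∣im∣≤‖_‖ : ∀ z → ∣ im z ∣ ≤ ‖ z ‖
  ∣im∣≤‖ a ⊹ b ‖ = subst (_≤ ∣ a ∣ ℚ.+ ∣ b ∣) (ℚ.+-identityˡ ∣ b ∣) (ℚ.+-monoˡ-≤ ∣ b ∣ (ℚ.0≤∣p∣ a))

  ‖z‖≡0⇒z≡0 : ∀ z → ‖ z ‖ ≤ 0ℚ → z ≡ 0𝔾
  ‖z‖≡0⇒z≡0 z@(_ ⊹ _) z≼0 = cong₂ _⊹_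
    (ℚ.∣p∣≡0⇒p≡0 (re z) (ℚ.≤-antisym (ℚ.≤-trans ∣re∣≤‖ z ‖ z≼0) (ℚ.0≤∣p∣ (re z))))
    (ℚ.∣p∣≡0⇒p≡0 (im z) (ℚ.≤-antisym (ℚ.≤-trans ∣im∣≤‖ z ‖ z≼0) (ℚ.0≤∣p∣ (im z))))

  inverse : ∀ z → 0ℚ < ‖ z ‖ → ∃ λ w → z * w ≡ 1𝔾
  inverse z@(a ⊹ b) 0<‖z‖ with reciprocal 0<N
    where
    0<N : 0ℚ < N z
    0<N with 0ℚ ℚ.<? N z
    ... | yes p = p
    ... | no ¬p = contradiction
      (ℚ.<-≤-trans (0<* 0<‖z‖ 0<‖z‖) (ℚ.≤-trans (‖‖²≤2N z)
        (subst (2ℚ ℚ.* N z ≤_) (ℚ.*-zeroʳ 2ℚ)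
          (*-mono {a = 2ℚ} (ℚ.nonNegative⁻¹ 2ℚ) (0≤N z) ℚ.≤-refl (ℚ.≮⇒≥ ¬p)))))
      (ℚ.<-irrefl refl)
  ... | n⁻¹ , _ , eq = (a ℚ.* n⁻¹) ⊹ (ℚ.- b ℚ.* n⁻¹) , cong₂ _⊹_
    (trans (solve 3 (λ a b n → a :* (a :* n) :- b :* (:- b :* n) := (a :* a :+ b :* b) :* n)
      refl a b n⁻¹) eq)
    (solve 3 (λ a b n → a :* (:- b :* n) :+ b :* (a :* n) := con 0ℚ) refl a b n⁻¹)

-- Approximate roots of polynomials over the Gaussian rationals.

module ApproximateRoot where

  open import Data.Rational.Base using (_≤_; _<_; ∣_∣)
  open RationalOrder
  open Archimedean
  open Gaussian

  open ℚ.+-*-Solver using (solve; con; _:+_; _:*_; _:-_; :-_; _:=_)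
  private module G = 𝔾-Solver

  ⟦_⟧ : ∀ {n} → Vec 𝔾 n → 𝔾 → 𝔾
  ⟦ [] ⟧    z = 1𝔾
  ⟦ a ∷ f ⟧ z = a + z * ⟦ f ⟧ z

  -- These are f′ and f″/2, obtained by differentiating Horner's scheme.
  taylor₁ taylor₂ : ∀ {n} → Vec 𝔾 n → 𝔾 → 𝔾
  taylor₁ []      z = 0𝔾
  taylor₁ (a ∷ f) z = ⟦ f ⟧ z + z * taylor₁ f z
  taylor₂ []      z = 0𝔾
  taylor₂ (a ∷ f) z = taylor₁ f z + z * taylor₂ f z

  -- The cubic remainder divided by h³. It depends on h, so that the expansion `taylor` is an exact
  -- identity.
  taylor₃ : ∀ {n} → Vec 𝔾 n → 𝔾 → 𝔾 → 𝔾
  taylor₃ []      z h = 0𝔾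
  taylor₃ (a ∷ f) z h = taylor₂ f z + (z + h) * taylor₃ f z h

  taylor : ∀ {n} (f : Vec 𝔾 n) z h →
    ⟦ f ⟧ (z + h) ≡ ⟦ f ⟧ z + h * (taylor₁ f z + h * (taylor₂ f z + h * taylor₃ f z h))
  taylor [] z h = G.solve 1 (λ h → G.con 1𝔾 G.:=
    G.con 1𝔾 G.:+ h G.:* (G.con 0𝔾 G.:+ h G.:* (G.con 0𝔾 G.:+ h G.:* G.con 0𝔾))) refl h
  taylor (a ∷ f) z h = trans (cong (λ t → a + (z + h) * t) (taylor f z h))
    (G.solve 7 (λ a z h c₀ c₁ c₂ d →
      a G.:+ (z G.:+ h) G.:* (c₀ G.:+ h G.:* (c₁ G.:+ h G.:* (c₂ G.:+ h G.:* d)))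
      G.:= (a G.:+ z G.:* c₀) G.:+ h G.:* ((c₀ G.:+ z G.:* c₁) G.:+ h G.:*
        ((c₁ G.:+ z G.:* c₂) G.:+ h G.:* (c₂ G.:+ (z G.:+ h) G.:* d))))
      refl a z h (⟦ f ⟧ z) (taylor₁ f z) (taylor₂ f z) (taylor₃ f z h))

  taylor-bounded : ∀ {n} (f : Vec 𝔾 n) {R} → 0ℚ ≤ R → ∃ λ B → 0ℚ ≤ B ×
    (∀ {z h} → z ≼ R → h ≼ 1ℚ →
      ⟦ f ⟧ z ≼ B × taylor₁ f z ≼ B × taylor₂ f z ≼ B × taylor₃ f z h ≼ B)
  taylor-bounded [] 0≤R = 1ℚ , 0≤1 , λ _ _ → ≼-refl , 0≼1 , 0≼1 , 0≼1
    where
    0≼1 : 0𝔾 ≼ 1ℚ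
    0≼1 = bounded 0≤1
  taylor-bounded (a ∷ f) {R} 0≤R with taylor-bounded f 0≤R
  ... | B , 0≤B , bound = ‖ a ‖ ℚ.+ B′ , 0≤+ 0≤‖ a ‖ 0≤B′ , λ z≼R h≼1 →
    let b₀ , b₁ , b₂ , b₃ = bound z≼R h≼1
        zb₀ = ≼-weaken (*-≼ z≼R b₀) RB≤B′
    in +-≼ {z = a} ≼-refl zb₀
     , ≼-weaken (+-≼ b₀ (*-≼ z≼R b₁)) B+RB≤
     , ≼-weaken (+-≼ b₁ (*-≼ z≼R b₂)) B+RB≤
     , ≼-weaken (+-≼ b₂ (*-≼ (+-≼ z≼R h≼1) b₃)) B′≤
    where
    B′ = B ℚ.+ (R ℚ.+ 1ℚ) ℚ.* B
    0≤RB = 0≤* 0≤R 0≤B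
    B+RB≤B′ : B ℚ.+ R ℚ.* B ≤ B′
    B+RB≤B′ = ≤-from 0≤B (solve 2 (λ B R →
      (B :+ (R :+ con 1ℚ) :* B) :- (B :+ R :* B) := B) refl B R)
    RB≤B′ : R ℚ.* B ≤ B′
    RB≤B′ = ≤-from (0≤+ 0≤B 0≤B) (solve 2 (λ B R →
      (B :+ (R :+ con 1ℚ) :* B) :- R :* B := B :+ B) refl B R)
    0≤B′ = ℚ.≤-trans 0≤RB RB≤B′
    B′≤ : B′ ≤ ‖ a ‖ ℚ.+ B′
    B′≤ = subst (_≤ ‖ a ‖ ℚ.+ B′) (ℚ.+-identityˡ B′) (ℚ.+-monoˡ-≤ B′ 0≤‖ a ‖)
    B+RB≤ = ℚ.≤-trans B+RB≤B′ B′≤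

  -- Second-order expansion of 1/g, where g = c₀ + h c₁ + h² c₂ + h³ d and v₀ = 1/c₀.
  module Reciprocal (c₁ c₂ v₀ : 𝔾) where
    v₁ v₂ : 𝔾
    v₁ = - (c₁ * v₀ * v₀)
    v₂ = - ((c₁ * v₁ + c₂ * v₀) * v₀)

    remainder : 𝔾 → 𝔾 → 𝔾
    remainder d h = c₁ * v₂ + c₂ * v₁ + h * (c₂ * v₂) + d * (v₀ + h * (v₁ + h * v₂))

    -- The coefficients `v₁` and `v₂` cancel the terms of orders 1 and 2 in g (v₀ + h v₁ + h² v₂),
    -- which leaves 1 + h³ `remainder`; multiplying by i = 1/g gives the expansion.
    expansion : ∀ {c₀ d h i} → c₀ * v₀ ≡ 1𝔾 → (c₀ + h * (c₁ + h * (c₂ + h * d))) * i ≡ 1𝔾 →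
      v₀ + h * (v₁ + h * v₂) ≡ i + h * h * h * (i * remainder d h)
    expansion {c₀} {d} {h} {i} c₀v₀≡1 gi≡1 = trans (sym (*-identityˡ V))
      (trans (cong (_* V) (sym gi≡1)) (trans expand
        (trans (cong (λ u → i * (u + h * (c₁ * v₀ * (1𝔾 - u))
            + h * h * ((c₁ * v₁ + c₂ * v₀) * (1𝔾 - u)) + h * h * h * remainder d h)) c₀v₀≡1)
          collect)))
      where
      V = v₀ + h * (v₁ + h * v₂)
      -- The ring solver cannot use `c₀ * v₀ ≡ 1𝔾`, so every occurrence of that product is kept
      -- visible, with defects `1𝔾 - c₀ * v₀`, and rewritten afterwards.
      expand : (c₀ + h * (c₁ + h * (c₂ + h * d))) * i * V ≡
        i * (c₀ * v₀ + h * (c₁ * v₀ * (1𝔾 - c₀ * v₀))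
          + h * h * ((c₁ * v₁ + c₂ * v₀) * (1𝔾 - c₀ * v₀)) + h * h * h * remainder d h)
      expand = G.solve 7 (λ c₀ c₁ c₂ d h i v₀ →
        let v₁ = G.:- (c₁ G.:* v₀ G.:* v₀)
            v₂ = G.:- ((c₁ G.:* v₁ G.:+ c₂ G.:* v₀) G.:* v₀)
        in (c₀ G.:+ h G.:* (c₁ G.:+ h G.:* (c₂ G.:+ h G.:* d))) G.:* i G.:* (v₀ G.:+ h G.:* (v₁ G.:+ h G.:* v₂))
           G.:= i G.:* (c₀ G.:* v₀ G.:+ h G.:* (c₁ G.:* v₀ G.:* (G.con 1𝔾 G.:- c₀ G.:* v₀))
             G.:+ h G.:* h G.:* ((c₁ G.:* v₁ G.:+ c₂ G.:* v₀) G.:* (G.con 1𝔾 G.:- c₀ G.:* v₀))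
             G.:+ h G.:* h G.:* h G.:* (c₁ G.:* v₂ G.:+ c₂ G.:* v₁ G.:+ h G.:* (c₂ G.:* v₂)
               G.:+ d G.:* (v₀ G.:+ h G.:* (v₁ G.:+ h G.:* v₂)))))
        refl c₀ c₁ c₂ d h i v₀
      collect : i * (1𝔾 + h * (c₁ * v₀ * (1𝔾 - 1𝔾))
          + h * h * ((c₁ * v₁ + c₂ * v₀) * (1𝔾 - 1𝔾)) + h * h * h * remainder d h) ≡
        i + h * h * h * (i * remainder d h)
      collect = G.solve 5 (λ h i a b r →
        i G.:* (G.con 1𝔾 G.:+ h G.:* (a G.:* (G.con 1𝔾 G.:- G.con 1𝔾)) G.:+ h G.:* h G.:* (b G.:* (G.con 1𝔾 G.:- G.con 1𝔾))
          G.:+ h G.:* h G.:* h G.:* r) G.:= i G.:+ h G.:* h G.:* h G.:* (i G.:* r))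
        refl h i (c₁ * v₀) (c₁ * v₁ + c₂ * v₀) (remainder d h)

  data Direction : Set where
    east north west south : Direction

  step : ℚ → Direction → 𝔾
  step δ east  = δ ⊹ 0ℚ
  step δ north = 0ℚ ⊹ δ
  step δ west  = (ℚ.- δ) ⊹ 0ℚ
  step δ south = 0ℚ ⊹ (ℚ.- δ)

  total : (Direction → ℚ) → ℚ
  total φ = (φ east ℚ.+ φ north) ℚ.+ (φ west ℚ.+ φ south)

  4ℚ : ℚ
  4ℚ = 2ℚ ℚ.+ 2ℚ

  0≤4 : 0ℚ ≤ 4ℚ
  0≤4 = ℚ.nonNegative⁻¹ 4ℚ

  total-linear : ∀ ε φ ψ → total φ ℚ.+ ε ℚ.* total ψ ≡ total (λ k → φ k ℚ.+ ε ℚ.* ψ k)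
  total-linear ε φ ψ = trans
    (interchange (φ east ℚ.+ φ north) (φ west ℚ.+ φ south) (ψ east ℚ.+ ψ north) (ψ west ℚ.+ ψ south))
    (cong₂ ℚ._+_ (interchange (φ east) (φ north) (ψ east) (ψ north))
                 (interchange (φ west) (φ south) (ψ west) (ψ south)))
    where
    interchange : ∀ a b c d → (a ℚ.+ b) ℚ.+ ε ℚ.* (c ℚ.+ d) ≡ (a ℚ.+ ε ℚ.* c) ℚ.+ (b ℚ.+ ε ℚ.* d)
    interchange = solve 5 (λ ε a b c d → (a :+ b) :+ ε :* (c :+ d)
      := (a :+ ε :* c) :+ (b :+ ε :* d)) refl ε

  above-average : ∀ φ {x} → 4ℚ ℚ.* x ≤ total φ → ∃ λ k → x ≤ φ k
  above-average φ {x} 4x≤ with x ℚ.≤? φ east | x ℚ.≤? φ north | x ℚ.≤? φ west | x ℚ.≤? φ south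
  ... | yes p | _ | _ | _ = east , p
  ... | _ | yes p | _ | _ = north , p
  ... | _ | _ | yes p | _ = west , p
  ... | _ | _ | _ | yes p = south , p
  ... | no a | no b | no c | no d = contradiction
    (ℚ.≤-<-trans 4x≤ (subst (total φ <_)
      (solve 1 (λ x → (x :+ x) :+ (x :+ x) := con 4ℚ :* x) refl x)
      (ℚ.+-mono-< (ℚ.+-mono-< (ℚ.≰⇒> a) (ℚ.≰⇒> b)) (ℚ.+-mono-< (ℚ.≰⇒> c) (ℚ.≰⇒> d)))))
    (ℚ.<-irrefl refl)

  step-≼ : ∀ {δ} → 0ℚ ≤ δ → ∀ k → step δ k ≼ δ
  step-≼ {δ} 0≤δ east  = bounded (ℚ.≤-reflexive (trans (ℚ.+-identityʳ ∣ δ ∣) (ℚ.0≤p⇒∣p∣≡p 0≤δ)))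
  step-≼ {δ} 0≤δ north = bounded (ℚ.≤-reflexive (trans (ℚ.+-identityˡ ∣ δ ∣) (ℚ.0≤p⇒∣p∣≡p 0≤δ)))
  step-≼ {δ} 0≤δ west  = neg-≼ {step δ east} (step-≼ 0≤δ east)
  step-≼ {δ} 0≤δ south = neg-≼ {step δ north} (step-≼ 0≤δ north)

  -- The discrete Laplacian of |z|² is a positive constant: its mean over the neighbours exceeds the
  -- central value by δ². This is the gain in each step of the ascent.
  total-N : ∀ δ z → total (λ k → N (z + step δ k)) ≡ 4ℚ ℚ.* (N z ℚ.+ δ ℚ.* δ)
  total-N δ (a ⊹ b) = solve 3 (λ a b δ →
    let n = λ x y → x :* x :+ y :* y
    in (n (a :+ δ) (b :+ con 0ℚ) :+ n (a :+ con 0ℚ) (b :+ δ))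
       :+ (n (a :+ :- δ) (b :+ con 0ℚ) :+ n (a :+ con 0ℚ) (b :+ :- δ))
       := con 4ℚ :* ((a :* a :+ b :* b) :+ δ :* δ)) refl a b δ

  private
    4𝔾 : 𝔾 → 𝔾
    4𝔾 v = (v + v) + (v + v)

    -- The four steps are δ times the fourth roots of unity, whose sum and whose sum of squares
    -- vanish; only the constant term of a quadratic survives.
    total-quadratic : ∀ δ v₀ v₁ v₂ → let q = λ k → v₀ + step δ k * (v₁ + step δ k * v₂) in
      (q east + q north) + (q west + q south) ≡ 4𝔾 v₀
    total-quadratic δ v₀ v₁ v₂ = trans
      (cong (λ h → (q (step δ east) + q h) + (q (step δ west) + q (- h))) north≡)
      (G.solve 4 (λ v₀ v₁ v₂ h →
        let q = λ h → v₀ G.:+ h G.:* (v₁ G.:+ h G.:* v₂)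
        in (q h G.:+ q (G.con i𝔾 G.:* h)) G.:+ (q (G.:- h) G.:+ q (G.:- (G.con i𝔾 G.:* h)))
           G.:= (v₀ G.:+ v₀) G.:+ (v₀ G.:+ v₀)) refl v₀ v₁ v₂ (step δ east))
      where
      q : 𝔾 → 𝔾
      q h = v₀ + h * (v₁ + h * v₂)
      north≡ : step δ north ≡ i𝔾 * step δ east
      north≡ = cong₂ _⊹_
        (solve 1 (λ δ → con 0ℚ := con 0ℚ :* δ :- con 1ℚ :* con 0ℚ) refl δ)
        (solve 1 (λ δ → δ := con 0ℚ :* con 0ℚ :+ con 1ℚ :* δ) refl δ)

    ¼ : ℚ
    ¼ = ½ ℚ.* ½

    ‖4𝔾‖ : ∀ v → 4ℚ ℚ.* ‖ v ‖ ≤ ‖ 4𝔾 v ‖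
    ‖4𝔾‖ v = subst (4ℚ ℚ.* ‖ v ‖ ≤_)
      (solve 1 (λ x → con 4ℚ :* (con ¼ :* x) := x) refl ‖ 4𝔾 v ‖)
      (*-mono {a = 4ℚ} 0≤4 0≤‖ v ‖ ℚ.≤-refl (subst (λ w → ‖ w ‖ ≤ ¼ ℚ.* ‖ 4𝔾 v ‖)
        (G.solve 1 (λ v → G.con (real ¼) G.:* ((v G.:+ v) G.:+ (v G.:+ v)) G.:= v) refl v)
        (‖*‖ (real ¼) (4𝔾 v))))

  -- The loss has order δ³, one order smaller than the gain ε δ² that comes from `total-N`; hence
  -- the expansion of 1/f to second order.
  mean-bound : ∀ {δ C v₀ v₁ v₂} (i r : Direction → 𝔾) → 0ℚ ≤ δ → (∀ k → r k ≼ C) →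
    (∀ k → let h = step δ k in v₀ + h * (v₁ + h * v₂) ≡ i k + h * h * h * r k) →
    4ℚ ℚ.* ‖ v₀ ‖ ≤ total (λ k → ‖ i k ‖) ℚ.+ 4ℚ ℚ.* (δ ℚ.* δ ℚ.* δ ℚ.* C)
  mean-bound {δ} {C} {v₀} {v₁} {v₂} i r 0≤δ r≼C eq = ℚ.≤-trans (‖4𝔾‖ v₀)
    (subst₂ ℚ._≤_
      (cong ‖_‖ (trans (cong₂ _+_ (cong₂ _+_ (sym (eq east)) (sym (eq north)))
                                  (cong₂ _+_ (sym (eq west)) (sym (eq south))))
        (total-quadratic δ v₀ v₁ v₂)))
      (solve 5 (λ a b c d e →
        ((a :+ e) :+ (b :+ e)) :+ ((c :+ e) :+ (d :+ e))
        := (a :+ b) :+ (c :+ d) :+ con 4ℚ :* e) refl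
        (‖ i east ‖) (‖ i north ‖) (‖ i west ‖) (‖ i south ‖) (δ ℚ.* δ ℚ.* δ ℚ.* C))
      (bound (+-≼ (+-≼ (term east) (term north)) (+-≼ (term west) (term south)))))
    where
    term : ∀ k → i k + step δ k * step δ k * step δ k * r k ≼ ‖ i k ‖ ℚ.+ δ ℚ.* δ ℚ.* δ ℚ.* C
    term k = let h≼δ = step-≼ 0≤δ k in +-≼ ≼-refl (*-≼ (*-≼ (*-≼ h≼δ h≼δ) h≼δ) (r≼C k))

  -- Growth along Horner's scheme: where ‖f(z)‖ ≥ 1, the reverse product bound gives ‖z f(z)‖ ≥
  -- ‖z‖/2, which for large z exceeds M + ‖a‖. The constant polynomial 1 satisfies only the weaker
  -- bound, so two mutual statements are proved.
  coercive : ∀ {n} (f : Vec 𝔾 n) → ∃ λ R → 0ℚ ≤ R × (∀ z → R ≤ ‖ z ‖ → 1ℚ ≤ ‖ ⟦ f ⟧ z ‖)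
  coercive-unbounded : ∀ {n} (f : Vec 𝔾 (suc n)) {M} → 0ℚ ≤ M →
    ∃ λ R → 0ℚ ≤ R × (∀ z → R ≤ ‖ z ‖ → M ≤ ‖ ⟦ f ⟧ z ‖)
  coercive []        = 0ℚ , ℚ.≤-refl , λ _ _ → ℚ.≤-refl
  coercive f@(_ ∷ _) = coercive-unbounded f 0≤1
  coercive-unbounded (a ∷ f) {M} 0≤M with coercive f
  ... | R , 0≤R , far = R ℚ.+ R′ , 0≤+ 0≤R 0≤R′ , λ z R+R′≤z →
    let 1≤fz = far z (ℚ.≤-trans (≤-from 0≤R′ (solve 2 (λ R S → (R :+ S) :- R := S) refl R R′)) R+R′≤z)
        R′≤z = ℚ.≤-trans (≤-from 0≤R (solve 2 (λ R S → (R :+ S) :- S := R) refl R R′)) R+R′≤z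
    in ≤-cancelˡ (ℚ.positive⁻¹ 2ℚ) (conclude (‖ z ‖) (‖ ⟦ f ⟧ z ‖) (‖ z * ⟦ f ⟧ z ‖) (‖ a + z * ⟦ f ⟧ z ‖)
         R′≤z 1≤fz (‖‖‖‖≤2‖*‖ z (⟦ f ⟧ z)) (triangle z))
    where
    R′ = 2ℚ ℚ.* (M ℚ.+ ‖ a ‖)
    0≤R′ = 0≤* (ℚ.nonNegative⁻¹ 2ℚ) (0≤+ 0≤M 0≤‖ a ‖)
    triangle : ∀ z → ‖ z * ⟦ f ⟧ z ‖ ≤ ‖ a + z * ⟦ f ⟧ z ‖ ℚ.+ ‖ a ‖
    triangle z = subst₂ ℚ._≤_
      (cong ‖_‖ (G.solve 2 (λ a w → (a G.:+ w) G.:+ (G.:- a) G.:= w) refl a (z * ⟦ f ⟧ z)))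
      (cong (‖ a + z * ⟦ f ⟧ z ‖ ℚ.+_) (‖-‖ a))
      (‖+‖ (a + z * ⟦ f ⟧ z) (- a))
    conclude : ∀ x y p t → R′ ≤ x → 1ℚ ≤ y → x ℚ.* y ≤ 2ℚ ℚ.* p → p ≤ t ℚ.+ ‖ a ‖ →
      2ℚ ℚ.* M ≤ 2ℚ ℚ.* t
    conclude x y p t R′≤x 1≤y xy≤2p p≤t+a = ≤-from
      (0≤+ (0≤+ (0≤+ (≤⇒0≤- R′≤x) (0≤* (ℚ.≤-trans 0≤R′ R′≤x) (≤⇒0≤- 1≤y))) (≤⇒0≤- xy≤2p))
        (0≤* (ℚ.nonNegative⁻¹ 2ℚ) (≤⇒0≤- p≤t+a)))
      (solve 6 (λ M a x y p t → con 2ℚ :* t :- con 2ℚ :* M :=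
        ((x :- con 2ℚ :* (M :+ a)) :+ x :* (y :- con 1ℚ)) :+ (con 2ℚ :* p :- x :* y)
          :+ con 2ℚ :* ((t :+ a) :- p)) refl M (‖ a ‖) x y p t)

  private
    inverse-bound : ∀ {w i m u} → 0ℚ < m → m ≤ ‖ w ‖ → m ℚ.* u ≡ 2ℚ → w * i ≡ 1𝔾 → i ≼ u
    inverse-bound {w} {i} {m} {u} 0<m m≤w mu≡2 wi≡1 = bounded (≤-cancelˡ 0<m (begin
      m ℚ.* ‖ i ‖      ≤⟨ *-mono 0≤‖ w ‖ 0≤‖ i ‖ m≤w ℚ.≤-refl ⟩
      ‖ w ‖ ℚ.* ‖ i ‖  ≤⟨ ‖‖‖‖≤2‖*‖ w i ⟩
      2ℚ ℚ.* ‖ w * i ‖ ≡⟨ cong (λ v → 2ℚ ℚ.* ‖ v ‖) wi≡1 ⟩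
      2ℚ               ≡⟨ sym mu≡2 ⟩
      m ℚ.* u          ∎))
      where open ℚ.≤-Reasoning

    N-≼ : ∀ {z b} → z ≼ b → N z ≤ b ℚ.* b
    N-≼ {z} (bounded z≤b) = ℚ.≤-trans (N≤‖‖² z) (*-mono (ℚ.≤-trans 0≤‖ z ‖ z≤b) 0≤‖ z ‖ z≤b z≤b)

    remainder-bound : ℚ → ℚ → ℚ
    remainder-bound B u = B ℚ.* b₂ ℚ.+ B ℚ.* b₁ ℚ.+ 1ℚ ℚ.* (B ℚ.* b₂)
      ℚ.+ B ℚ.* (u ℚ.+ 1ℚ ℚ.* (b₁ ℚ.+ 1ℚ ℚ.* b₂))
      where
      b₁ b₂ : ℚ
      b₁ = (B ℚ.* u) ℚ.* u
      b₂ = (B ℚ.* b₁ ℚ.+ B ℚ.* u) ℚ.* u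

    remainder-≼ : ∀ {c₁ c₂ v₀ d h B u} → c₁ ≼ B → c₂ ≼ B → d ≼ B → v₀ ≼ u → h ≼ 1ℚ →
      Reciprocal.remainder c₁ c₂ v₀ d h ≼ remainder-bound B u
    remainder-≼ {c₁} {c₂} {v₀} {B = B} {u} c₁≼ c₂≼ d≼ v₀≼ h≼ =
      +-≼ (+-≼ (+-≼ (*-≼ c₁≼ v₂≼) (*-≼ c₂≼ v₁≼)) (*-≼ h≼ (*-≼ c₂≼ v₂≼)))
          (*-≼ d≼ (+-≼ v₀≼ (*-≼ h≼ (+-≼ v₁≼ (*-≼ h≼ v₂≼)))))
      where
      open Reciprocal c₁ c₂ v₀
      v₁≼ : v₁ ≼ (B ℚ.* u) ℚ.* u
      v₁≼ = neg-≼ (*-≼ (*-≼ c₁≼ v₀≼) v₀≼)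
      v₂≼ : v₂ ≼ (B ℚ.* ((B ℚ.* u) ℚ.* u) ℚ.+ B ℚ.* u) ℚ.* u
      v₂≼ = neg-≼ (*-≼ (+-≼ (*-≼ c₁≼ v₁≼) (*-≼ c₂≼ v₀≼)) v₀≼)

    0≤remainder-bound : ∀ {B u} → 0ℚ ≤ B → 0ℚ ≤ u → 0ℚ ≤ remainder-bound B u
    0≤remainder-bound {B} {u} 0≤B 0≤u =
      0≤+ (0≤+ (0≤+ (0≤* 0≤B 0≤b₂) (0≤* 0≤B 0≤b₁)) (0≤* 0≤1 (0≤* 0≤B 0≤b₂)))
          (0≤* 0≤B (0≤+ 0≤u (0≤* 0≤1 (0≤+ 0≤b₁ (0≤* 0≤1 0≤b₂)))))
      where
      0≤b₁ = 0≤* (0≤* 0≤B 0≤u) 0≤u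
      0≤b₂ = 0≤* (0≤+ (0≤* 0≤B 0≤b₁) (0≤* 0≤B 0≤u)) 0≤u

  -- Away from the zeros of f, the function φ = ‖1/f‖ + ε N is strictly
  -- subharmonic on a fine grid, so from every grid point one of the four
  -- neighbours increases φ by the fixed amount γ.  As φ is bounded where
  -- η ≤ ‖f‖, such a walk ends at a point with ‖f‖ < η or far from the origin.
  private
    module Ascent {n} (f : Vec 𝔾 n) (η u R B ε δ A : ℚ) (0<η : 0ℚ < η) (ηu≡2 : η ℚ.* u ≡ 2ℚ)
      (f-bounded : ∀ {z h} → z ≼ R → h ≼ 1ℚ →
        ⟦ f ⟧ z ≼ B × taylor₁ f z ≼ B × taylor₂ f z ≼ B × taylor₃ f z h ≼ B)
      (0≤ε : 0ℚ ≤ ε) (0≤δ : 0ℚ ≤ δ) (δ≤1 : δ ≤ 1ℚ) where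

      Found : Set
      Found = ∃ λ z → ‖ ⟦ f ⟧ z ‖ < η

      -- The inverse of f(z) is passed as the second argument, so no division by a possibly
      -- vanishing value occurs.
      φ : 𝔾 → 𝔾 → ℚ
      φ z i = ‖ i ‖ ℚ.+ ε ℚ.* N z

      -- `C` bounds the coefficient of the cubic error of 1/f; `γ` is the gain ε δ² minus the loss C
      -- δ³.
      C γ : ℚ
      C = u ℚ.* remainder-bound B u
      γ = δ ℚ.* δ ℚ.* (ε ℚ.- C ℚ.* δ)

      Inverse : 𝔾 → 𝔾 → Set
      Inverse z i = ⟦ f ⟧ z * i ≡ 1𝔾

      Inverted : 𝔾 → Set
      Inverted z = ∃ λ i → Inverse z i × i ≼ u

      invert : ∀ z → Found ⊎ Inverted z
      invert z with ‖ ⟦ f ⟧ z ‖ ℚ.<? η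
      ... | yes small = inj₁ (z , small)
      ... | no  large with ℚ.≮⇒≥ large
      ... | η≤fz with inverse (⟦ f ⟧ z) (ℚ.<-≤-trans 0<η η≤fz)
      ... | i , fi≡1 = inj₂ (i , fi≡1 , inverse-bound 0<η η≤fz ηu≡2 fi≡1)

      invert-neighbours : ∀ z → Found ⊎ (∀ k → Inverted (z + step δ k))
      invert-neighbours z
        with invert (z + step δ east) | invert (z + step δ north)
           | invert (z + step δ west) | invert (z + step δ south)
      ... | inj₁ r | _ | _ | _ = inj₁ r
      ... | _ | inj₁ r | _ | _ = inj₁ r
      ... | _ | _ | inj₁ r | _ = inj₁ r
      ... | _ | _ | _ | inj₁ r = inj₁ r
      ... | inj₂ p | inj₂ q | inj₂ r | inj₂ s = inj₂ λ { east → p ; north → q ; west → r ; south → s }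

      uphill : ∀ {z i₀} → z ≼ R → Inverse z i₀ → i₀ ≼ u → (i : Direction → 𝔾) →
        (∀ k → Inverse (z + step δ k) (i k) × i k ≼ u) →
        ∃ λ k → φ z i₀ ℚ.+ γ ≤ φ (z + step δ k) (i k)
      uphill {z} {i₀} z≼R fi₀≡1 i₀≼u i inv = above-average (λ k → φ (z + step δ k) (i k)) (begin
        4ℚ ℚ.* (φ z i₀ ℚ.+ γ)
          ≡⟨ solve 5 (λ x n ε δ C →
               con 4ℚ :* ((x :+ ε :* n) :+ δ :* δ :* (ε :- C :* δ))
               := con 4ℚ :* x :+ (ε :* (con 4ℚ :* (n :+ δ :* δ)) :- con 4ℚ :* (δ :* δ :* δ :* C)))
             refl (‖ i₀ ‖) (N z) ε δ C ⟩
        4ℚ ℚ.* ‖ i₀ ‖ ℚ.+ (ε ℚ.* (4ℚ ℚ.* (N z ℚ.+ δ ℚ.* δ)) ℚ.- err)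
          ≤⟨ ℚ.+-monoˡ-≤ (ε ℚ.* (4ℚ ℚ.* (N z ℚ.+ δ ℚ.* δ)) ℚ.- err)
               (mean-bound i (λ k → i k * rem k) 0≤δ r≼C expand) ⟩
        (total (λ k → ‖ i k ‖) ℚ.+ err) ℚ.+ (ε ℚ.* (4ℚ ℚ.* (N z ℚ.+ δ ℚ.* δ)) ℚ.- err)
          ≡⟨ cong (λ t → (total (λ k → ‖ i k ‖) ℚ.+ err) ℚ.+ (ε ℚ.* t ℚ.- err)) (sym (total-N δ z)) ⟩
        (total (λ k → ‖ i k ‖) ℚ.+ err) ℚ.+ (ε ℚ.* total (λ k → N (z + step δ k)) ℚ.- err)
          ≡⟨ solve 3 (λ t e s → (t :+ e) :+ (s :- e) := t :+ s)
               refl (total (λ k → ‖ i k ‖)) err (ε ℚ.* total (λ k → N (z + step δ k))) ⟩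
        total (λ k → ‖ i k ‖) ℚ.+ ε ℚ.* total (λ k → N (z + step δ k))
          ≡⟨ total-linear ε (λ k → ‖ i k ‖) (λ k → N (z + step δ k)) ⟩
        total (λ k → φ (z + step δ k) (i k)) ∎)
        where
        open ℚ.≤-Reasoning
        open Reciprocal (taylor₁ f z) (taylor₂ f z) i₀
        err : ℚ
        err = 4ℚ ℚ.* (δ ℚ.* δ ℚ.* δ ℚ.* C)
        rem : Direction → 𝔾
        rem k = remainder (taylor₃ f z (step δ k)) (step δ k)
        step≼1 : ∀ k → step δ k ≼ 1ℚ
        step≼1 k = ≼-weaken (step-≼ 0≤δ k) δ≤1
        r≼C : ∀ k → i k * rem k ≼ C
        r≼C k = let _ , b₁ , b₂ , b₃ = f-bounded z≼R (step≼1 k)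
                in *-≼ (proj₂ (inv k)) (remainder-≼ b₁ b₂ b₃ i₀≼u (step≼1 k))
        expand : ∀ k → let h = step δ k in
          i₀ + h * (v₁ + h * v₂) ≡ i k + h * h * h * (i k * rem k)
        expand k = expansion fi₀≡1
          (trans (cong (_* i k) (sym (taylor f z (step δ k)))) (proj₁ (inv k)))

      Far : Set
      Far = ∀ {z i} → R ≤ ‖ z ‖ → z ≼ R ℚ.+ 1ℚ → Inverse z i → φ z i < A

      ceiling : ℚ
      ceiling = u ℚ.+ ε ℚ.* (R ℚ.* R)

      φ≤ceiling : ∀ {z i} → z ≼ R → i ≼ u → φ z i ≤ ceiling
      φ≤ceiling {z} z≼R i≼u = ℚ.+-mono-≤ (bound i≼u)
        (*-mono {ε} {ε} {N z} {R ℚ.* R} 0≤ε (0≤N z) ℚ.≤-refl (N-≼ z≼R))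

      -- The fuel `k` is enough while φ + k γ exceeds the `ceiling`; at k = 0 this contradicts the
      -- bound of φ on the disc. The invariant `A ≤ φ z i` keeps the walk inside, because φ < A just
      -- beyond radius R.
      climb : Far → 0ℚ ≤ γ → ∀ k {z i} → z ≼ R → Inverse z i → i ≼ u → A ≤ φ z i →
        ceiling < φ z i ℚ.+ multiple k γ → Found
      climb far 0≤γ zero {z} {i} z≼R _ i≼u _ high = contradiction
        (ℚ.<-≤-trans high (ℚ.≤-trans (ℚ.≤-reflexive (ℚ.+-identityʳ (φ z i))) (φ≤ceiling z≼R i≼u)))
        (ℚ.<-irrefl refl)
      climb far 0≤γ (suc k) {z} {i₀} z≼R fi₀≡1 i₀≼u A≤φ high with invert-neighbours z
      ... | inj₁ found    = found
      ... | inj₂ inverted = continue (uphill z≼R fi₀≡1 i₀≼u (λ k → proj₁ (inverted k)) (λ k → proj₂ (inverted k)))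
        where
        continue : (∃ λ d → φ z i₀ ℚ.+ γ ≤ φ (z + step δ d) (proj₁ (inverted d))) → Found
        continue (d , gain) = split (inverted d) gain
          where
          w : 𝔾
          w = z + step δ d
          split : ((j , _) : Inverted w) → φ z i₀ ℚ.+ γ ≤ φ w j → Found
          split (j , fj≡1 , j≼u) gain with R ℚ.≤? ‖ w ‖
          ... | yes beyond = contradiction
            (ℚ.≤-<-trans A≤φw (far beyond (+-≼ z≼R (≼-weaken (step-≼ 0≤δ d) δ≤1)) fj≡1))
            (ℚ.<-irrefl refl)
            where
            A≤φw : A ≤ φ w j
            A≤φw = ℚ.≤-trans A≤φ (ℚ.≤-trans (≤-from 0≤γ (solve 2 (λ a b → (a :+ b) :- a := b) refl (φ z i₀) γ)) gain)
          ... | no near = climb far 0≤γ k (bounded (ℚ.<⇒≤ (ℚ.≰⇒> near))) fj≡1 j≼u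
            (ℚ.≤-trans A≤φ (ℚ.≤-trans (≤-from 0≤γ (solve 2 (λ a b → (a :+ b) :- a := b) refl (φ z i₀) γ)) gain))
            (ℚ.<-≤-trans high (ℚ.≤-trans (ℚ.≤-reflexive (sym (ℚ.+-assoc (φ z i₀) γ (multiple k γ))))
              (ℚ.+-monoˡ-≤ (multiple k γ) gain)))

  private
    0<½ : 0ℚ < ½
    0<½ = ℚ.positive⁻¹ ½

    positive-inverse : ∀ {w i} → w * i ≡ 1𝔾 → 0ℚ < ‖ i ‖
    positive-inverse {w} {i} wi≡1 = ℚ.≰⇒> λ i≤0 → contradiction
      (trans (sym wi≡1) (trans (cong (w *_) (‖z‖≡0⇒z≡0 i i≤0)) (zeroʳ w))) λ ()

    start : ∀ A ε → A ≡ A ℚ.+ ε ℚ.* N 0𝔾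
    start = solve 2 (λ A ε → A := A :+ ε :* con 0ℚ) refl
    restart : ∀ A ε m → (A ℚ.+ ε ℚ.* N 0𝔾 ℚ.+ m) ℚ.- m ≡ A
    restart = solve 3 (λ A ε m → (A :+ ε :* con 0ℚ :+ m) :- m := A) refl

    remaining : ∀ C ε δ → (C ℚ.+ ε) ℚ.* δ ≡ ε → ε ℚ.* 1ℚ ℚ.- ε ℚ.* δ ≡ C ℚ.* δ
    remaining C ε δ eq = trans (cong (λ e → e ℚ.* 1ℚ ℚ.- ε ℚ.* δ) (sym eq))
      (solve 3 (λ C ε δ → ((C :+ ε) :* δ) :* con 1ℚ :- ε :* δ := C :* δ) refl C ε δ)
    gain : ∀ C ε δ → (C ℚ.+ ε) ℚ.* δ ≡ ε → ε ℚ.* δ ≡ ε ℚ.- C ℚ.* δ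
    gain C ε δ eq = trans
      (solve 3 (λ C ε δ → ε :* δ := (C :+ ε) :* δ :- C :* δ) refl C ε δ)
      (cong (ℚ._- C ℚ.* δ) eq)

    -- The choice of M gives ‖1/f‖ ≤ A/4 beyond radius R, and the choice of ε gives ε N z ≤ A/2 on
    -- the collar of width 1 that a single step can reach; together 3A/4. In the application A =
    -- ‖1/f(0)‖, the value of φ at the origin.
    outside : ∀ {n} (f : Vec 𝔾 n) {A M ε R} → 0ℚ < A → 0ℚ < M → M ℚ.* (½ ℚ.* ½ ℚ.* A) ≡ 2ℚ → 0ℚ < ε →
      (R ℚ.+ 1ℚ) ℚ.* (R ℚ.+ 1ℚ) ℚ.* ε ≡ ½ ℚ.* A → (∀ z → R ≤ ‖ z ‖ → M ≤ ‖ ⟦ f ⟧ z ‖) →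
      ∀ {z i} → R ≤ ‖ z ‖ → z ≼ R ℚ.+ 1ℚ → ⟦ f ⟧ z * i ≡ 1𝔾 → ‖ i ‖ ℚ.+ ε ℚ.* N z < A
    outside f {A} {M} {ε} {R} 0<A 0<M M¼A≡2 0<ε R²ε≡½A far {z} R≤z z≼R+1 fi≡1 = ℚ.≤-<-trans
      (ℚ.+-mono-≤ (bound (inverse-bound 0<M (far z R≤z) M¼A≡2 fi≡1))
        (*-mono {ε} {ε} {N z} (ℚ.<⇒≤ 0<ε) (0≤N z) ℚ.≤-refl (N-≼ z≼R+1)))
      (<-from (0<* (0<* 0<½ 0<½) 0<A) (trans
        (cong (λ t → A ℚ.- (½ ℚ.* ½ ℚ.* A ℚ.+ t)) (trans (ℚ.*-comm ε _) R²ε≡½A))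
        (solve 1 (λ A → A :- (con ½ :* con ½ :* A :+ con ½ :* A) := con ½ :* con ½ :* A) refl A)))

    search : ∀ {n} (f : Vec 𝔾 n) {η i₀ u M R B ε} → ⟦ f ⟧ 0𝔾 * i₀ ≡ 1𝔾 → 0ℚ < η → η ≤ ‖ ⟦ f ⟧ 0𝔾 ‖ →
      0ℚ < u → η ℚ.* u ≡ 2ℚ →
      0ℚ < M → M ℚ.* (½ ℚ.* ½ ℚ.* ‖ i₀ ‖) ≡ 2ℚ → 0ℚ ≤ R → (∀ z → R ≤ ‖ z ‖ → M ≤ ‖ ⟦ f ⟧ z ‖) →
      0ℚ ≤ B → (∀ {z h} → z ≼ R → h ≼ 1ℚ →
        ⟦ f ⟧ z ≼ B × taylor₁ f z ≼ B × taylor₂ f z ≼ B × taylor₃ f z h ≼ B) →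
      0ℚ < ε → (R ℚ.+ 1ℚ) ℚ.* (R ℚ.+ 1ℚ) ℚ.* ε ≡ ½ ℚ.* ‖ i₀ ‖ →
      ∃ λ z → ‖ ⟦ f ⟧ z ‖ < η
    search f {η} {i₀} {u} {M} {R} {B} {ε} fi₀≡1 0<η η≤f0 0<u ηu≡2 0<M M¼A≡2 0≤R far 0≤B f≼B 0<ε R²ε≡½A =
      -- δ = ε / (C + ε) yields both δ ≤ 1 and ε - C δ = ε δ, so that γ = ε δ³ > 0.
      stage₁ (quotient (0<+′ 0≤C 0<ε) 0<ε)
      where
      A C : ℚ
      A = ‖ i₀ ‖
      C = u ℚ.* remainder-bound B u
      0<A : 0ℚ < A
      0<A = positive-inverse fi₀≡1
      0≤C : 0ℚ ≤ C
      0≤C = 0≤* (ℚ.<⇒≤ 0<u) (0≤remainder-bound 0≤B (ℚ.<⇒≤ 0<u))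
      stage₁ : (∃ λ δ → 0ℚ < δ × (C ℚ.+ ε) ℚ.* δ ≡ ε) → ∃ λ z → ‖ ⟦ f ⟧ z ‖ < η
      stage₁ (δ , 0<δ , Cδ+εδ≡ε) = stage₂ (archimedean 0<γ ceiling)
        where
        δ≤1 : δ ≤ 1ℚ
        δ≤1 = ≤-cancelˡ 0<ε (≤-from (0≤* 0≤C (ℚ.<⇒≤ 0<δ)) (remaining C ε δ Cδ+εδ≡ε))
        open Ascent f η u R B ε δ A 0<η ηu≡2 f≼B (ℚ.<⇒≤ 0<ε) (ℚ.<⇒≤ 0<δ) δ≤1 hiding (C)
        0<γ : 0ℚ < γ
        0<γ = 0<* (0<* 0<δ 0<δ) (subst (0ℚ <_) (gain C ε δ Cδ+εδ≡ε) (0<* 0<ε 0<δ))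
        stage₂ : (∃ λ k → ceiling < multiple k γ) → ∃ λ z → ‖ ⟦ f ⟧ z ‖ < η
        stage₂ (k , ceiling<kγ) = climb (outside f 0<A 0<M M¼A≡2 0<ε R²ε≡½A far) (ℚ.<⇒≤ 0<γ) k {0𝔾}
          (bounded 0≤R) fi₀≡1 (inverse-bound 0<η η≤f0 ηu≡2 fi₀≡1)
          (ℚ.≤-reflexive (start A ε))
          (ℚ.<-≤-trans ceiling<kγ (≤-from (ℚ.<⇒≤ 0<A) (restart A ε (multiple k γ))))

  abstract
    -- Unless 0 itself is good enough, 1/f(0) exists and starts the walk. The constants depend on
    -- each other in this order: M on 1/f(0), R on M, the Taylor bound B and ε on R, and the step δ
    -- on all of them.
    approximate-root : ∀ {n} (f : Vec 𝔾 (suc n)) {η} → 0ℚ < η → ∃ λ z → ‖ ⟦ f ⟧ z ‖ < η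
    approximate-root f {η} 0<η = decide (‖ ⟦ f ⟧ 0𝔾 ‖ ℚ.<? η)
      where
      Result : Set
      Result = ∃ λ z → ‖ ⟦ f ⟧ z ‖ < η
      decide : Dec (‖ ⟦ f ⟧ 0𝔾 ‖ < η) → Result
      decide (yes small) = 0𝔾 , small
      decide (no large)  = stage₁ (inverse (⟦ f ⟧ 0𝔾) (ℚ.<-≤-trans 0<η η≤f0)) (quotient 0<η (ℚ.positive⁻¹ 2ℚ))
        where
        η≤f0 : η ≤ ‖ ⟦ f ⟧ 0𝔾 ‖
        η≤f0 = ℚ.≮⇒≥ large
        stage₁ : (∃ λ i → ⟦ f ⟧ 0𝔾 * i ≡ 1𝔾) → (∃ λ u → 0ℚ < u × η ℚ.* u ≡ 2ℚ) → Result
        stage₁ (i₀ , fi₀≡1) (u , 0<u , ηu≡2) =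
          stage₂ (quotient (0<* (0<* (ℚ.positive⁻¹ ½) (ℚ.positive⁻¹ ½)) 0<A) (ℚ.positive⁻¹ 2ℚ))
          where
          0<A : 0ℚ < ‖ i₀ ‖
          0<A = positive-inverse {⟦ f ⟧ 0𝔾} {i₀} fi₀≡1
          stage₂ : (∃ λ M → 0ℚ < M × ½ ℚ.* ½ ℚ.* ‖ i₀ ‖ ℚ.* M ≡ 2ℚ) → Result
          stage₂ (M , 0<M , ¼AM≡2) = stage₃ (coercive-unbounded f (ℚ.<⇒≤ 0<M))
            where
            stage₃ : (∃ λ R → 0ℚ ≤ R × (∀ z → R ≤ ‖ z ‖ → M ≤ ‖ ⟦ f ⟧ z ‖)) → Result
            stage₃ (R , 0≤R , far) = stage₄ (taylor-bounded f 0≤R)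
              (quotient (0<* (0<+′ 0≤R 0<1) (0<+′ 0≤R 0<1)) (0<* (ℚ.positive⁻¹ ½) 0<A))
              where
              stage₄ : (∃ λ B → 0ℚ ≤ B × (∀ {z h} → z ≼ R → h ≼ 1ℚ →
                  ⟦ f ⟧ z ≼ B × taylor₁ f z ≼ B × taylor₂ f z ≼ B × taylor₃ f z h ≼ B)) →
                (∃ λ ε → 0ℚ < ε × (R ℚ.+ 1ℚ) ℚ.* (R ℚ.+ 1ℚ) ℚ.* ε ≡ ½ ℚ.* ‖ i₀ ‖) → Result
              stage₄ (B , 0≤B , f≼B) (ε , 0<ε , R²ε≡½A) = search f fi₀≡1 0<η η≤f0 0<u ηu≡2 0<M
                (trans (ℚ.*-comm M _) ¼AM≡2) 0≤R far 0≤B f≼B 0<ε R²ε≡½A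

-- Approximate factorization into linear factors.

module ApproximateFactorization where

  open import Data.Rational.Base using (_≤_; _<_)
  open RationalOrder
  open Gaussian
  open ApproximateRoot

  open ℚ.+-*-Solver using (solve; con; _:+_; _:*_; _:-_; :-_; _:=_)
  private module G = 𝔾-Solver

  infixr 5 _+₀_
  _+₀_ : ∀ {n} → 𝔾 → Vec 𝔾 (suc n) → Vec 𝔾 (suc n)
  r +₀ (a ∷ f) = (r + a) ∷ f

  -- In Horner form, (x - w)(b + x g) = - w b + x (b + (x - w) g).
  times-linear : ∀ {n} → 𝔾 → Vec 𝔾 n → Vec 𝔾 (suc n)
  times-linear w []      = - w ∷ []
  times-linear w (b ∷ g) = - (w * b) ∷ (b +₀ times-linear w g)

  from-roots : ∀ {n} → Vec 𝔾 n → Vec 𝔾 n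
  from-roots []       = []
  from-roots (w ∷ ws) = times-linear w (from-roots ws)

  -- Synthetic division by x - w: the coefficients of the quotient are the values at w of the
  -- successive tails of f.
  deflate : ∀ {n} → Vec 𝔾 (suc n) → 𝔾 → Vec 𝔾 n
  deflate (a ∷ [])        w = []
  deflate (a ∷ f@(_ ∷ _)) w = ⟦ f ⟧ w ∷ deflate f w

  deflate-times-linear : ∀ {n} (f : Vec 𝔾 (suc n)) w → ⟦ f ⟧ w +₀ times-linear w (deflate f w) ≡ f
  deflate-times-linear (a ∷ []) w = cong (_∷ [])
    (G.solve 2 (λ a w → (a G.:+ w G.:* G.con 1𝔾) G.:+ G.:- w G.:= a) refl a w)
  deflate-times-linear (a ∷ f@(_ ∷ _)) w = cong₂ _∷_
    (G.solve 3 (λ a w c → (a G.:+ w G.:* c) G.:+ G.:- (w G.:* c) G.:= a) refl a w (⟦ f ⟧ w))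
    (deflate-times-linear f w)

  ⟦+₀⟧ : ∀ {n} r (f : Vec 𝔾 (suc n)) z → ⟦ r +₀ f ⟧ z ≡ r + ⟦ f ⟧ z
  ⟦+₀⟧ r (a ∷ f) z = +-assoc r a (z * ⟦ f ⟧ z)

  ⟦times-linear⟧ : ∀ {n} w (g : Vec 𝔾 n) z → ⟦ times-linear w g ⟧ z ≡ (z - w) * ⟦ g ⟧ z
  ⟦times-linear⟧ w [] z =
    G.solve 2 (λ w z → G.:- w G.:+ z G.:* G.con 1𝔾 G.:= (z G.:- w) G.:* G.con 1𝔾) refl w z
  ⟦times-linear⟧ w (b ∷ g) z = trans
    (cong (λ t → - (w * b) + z * t) (trans (⟦+₀⟧ b (times-linear w g) z) (cong (b +_) (⟦times-linear⟧ w g z))))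
    (G.solve 4 (λ w b z t → G.:- (w G.:* b) G.:+ z G.:* (b G.:+ (z G.:- w) G.:* t)
      G.:= (z G.:- w) G.:* (b G.:+ z G.:* t)) refl w b z (⟦ g ⟧ z))

  ⟦deflate⟧ : ∀ {n} (f : Vec 𝔾 (suc n)) w z → ⟦ f ⟧ z ≡ ⟦ f ⟧ w + (z - w) * ⟦ deflate f w ⟧ z
  ⟦deflate⟧ f w z = trans (cong (λ h → ⟦ h ⟧ z) (sym (deflate-times-linear f w)))
    (trans (⟦+₀⟧ (⟦ f ⟧ w) (times-linear w (deflate f w)) z)
      (cong (⟦ f ⟧ w +_) (⟦times-linear⟧ w (deflate f w) z)))

  dist : ∀ {n} → Vec 𝔾 n → Vec 𝔾 n → ℚ
  dist []      []      = 0ℚ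
  dist (a ∷ f) (b ∷ g) = ‖ a - b ‖ ℚ.+ dist f g

  0≤dist : ∀ {n} (f g : Vec 𝔾 n) → 0ℚ ≤ dist f g
  0≤dist []      []      = ℚ.≤-refl
  0≤dist (a ∷ f) (b ∷ g) = 0≤+ {‖ a - b ‖} 0≤‖ a - b ‖ (0≤dist f g)

  ‖z-z‖≡0 : ∀ z → ‖ z - z ‖ ≡ 0ℚ
  ‖z-z‖≡0 z = trans (cong ‖_‖ (-‿inverseʳ z)) ‖0‖≡0

  dist-refl : ∀ {n} (f : Vec 𝔾 n) → dist f f ≡ 0ℚ
  dist-refl []      = refl
  dist-refl (a ∷ f) = cong₂ ℚ._+_ (‖z-z‖≡0 a) (dist-refl f)

  dist-sym : ∀ {n} (f g : Vec 𝔾 n) → dist f g ≡ dist g f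
  dist-sym []      []      = refl
  dist-sym (a ∷ f) (b ∷ g) = cong₂ ℚ._+_ (‖z-w‖-sym a b) (dist-sym f g)

  ‖-‖-triangle : ∀ z w v → ‖ z - v ‖ ≤ ‖ z - w ‖ ℚ.+ ‖ w - v ‖
  ‖-‖-triangle z w v = subst (λ t → ‖ t ‖ ≤ ‖ z - w ‖ ℚ.+ ‖ w - v ‖)
    (G.solve 3 (λ z w v → (z G.:- w) G.:+ (w G.:- v) G.:= z G.:- v) refl z w v)
    (‖+‖ (z - w) (w - v))

  ‖‖-triangle : ∀ z w → ‖ z ‖ ≤ ‖ z - w ‖ ℚ.+ ‖ w ‖
  ‖‖-triangle z w = subst (λ t → ‖ t ‖ ≤ ‖ z - w ‖ ℚ.+ ‖ w ‖)
    (G.solve 2 (λ z w → (z G.:- w) G.:+ w G.:= z) refl z w) (‖+‖ (z - w) w)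

  private
    interchange : ∀ a b c d → (a ℚ.+ b) ℚ.+ (c ℚ.+ d) ≡ (a ℚ.+ c) ℚ.+ (b ℚ.+ d)
    interchange = solve 4 (λ a b c d → (a :+ b) :+ (c :+ d) := (a :+ c) :+ (b :+ d)) refl

  dist-triangle : ∀ {n} (f g h : Vec 𝔾 n) → dist f h ≤ dist f g ℚ.+ dist g h
  dist-triangle []      []      []      = ℚ.≤-refl
  dist-triangle (a ∷ f) (b ∷ g) (c ∷ h) = ℚ.≤-trans
    (ℚ.+-mono-≤ (‖-‖-triangle a b c) (dist-triangle f g h))
    (ℚ.≤-reflexive (interchange (‖ a - b ‖) (‖ b - c ‖) (dist f g) (dist g h)))

  dist-+₀ : ∀ {n} r s (f g : Vec 𝔾 (suc n)) → dist (r +₀ f) (s +₀ g) ≤ ‖ r - s ‖ ℚ.+ dist f g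
  dist-+₀ r s (a ∷ f) (b ∷ g) = ℚ.≤-trans
    (ℚ.+-monoˡ-≤ (dist f g) (subst (λ t → ‖ t ‖ ≤ ‖ r - s ‖ ℚ.+ ‖ a - b ‖)
      (G.solve 4 (λ r s a b → (r G.:- s) G.:+ (a G.:- b) G.:= (r G.:+ a) G.:- (s G.:+ b)) refl r s a b)
      (‖+‖ (r - s) (a - b))))
    (ℚ.≤-reflexive (ℚ.+-assoc (‖ r - s ‖) (‖ a - b ‖) (dist f g)))

  dist-times-linear : ∀ {n} w (f g : Vec 𝔾 n) →
    dist (times-linear w f) (times-linear w g) ≤ (1ℚ ℚ.+ ‖ w ‖) ℚ.* dist f g
  dist-times-linear w [] [] = ℚ.≤-reflexive
    (trans (dist-refl (- w ∷ [])) (sym (ℚ.*-zeroʳ (1ℚ ℚ.+ ‖ w ‖))))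
  dist-times-linear w (a ∷ f) (b ∷ g) = ℚ.≤-trans
    (ℚ.+-mono-≤
      (subst (λ t → ‖ t ‖ ≤ ‖ w ‖ ℚ.* ‖ b - a ‖)
        (G.solve 3 (λ w a b → w G.:* (b G.:- a) G.:= G.:- (w G.:* a) G.:- G.:- (w G.:* b)) refl w a b)
        (‖*‖ w (b - a)))
      (ℚ.≤-trans (dist-+₀ a b (times-linear w f) (times-linear w g))
        (ℚ.+-monoʳ-≤ (‖ a - b ‖) (dist-times-linear w f g))))
    (ℚ.≤-reflexive (trans
      (cong (λ t → ‖ w ‖ ℚ.* t ℚ.+ (‖ a - b ‖ ℚ.+ (1ℚ ℚ.+ ‖ w ‖) ℚ.* dist f g)) (‖z-w‖-sym b a))
      (solve 3 (λ w x d → w :* x :+ (x :+ (con 1ℚ :+ w) :* d)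
        := (con 1ℚ :+ w) :* (x :+ d)) refl (‖ w ‖) (‖ a - b ‖) (dist f g))))

  power : ℚ → ℕ → ℚ
  power x zero    = 1ℚ
  power x (suc n) = x ℚ.* power x n

  0<power : ∀ {x} → 0ℚ < x → ∀ n → 0ℚ < power x n
  0<power 0<x zero    = 0<1
  0<power 0<x (suc n) = 0<* 0<x (0<power 0<x n)

  1≤power : ∀ {x} → 1ℚ ≤ x → ∀ n → 1ℚ ≤ power x n
  1≤power 1≤x zero    = ℚ.≤-refl
  1≤power {x} 1≤x (suc n) = *-mono {1ℚ} {x} {1ℚ} {power x n}
    (ℚ.≤-trans 0≤1 1≤x) 0≤1 1≤x (1≤power 1≤x n)

  ⟦⟧-lipschitz : ∀ {n} {b} (f g : Vec 𝔾 n) z → 1ℚ ≤ b → ‖ z ‖ ≤ b →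
    ‖ ⟦ f ⟧ z - ⟦ g ⟧ z ‖ ≤ power b n ℚ.* dist f g
  ⟦⟧-lipschitz [] [] z 1≤b z≤b = ℚ.≤-refl
  ⟦⟧-lipschitz {suc n} {b} (a ∷ f) (a′ ∷ g) z 1≤b z≤b = begin
    ‖ (a + z * ⟦ f ⟧ z) - (a′ + z * ⟦ g ⟧ z) ‖
      ≡⟨ cong ‖_‖ (G.solve 5 (λ a a′ z s t → (a G.:+ z G.:* s) G.:- (a′ G.:+ z G.:* t)
           G.:= (a G.:- a′) G.:+ z G.:* (s G.:- t)) refl a a′ z (⟦ f ⟧ z) (⟦ g ⟧ z)) ⟩
    ‖ (a - a′) + z * (⟦ f ⟧ z - ⟦ g ⟧ z) ‖
      ≤⟨ ‖+‖ (a - a′) (z * (⟦ f ⟧ z - ⟦ g ⟧ z)) ⟩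
    ‖ a - a′ ‖ ℚ.+ ‖ z * (⟦ f ⟧ z - ⟦ g ⟧ z) ‖
      ≤⟨ ℚ.+-mono-≤
           (≤-from {‖ a - a′ ‖} {power b (suc n) ℚ.* ‖ a - a′ ‖} (0≤* (≤⇒0≤- (1≤power 1≤b (suc n))) 0≤‖ a - a′ ‖)
             (solve 2 (λ p x → p :* x :- x := (p :- con 1ℚ) :* x) refl (power b (suc n)) (‖ a - a′ ‖)))
           (bound (*-≼ {z} {⟦ f ⟧ z - ⟦ g ⟧ z} (bounded z≤b) (bounded (⟦⟧-lipschitz f g z 1≤b z≤b)))) ⟩
    power b (suc n) ℚ.* ‖ a - a′ ‖ ℚ.+ b ℚ.* (power b n ℚ.* dist f g)
      ≡⟨ solve 4 (λ b p x d → (b :* p) :* x :+ b :* (p :* d) := (b :* p) :* (x :+ d))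
           refl b (power b n) (‖ a - a′ ‖) (dist f g) ⟩
    power b (suc n) ℚ.* (‖ a - a′ ‖ ℚ.+ dist f g) ∎
    where open ℚ.≤-Reasoning

  -- f differs from (x - w) `deflate f w` only by the constant f(w), and multiplication by x - w
  -- stretches distances by at most 1 + ‖w‖.
  dist-via-deflate : ∀ {n} (f : Vec 𝔾 (suc n)) w (g : Vec 𝔾 n) →
    dist f (times-linear w g) ≤ ‖ ⟦ f ⟧ w ‖ ℚ.+ (1ℚ ℚ.+ ‖ w ‖) ℚ.* dist (deflate f w) g
  dist-via-deflate f w g = ℚ.≤-trans (dist-triangle f d (times-linear w g))
    (ℚ.+-mono-≤ f≈d (dist-times-linear w (deflate f w) g))
    where
    d = times-linear w (deflate f w)
    0+₀ : ∀ {n} (h : Vec 𝔾 (suc n)) → 0𝔾 +₀ h ≡ h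
    0+₀ (a ∷ h) = cong (_∷ h) (+-identityˡ a)
    f≈d : dist f d ≤ ‖ ⟦ f ⟧ w ‖
    f≈d = subst₂ ℚ._≤_ (cong₂ dist (deflate-times-linear f w) (0+₀ d))
      (trans (cong₂ (λ r e → ‖ r ‖ ℚ.+ e)
        (G.solve 1 (λ r → r G.:- G.con 0𝔾 G.:= r) refl (⟦ f ⟧ w)) (dist-refl d)) (ℚ.+-identityʳ (‖ ⟦ f ⟧ w ‖)))
      (dist-+₀ (⟦ f ⟧ w) 0𝔾 d d)

  abstract
    approximate-roots : ∀ {n} (f : Vec 𝔾 n) {η} → 0ℚ < η → ∃ λ w → dist f (from-roots w) < η
    approximate-roots []        0<η = [] , 0<η
    approximate-roots f@(_ ∷ _) {η} 0<η = stage₁ (approximate-root f (0<half 0<η))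
      where
      stage₁ : (∃ λ w → ‖ ⟦ f ⟧ w ‖ < ½ ℚ.* η) → ∃ λ w → dist f (from-roots w) < η
      stage₁ (w , small) = stage₂ (quotient {1ℚ ℚ.+ ‖ w ‖} (0<+ 0<1 0≤‖ w ‖) (0<half 0<η))
        where
        stage₂ : (∃ λ δ → 0ℚ < δ × (1ℚ ℚ.+ ‖ w ‖) ℚ.* δ ≡ ½ ℚ.* η) → ∃ λ w → dist f (from-roots w) < η
        stage₂ (δ , 0<δ , [1+w]δ≡½η) = stage₃ (approximate-roots (deflate f w) 0<δ)
          where
          stage₃ : (∃ λ ws → dist (deflate f w) (from-roots ws) < δ) → ∃ λ w → dist f (from-roots w) < η
          stage₃ (ws , close) = w ∷ ws , ℚ.≤-<-trans (dist-via-deflate f w (from-roots ws))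
            (subst (‖ ⟦ f ⟧ w ‖ ℚ.+ (1ℚ ℚ.+ ‖ w ‖) ℚ.* dist (deflate f w) (from-roots ws) <_)
              (trans (cong (½ ℚ.* η ℚ.+_) [1+w]δ≡½η) (half+half η))
              (ℚ.+-mono-<-≤ small (*-mono {1ℚ ℚ.+ ‖ w ‖} (ℚ.<⇒≤ (0<+ 0<1 0≤‖ w ‖)) (0≤dist (deflate f w) (from-roots ws))
                ℚ.≤-refl (ℚ.<⇒≤ close))))

  abstract
    -- If every root were at distance at least ρ from z, each factor could be peeled off at the cost
    -- of ρ/2, the 2 coming from `‖‖‖‖≤2‖*‖`, and the product could not be below (ρ/2)ⁿ.
    nearest-root : ∀ {n} (ws : Vec 𝔾 n) z {ρ} → 0ℚ < ρ → ‖ ⟦ from-roots ws ⟧ z ‖ < power (½ ℚ.* ρ) n →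
      ∃ λ w → ‖ z - w ‖ < ρ × ⟦ from-roots ws ⟧ w ≡ 0𝔾
    nearest-root [] z 0<ρ small = contradiction small (ℚ.<-irrefl refl)
    nearest-root {suc n} (w ∷ ws) z {ρ} 0<ρ small = decide (‖ z - w ‖ ℚ.<? ρ)
      where
      g : Vec 𝔾 n
      g = from-roots ws
      decide : Dec (‖ z - w ‖ < ρ) → ∃ λ w′ → ‖ z - w′ ‖ < ρ × ⟦ times-linear w g ⟧ w′ ≡ 0𝔾
      decide (yes near) = w , near , trans (⟦times-linear⟧ w g w)
        (trans (cong (_* ⟦ g ⟧ w) (-‿inverseʳ w)) (zeroˡ (⟦ g ⟧ w)))
      decide (no far) = finish (nearest-root ws z 0<ρ small′)
        where
        finish : (∃ λ w′ → ‖ z - w′ ‖ < ρ × ⟦ g ⟧ w′ ≡ 0𝔾) →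
          ∃ λ w′ → ‖ z - w′ ‖ < ρ × ⟦ times-linear w g ⟧ w′ ≡ 0𝔾
        finish (w′ , near , gw′≡0) = w′ , near , trans (⟦times-linear⟧ w g w′)
          (trans (cong ((w′ - w) *_) gw′≡0) (zeroʳ (w′ - w)))
        small′ : ‖ ⟦ g ⟧ z ‖ < power (½ ℚ.* ρ) n
        small′ = ℚ.*-cancelˡ-<-nonNeg ρ {{ℚ.nonNegative (ℚ.<⇒≤ 0<ρ)}} (ℚ.≤-<-trans
          (ℚ.≤-trans (*-mono {ρ} {‖ z - w ‖} {‖ ⟦ g ⟧ z ‖} 0≤‖ z - w ‖ 0≤‖ ⟦ g ⟧ z ‖ (ℚ.≮⇒≥ far) ℚ.≤-refl)
            (‖‖‖‖≤2‖*‖ (z - w) (⟦ g ⟧ z)))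
          (subst₂ ℚ._<_ (cong (λ t → 2ℚ ℚ.* ‖ t ‖) (⟦times-linear⟧ w g z))
            (solve 2 (λ ρ p → con 2ℚ :* ((con ½ :* ρ) :* p) := ρ :* p) refl ρ (power (½ ℚ.* ρ) n))
            (ℚ.*-monoʳ-<-pos 2ℚ small)))

-- The fundamental theorem of algebra for Cauchy complex numbers.

module ComplexRoots where

  open import Data.Rational.Base using (_≤_; _<_; ∣_∣)
  open RationalOrder
  open Archimedean
  open Gaussian hiding (N)
  open ApproximateRoot
  open ApproximateFactorization
  open import Defs as D using (mkℝ; seq; cauchy; ℂ; _+i_; 0ℂ; 1ℂ; _+ᶜ_; _*ᶜ_)

  open ℚ.+-*-Solver using (solve; con; _:+_; _:*_; _:-_; :-_; _:=_)
  private module G = 𝔾-Solver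

  Eventually : (ℕ → Set) → Set
  Eventually P = ∃ λ N → ∀ k → N ℕ.≤ k → P k

  always : ∀ {P : ℕ → Set} → (∀ k → P k) → Eventually P
  always p = 0 , λ k _ → p k

  ev-map : ∀ {P Q : ℕ → Set} → (∀ k → P k → Q k) → Eventually P → Eventually Q
  ev-map f (N , p) = N , λ k N≤k → f k (p k N≤k)

  ev-zip : ∀ {P Q R : ℕ → Set} → (∀ k → P k → Q k → R k) → Eventually P → Eventually Q → Eventually R
  ev-zip f (M , p) (N , q) = M ℕ.⊔ N , λ k M⊔N≤k →
    f k (p k (ℕ.m⊔n≤o⇒m≤o M N M⊔N≤k)) (q k (ℕ.m⊔n≤o⇒n≤o M N M⊔N≤k))

  witness : ∀ {P : ℕ → Set} → Eventually P → ∃ P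
  witness (N , p) = N , p N ℕ.≤-refl

  at : ℕ → ℂ → 𝔾
  at k (x +i y) = seq x k ⊹ seq y k

  eval : ∀ {n} → Vec ℂ n → ℂ → ℂ
  eval []      z = 1ℂ
  eval (a ∷ f) z = a +ᶜ z *ᶜ eval f z

  -- Arithmetic on ℂ acts termwise on the representing sequences, so evaluation commutes with taking
  -- the k-th term exactly, and all estimates can be made over the Gaussian rationals.
  at-eval : ∀ {n} (f : Vec ℂ n) z k → at k (eval f z) ≡ ⟦ map (at k) f ⟧ (at k z)
  at-eval []      z k = refl
  at-eval (a ∷ f) z k = cong (λ t → at k a + at k z * t) (at-eval f z k)

  deflateᶜ : ∀ {n} → Vec ℂ (suc n) → ℂ → Vec ℂ n
  deflateᶜ (a ∷ [])        w = []
  deflateᶜ (a ∷ f@(_ ∷ _)) w = eval f w ∷ deflateᶜ f w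

  at-deflateᶜ : ∀ {n} (f : Vec ℂ (suc n)) w k → map (at k) (deflateᶜ f w) ≡ deflate (map (at k) f) (at k w)
  at-deflateᶜ (a ∷ [])        w k = refl
  at-deflateᶜ (a ∷ f@(_ ∷ _)) w k = cong₂ _∷_ (at-eval f w k) (at-deflateᶜ f w k)

  Vanishes : (ℕ → ℚ) → Set
  Vanishes x = ∀ ε → 0ℚ < ε → Eventually λ k → x k < ε

  at-cauchy : ∀ z ε → 0ℚ < ε → ∃ λ N → ∀ m k → N ℕ.≤ m → N ℕ.≤ k → ‖ at m z - at k z ‖ < ε
  at-cauchy (x +i y) ε 0<ε with cauchy x (½ ℚ.* ε) (0<half 0<ε) | cauchy y (½ ℚ.* ε) (0<half 0<ε)
  ... | M , hM | N , hN = M ℕ.⊔ N , λ m k ≤m ≤k → sum< (∣ seq x m ℚ.- seq x k ∣) (∣ seq y m ℚ.- seq y k ∣)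
    (hM m k (ℕ.m⊔n≤o⇒m≤o M N ≤m) (ℕ.m⊔n≤o⇒m≤o M N ≤k))
    (hN m k (ℕ.m⊔n≤o⇒n≤o M N ≤m) (ℕ.m⊔n≤o⇒n≤o M N ≤k))

  poly-cauchy : ∀ {n} (f : Vec ℂ n) ε → 0ℚ < ε →
    ∃ λ N → ∀ m k → N ℕ.≤ m → N ℕ.≤ k → dist (map (at m) f) (map (at k) f) < ε
  poly-cauchy []      ε 0<ε = 0 , λ _ _ _ _ → 0<ε
  poly-cauchy (a ∷ f) ε 0<ε = combine (at-cauchy a (½ ℚ.* ε) (0<half 0<ε)) (poly-cauchy f (½ ℚ.* ε) (0<half 0<ε))
    where
    combine : (∃ λ N → ∀ m k → N ℕ.≤ m → N ℕ.≤ k → ‖ at m a - at k a ‖ < ½ ℚ.* ε) →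
      (∃ λ N → ∀ m k → N ℕ.≤ m → N ℕ.≤ k → dist (map (at m) f) (map (at k) f) < ½ ℚ.* ε) →
      ∃ λ N → ∀ m k → N ℕ.≤ m → N ℕ.≤ k → dist (map (at m) (a ∷ f)) (map (at k) (a ∷ f)) < ε
    combine (M , hM) (N , hN) = M ℕ.⊔ N , λ m k ≤m ≤k →
      sum< (‖ at m a - at k a ‖) (dist (map (at m) f) (map (at k) f))
        (hM m k (ℕ.m⊔n≤o⇒m≤o M N ≤m) (ℕ.m⊔n≤o⇒m≤o M N ≤k))
        (hN m k (ℕ.m⊔n≤o⇒n≤o M N ≤m) (ℕ.m⊔n≤o⇒n≤o M N ≤k))

  at-bounded : ∀ z → ∃ λ B → 1ℚ ≤ B × Eventually λ k → ‖ at k z ‖ ≤ B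
  at-bounded z = from (at-cauchy z 1ℚ 0<1)
    where
    from : (∃ λ N → ∀ m k → N ℕ.≤ m → N ℕ.≤ k → ‖ at m z - at k z ‖ < 1ℚ) →
      ∃ λ B → 1ℚ ≤ B × Eventually λ k → ‖ at k z ‖ ≤ B
    from (N , hN) = 1ℚ ℚ.+ ‖ at N z ‖
      , ≤-from {1ℚ} 0≤‖ at N z ‖ (solve 1 (λ x → (con 1ℚ :+ x) :- con 1ℚ := x) refl (‖ at N z ‖))
      , N , λ k N≤k → ℚ.≤-trans (‖‖-triangle (at k z) (at N z))
          (ℚ.+-monoˡ-≤ (‖ at N z ‖) (ℚ.<⇒≤ (hN k N N≤k ℕ.≤-refl)))

  module Root {n} (f : Vec ℂ (suc n)) where

    F : ℕ → Vec 𝔾 (suc n)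
    F k = map (at k) f

    SmallAt : 𝔾 → ℚ → Set
    SmallAt z θ = Eventually λ k → ‖ ⟦ F k ⟧ z ‖ < θ

    -- Half of the bound in `nearest-root`; the other half is spent on replacing F by an approximate
    -- factorization.
    threshold : ℚ → ℚ
    threshold ρ = ½ ℚ.* power (½ ℚ.* ρ) (suc n)

    0<threshold : ∀ {ρ} → 0ℚ < ρ → 0ℚ < threshold ρ
    0<threshold 0<ρ = 0<half (0<power (0<half 0<ρ) (suc n))

    -- Some late F m is factored approximately as g. As g(z) is small, g has a root w within ρ of z,
    -- and F k (w) is close to g(w) = 0 for all late k.
    refine : ∀ {ρ} → 0ℚ < ρ → ∀ {z} → SmallAt z (threshold ρ) → ∀ {θ} → 0ℚ < θ →
      ∃ λ w → ‖ z - w ‖ < ρ × SmallAt w θ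
    refine {ρ} 0<ρ {z} (M , small) {θ} 0<θ =
      stage₁ (smaller (0<threshold 0<ρ) (0<half 0<θ))
      where
      b K : ℚ
      b = 1ℚ ℚ.+ (‖ z ‖ ℚ.+ ρ)
      K = power b (suc n)
      0≤ρ = ℚ.<⇒≤ 0<ρ
      1≤b : 1ℚ ≤ b
      1≤b = ≤-from (0≤+ 0≤‖ z ‖ 0≤ρ) (solve 1 (λ x → (con 1ℚ :+ x) :- con 1ℚ := x) refl (‖ z ‖ ℚ.+ ρ))
      0<K : 0ℚ < K
      0<K = ℚ.<-≤-trans 0<1 (1≤power 1≤b (suc n))
      z≤b : ‖ z ‖ ≤ b
      z≤b = ≤-from (0≤+ 0≤1 0≤ρ)
        (solve 2 (λ x ρ → (con 1ℚ :+ (x :+ ρ)) :- x := con 1ℚ :+ ρ) refl (‖ z ‖) ρ)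
      near≤b : ∀ w → ‖ z - w ‖ < ρ → ‖ w ‖ ≤ b
      near≤b w near = ℚ.≤-trans (‖‖-triangle w z) (≤-from
        (0≤+ (≤⇒0≤- (subst (_≤ ρ) (‖z-w‖-sym z w) (ℚ.<⇒≤ near))) 0≤1)
        (solve 3 (λ x ρ y → (con 1ℚ :+ (x :+ ρ)) :- (y :+ x) := (ρ :- y) :+ con 1ℚ)
          refl (‖ z ‖) ρ (‖ w - z ‖)))

      Result : Set
      Result = ∃ λ w → ‖ z - w ‖ < ρ × SmallAt w θ

      stage₁ : (∃ λ τ → 0ℚ < τ × τ ≤ threshold ρ × τ ≤ ½ ℚ.* θ) → Result
      stage₁ (τ , 0<τ , τ≤ρ , τ≤θ) = stage₂ (quotient 0<K 0<τ)
        where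
        stage₂ : (∃ λ ε → 0ℚ < ε × K ℚ.* ε ≡ τ) → Result
        stage₂ (ε , 0<ε , Kε≡τ) = stage₃ (poly-cauchy f ε 0<ε)
          where
          close : ∀ (g h : Vec 𝔾 (suc n)) w → ‖ w ‖ ≤ b → dist g h < ε → ‖ ⟦ g ⟧ w - ⟦ h ⟧ w ‖ < τ
          close g h w w≤b g≈h = ℚ.≤-<-trans (⟦⟧-lipschitz g h w 1≤b w≤b)
            (subst (K ℚ.* dist g h <_) Kε≡τ (ℚ.*-monoʳ-<-pos K {{ℚ.positive 0<K}} g≈h))

          stage₃ : (∃ λ N → ∀ i j → N ℕ.≤ i → N ℕ.≤ j → dist (F i) (F j) < ε) → Result
          stage₃ (N , hN) = stage₄ (approximate-roots (F (M ℕ.⊔ N)) 0<ε)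
           where
           m : ℕ
           m = M ℕ.⊔ N
           stage₄ : (∃ λ ws → dist (F m) (from-roots ws) < ε) → Result
           stage₄ (ws , Fm≈g) = stage₅ (nearest-root ws z 0<ρ g-small)
            where
            g : Vec 𝔾 (suc n)
            g = from-roots ws
            g-small : ‖ ⟦ g ⟧ z ‖ < power (½ ℚ.* ρ) (suc n)
            g-small = ℚ.≤-<-trans (‖‖-triangle (⟦ g ⟧ z) (⟦ F m ⟧ z))
              (sum< (‖ ⟦ g ⟧ z - ⟦ F m ⟧ z ‖) (‖ ⟦ F m ⟧ z ‖)
                (ℚ.<-≤-trans (close g (F m) z z≤b (subst (_< ε) (dist-sym (F m) g) Fm≈g)) τ≤ρ)
                (small m (ℕ.m≤m⊔n M N)))
            stage₅ : (∃ λ w → ‖ z - w ‖ < ρ × ⟦ g ⟧ w ≡ 0𝔾) → Result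
            stage₅ (w , near , gw≡0) = w , near , N , λ k N≤k →
              ℚ.≤-<-trans (‖‖-triangle (⟦ F k ⟧ w) (⟦ F m ⟧ w))
                (sum< (‖ ⟦ F k ⟧ w - ⟦ F m ⟧ w ‖) (‖ ⟦ F m ⟧ w ‖)
                  (ℚ.<-≤-trans (close (F k) (F m) w (near≤b w near) (hN k m N≤k (ℕ.m≤n⊔m M N))) τ≤θ)
                  (ℚ.<-≤-trans (subst (λ v → ‖ v ‖ < τ)
                    (trans (cong (λ v → ⟦ F m ⟧ w - v) gw≡0)
                      (G.solve 1 (λ v → v G.:- G.con 0𝔾 G.:= v) refl (⟦ F m ⟧ w)))
                    (close (F m) g w (near≤b w near) Fm≈g)) τ≤θ))

    private
      Approximation : ℕ → Set
      Approximation j = ∃ λ z → SmallAt z (threshold (halving j))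

    next : ∀ j → ((z , _) : Approximation j) →
      ∃ λ w → ‖ z - w ‖ < halving j × SmallAt w (threshold (halving (suc j)))
    next j (z , small) = refine (0<halving j) small (0<threshold (0<halving (suc j)))

    initial : Approximation 0
    initial = stage₁ (at-bounded (eval f 0ℂ))
      where
      stage₁ : (∃ λ B → 1ℚ ≤ B × Eventually λ k → ‖ at k (eval f 0ℂ) ‖ ≤ B) → Approximation 0
      stage₁ (B , 1≤B , below) = conclude (refine {ρ} 0<ρ {0𝔾} small (0<threshold (0<halving 0)))
        where
        ρ : ℚ
        -- A radius so large that the bounded values at 0 count as small: ρ/2 = 1 + 2 B ≥ 1, hence
        -- `threshold ρ` ≥ (1 + 2 B)/2 > B.
        ρ = 2ℚ ℚ.* (1ℚ ℚ.+ 2ℚ ℚ.* B)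
        0<B = ℚ.<-≤-trans 0<1 1≤B
        0<2B = 0<* (ℚ.positive⁻¹ 2ℚ) 0<B
        0<ρ : 0ℚ < ρ
        0<ρ = 0<* (ℚ.positive⁻¹ 2ℚ) (0<+ 0<1 (ℚ.<⇒≤ 0<2B))
        1≤x : 1ℚ ≤ 1ℚ ℚ.+ 2ℚ ℚ.* B
        1≤x = ≤-from (ℚ.<⇒≤ 0<2B) (solve 1 (λ x → (con 1ℚ :+ x) :- con 1ℚ := x) refl (2ℚ ℚ.* B))
        B<threshold : B < threshold ρ
        B<threshold = subst (λ x → B < ½ ℚ.* (x ℚ.* power x n))
          (solve 1 (λ B → con 1ℚ :+ con 2ℚ :* B
            := con ½ :* (con 2ℚ :* (con 1ℚ :+ con 2ℚ :* B))) refl B)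
          (ℚ.<-≤-trans
            (<-from (ℚ.positive⁻¹ ½) (solve 1 (λ B → con ½ :* ((con 1ℚ :+ con 2ℚ :* B) :* con 1ℚ) :- B
              := con ½) refl B))
            (*-mono {½} (ℚ.nonNegative⁻¹ ½) (0≤* 0≤x 0≤1) ℚ.≤-refl
              (*-mono {1ℚ ℚ.+ 2ℚ ℚ.* B} 0≤x 0≤1 ℚ.≤-refl (1≤power 1≤x n))))
          where
          0≤x = ℚ.≤-trans 0≤1 1≤x
        small : SmallAt 0𝔾 (threshold ρ)
        small = ev-map (λ k le → ℚ.≤-<-trans (subst (λ v → ‖ v ‖ ≤ B) (at-eval f 0ℂ k) le) B<threshold) below
        conclude : (∃ λ w → ‖ 0𝔾 - w ‖ < ρ × SmallAt w (threshold (halving 0))) → Approximation 0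
        conclude (w , _ , small) = w , small

    approximation : ∀ j → Approximation j
    approximation zero    = initial
    approximation (suc j) = let w , _ , small = next j (approximation j) in w , small

    z : ℕ → 𝔾
    z j = proj₁ (approximation j)

    z-small : ∀ j → SmallAt (z j) (threshold (halving j))
    z-small j = proj₂ (approximation j)

    z-step : ∀ j → ‖ z j - z (suc j) ‖ < halving j
    z-step j = proj₁ (proj₂ (next j (approximation j)))

    -- The closed form of the geometric sum of the step lengths turns the induction into a ring
    -- identity.
    z-near : ∀ j i → ‖ z j - z (i ℕ.+ j) ‖ ≤ 2ℚ ℚ.* (halving j ℚ.- halving (i ℕ.+ j))
    z-near j zero = ℚ.≤-reflexive (trans (‖z-z‖≡0 (z j))
      (solve 1 (λ h → con 0ℚ := con 2ℚ :* (h :- h)) refl (halving j)))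
    z-near j (suc i) = ℚ.≤-trans (‖-‖-triangle (z j) (z (i ℕ.+ j)) (z (suc i ℕ.+ j)))
      (ℚ.≤-trans (ℚ.+-mono-≤ (z-near j i) (ℚ.<⇒≤ (z-step (i ℕ.+ j)))) (ℚ.≤-reflexive
        (solve 2 (λ h g → con 2ℚ :* (h :- g) :+ g := con 2ℚ :* (h :- con ½ :* g))
          refl (halving j) (halving (i ℕ.+ j)))))

    z-close : ∀ j m → j ℕ.≤ m → ‖ z j - z m ‖ ≤ 2ℚ ℚ.* halving j
    z-close j m j≤m = subst (λ i → ‖ z j - z i ‖ ≤ 2ℚ ℚ.* halving j) (ℕ.m∸n+n≡m j≤m)
      (ℚ.≤-trans (z-near j (m ℕ.∸ j)) (≤-from (ℚ.<⇒≤ (0<* (ℚ.positive⁻¹ 2ℚ) (0<halving (m ℕ.∸ j ℕ.+ j))))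
        (solve 2 (λ h g → con 2ℚ :* h :- con 2ℚ :* (h :- g) := con 2ℚ :* g)
          refl (halving j) (halving (m ℕ.∸ j ℕ.+ j)))))

    z-cauchy : ∀ ε → 0ℚ < ε → ∃ λ N → ∀ m k → N ℕ.≤ m → N ℕ.≤ k → ‖ z m - z k ‖ < ε
    z-cauchy ε 0<ε = from (halving-small (0<* (0<* (ℚ.positive⁻¹ ½) (ℚ.positive⁻¹ ½)) 0<ε))
      where
      from : (∃ λ J → ∀ j → J ℕ.≤ j → halving j < ½ ℚ.* ½ ℚ.* ε) →
        ∃ λ N → ∀ m k → N ℕ.≤ m → N ℕ.≤ k → ‖ z m - z k ‖ < ε
      from (J , small) = J , λ m k J≤m J≤k → ℚ.≤-<-trans (‖-‖-triangle (z m) (z J) (z k))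
        (ℚ.≤-<-trans
          (ℚ.+-mono-≤ (subst (_≤ 2ℚ ℚ.* halving J) (‖z-w‖-sym (z J) (z m)) (z-close J m J≤m)) (z-close J k J≤k))
          (subst₂ ℚ._<_
            (solve 1 (λ h → con 4ℚ :* h := con 2ℚ :* h :+ con 2ℚ :* h) refl (halving J))
            (solve 1 (λ e → con 4ℚ :* (con ½ :* con ½ :* e) := e) refl ε)
            (ℚ.*-monoʳ-<-pos 4ℚ (small J ℕ.≤-refl))))

    root : ℂ
    root = mkℝ (λ k → 𝔾.re (z k)) (component 𝔾.re (λ { (_ ⊹ _) (_ ⊹ _) → refl }) ∣re∣≤‖_‖)
        +i mkℝ (λ k → 𝔾.im (z k)) (component 𝔾.im (λ { (_ ⊹ _) (_ ⊹ _) → refl }) ∣im∣≤‖_‖)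
      where
      component : (π : 𝔾 → ℚ) → (∀ z w → π (z - w) ≡ π z ℚ.- π w) → (∀ z → ∣ π z ∣ ≤ ‖ z ‖) →
        D.IsCauchy (λ k → π (z k))
      component π π-- ∣π∣≤ ε 0<ε = from (z-cauchy ε 0<ε)
        where
        from : (∃ λ N → ∀ m k → N ℕ.≤ m → N ℕ.≤ k → ‖ z m - z k ‖ < ε) →
          ∃ λ N → ∀ m k → N ℕ.≤ m → N ℕ.≤ k → ∣ π (z m) ℚ.- π (z k) ∣ < ε
        from (N , hN) = N , λ m k N≤m N≤k → ℚ.≤-<-trans
          (subst (λ t → ∣ t ∣ ≤ ‖ z m - z k ‖) (π-- (z m) (z k)) (∣π∣≤ (z m - z k))) (hN m k N≤m N≤k)

    at-root : ∀ k → at k root ≡ z k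
    at-root k = eta (z k)
      where
      eta : ∀ w → 𝔾.re w ⊹ 𝔾.im w ≡ w
      eta (_ ⊹ _) = refl

    threshold≤ : ∀ {ρ} → 0ℚ ≤ ρ → ρ ≤ 1ℚ → threshold ρ ≤ ρ
    threshold≤ {ρ} 0≤ρ ρ≤1 = ℚ.≤-trans
      (*-mono {½} {1ℚ} 0≤1 (0≤* 0≤½ρ (0≤power n)) (≤-from {½} {1ℚ} 0≤½ refl)
        (*-mono {½ ℚ.* ρ} {ρ} 0≤ρ (0≤power n) ½ρ≤ρ (power≤1 n)))
      (ℚ.≤-reflexive (solve 1 (λ x → con 1ℚ :* (x :* con 1ℚ) := x) refl ρ))
      where
      0≤½ = ℚ.nonNegative⁻¹ ½
      0≤½ρ : 0ℚ ≤ ½ ℚ.* ρ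
      0≤½ρ = 0≤* 0≤½ 0≤ρ
      ½ρ≤ρ : ½ ℚ.* ρ ≤ ρ
      ½ρ≤ρ = ≤-from 0≤½ρ (solve 1 (λ x → x :- con ½ :* x := con ½ :* x) refl ρ)
      0≤power : ∀ k → 0ℚ ≤ power (½ ℚ.* ρ) k
      0≤power zero    = 0≤1
      0≤power (suc k) = 0≤* 0≤½ρ (0≤power k)
      power≤1 : ∀ k → power (½ ℚ.* ρ) k ≤ 1ℚ
      power≤1 zero    = ℚ.≤-refl
      power≤1 (suc k) = *-mono {½ ℚ.* ρ} {1ℚ} {power (½ ℚ.* ρ) k} {1ℚ} 0≤1 (0≤power k)
        (ℚ.≤-trans ½ρ≤ρ ρ≤1) (power≤1 k)

    z-root : Vanishes λ k → ‖ ⟦ F k ⟧ (z k) ‖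
    z-root ε 0<ε = stage₁ (quotient 0<K (0<half 0<ε)) (halving-small (0<half 0<ε))
      where
      b K : ℚ
      b = 1ℚ ℚ.+ (‖ z 0 ‖ ℚ.+ 2ℚ)
      K = power b (suc n)
      1≤b : 1ℚ ≤ b
      1≤b = ≤-from (0≤+ 0≤‖ z 0 ‖ (ℚ.nonNegative⁻¹ 2ℚ))
        (solve 1 (λ x → (con 1ℚ :+ x) :- con 1ℚ := x) refl (‖ z 0 ‖ ℚ.+ 2ℚ))
      0<K : 0ℚ < K
      0<K = ℚ.<-≤-trans 0<1 (1≤power 1≤b (suc n))
      z≤b : ∀ m → ‖ z m ‖ ≤ b
      z≤b m = ℚ.≤-trans (‖‖-triangle (z m) (z 0)) (≤-from
        (0≤+ (≤⇒0≤- (subst (_≤ 2ℚ) (‖z-w‖-sym (z 0) (z m)) (z-close 0 m ℕ.z≤n))) 0≤1)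
        (solve 2 (λ x y → (con 1ℚ :+ (x :+ con 2ℚ)) :- (y :+ x) := (con 2ℚ :- y) :+ con 1ℚ)
          refl (‖ z 0 ‖) (‖ z m - z 0 ‖)))

      stage₁ : (∃ λ δ → 0ℚ < δ × K ℚ.* δ ≡ ½ ℚ.* ε) → (∃ λ J → ∀ j → J ℕ.≤ j → halving j < ½ ℚ.* ε) →
        Eventually λ k → ‖ ⟦ F k ⟧ (z k) ‖ < ε
      stage₁ (δ , 0<δ , Kδ≡½ε) (J , small) = stage₂ (poly-cauchy f δ 0<δ)
        where
        stage₂ : (∃ λ N → ∀ i j → N ℕ.≤ i → N ℕ.≤ j → dist (F i) (F j) < δ) →
          Eventually λ k → ‖ ⟦ F k ⟧ (z k) ‖ < ε
        stage₂ (N , hN) = J ℕ.⊔ N , λ m J⊔N≤m →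
          stage₃ m (ℕ.m⊔n≤o⇒m≤o J N J⊔N≤m) (ℕ.m⊔n≤o⇒n≤o J N J⊔N≤m) (z-small m)
          where
          stage₃ : ∀ m → J ℕ.≤ m → N ℕ.≤ m → SmallAt (z m) (threshold (halving m)) → ‖ ⟦ F m ⟧ (z m) ‖ < ε
          -- The smallness of F k at z m starts only at an index M that depends on m, so F m is
          -- compared with a later F k at the same point.
          stage₃ m J≤m N≤m (M , hM) = ℚ.≤-<-trans (‖‖-triangle (⟦ F m ⟧ (z m)) (⟦ F k ⟧ (z m)))
            (sum< (‖ ⟦ F m ⟧ (z m) - ⟦ F k ⟧ (z m) ‖) (‖ ⟦ F k ⟧ (z m) ‖)
              (ℚ.≤-<-trans (⟦⟧-lipschitz (F m) (F k) (z m) 1≤b (z≤b m))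
                (subst (K ℚ.* dist (F m) (F k) <_) Kδ≡½ε
                  (ℚ.*-monoʳ-<-pos K {{ℚ.positive 0<K}} (hN m k N≤m (ℕ.m≤n⊔m M N)))))
              (ℚ.<-≤-trans (hM k (ℕ.m≤m⊔n M N))
                (ℚ.≤-trans (threshold≤ (ℚ.<⇒≤ (0<halving m)) (halving≤1 m)) (ℚ.<⇒≤ (small m J≤m)))))
            where
            k : ℕ
            k = M ℕ.⊔ N

  abstract
    complex-root : ∀ {n} (f : Vec ℂ (suc n)) → ∃ λ z → Vanishes λ k → ‖ at k (eval f z) ‖
    complex-root f = root , λ ε 0<ε → ev-map
      (λ k → subst (_< ε) (cong ‖_‖ (sym (trans (at-eval f root k) (cong ⟦ F k ⟧ (at-root k))))))
      (z-root ε 0<ε)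
      where open Root f

    times-linear-limit : ∀ {n} (f : Vec ℂ (suc n)) w → Vanishes (λ k → ‖ at k (eval f w) ‖) →
      (g : ℕ → Vec 𝔾 n) → Vanishes (λ k → dist (map (at k) (deflateᶜ f w)) (g k)) →
      Vanishes λ k → dist (map (at k) f) (times-linear (at k w) (g k))
    times-linear-limit {n} f w fw→0 g d→g ε 0<ε = stage₁ (at-bounded w)
      where
      h : ℕ → Vec 𝔾 n
      h k = deflate (map (at k) f) (at k w)
      Result : Set
      Result = Eventually λ k → dist (map (at k) f) (times-linear (at k w) (g k)) < ε
      stage₁ : (∃ λ B → 1ℚ ≤ B × Eventually λ k → ‖ at k w ‖ ≤ B) → Result
      stage₁ (B , 1≤B , w≤B) = stage₂ (quotient 0<1+B (0<half 0<ε))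
        where
        0<1+B : 0ℚ < 1ℚ ℚ.+ B
        0<1+B = 0<+ 0<1 (ℚ.≤-trans 0≤1 1≤B)
        stage₂ : (∃ λ δ → 0ℚ < δ × (1ℚ ℚ.+ B) ℚ.* δ ≡ ½ ℚ.* ε) → Result
        stage₂ (δ , 0<δ , [1+B]δ≡½ε) = ev-zip combine (fw→0 (½ ℚ.* ε) (0<half 0<ε))
          (ev-zip {Q = λ k → dist (map (at k) (deflateᶜ f w)) (g k) < δ} (λ k → _,_) w≤B (d→g δ 0<δ))
          where
          combine : ∀ k → ‖ at k (eval f w) ‖ < ½ ℚ.* ε →
            ‖ at k w ‖ ≤ B × dist (map (at k) (deflateᶜ f w)) (g k) < δ →
            dist (map (at k) f) (times-linear (at k w) (g k)) < ε
          combine k fw< (w≤B , g<) = ℚ.≤-<-trans (dist-via-deflate (map (at k) f) (at k w) (g k))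
            (sum< (‖ ⟦ map (at k) f ⟧ (at k w) ‖) ((1ℚ ℚ.+ ‖ at k w ‖) ℚ.* dist (h k) (g k))
              (subst (λ v → ‖ v ‖ < ½ ℚ.* ε) (at-eval f w k) fw<)
              (subst ((1ℚ ℚ.+ ‖ at k w ‖) ℚ.* dist (h k) (g k) <_) [1+B]δ≡½ε
                (ℚ.≤-<-trans
                  (ℚ.*-monoʳ-≤-nonNeg (dist (h k) (g k)) {{ℚ.nonNegative (0≤dist (h k) (g k))}} (ℚ.+-monoʳ-≤ 1ℚ w≤B))
                  (ℚ.*-monoʳ-<-pos (1ℚ ℚ.+ B) {{ℚ.positive 0<1+B}}
                    (subst (λ d → dist d (g k) < δ) (at-deflateᶜ f w k) g<)))))

    complex-factorization : ∀ {n} (f : Vec ℂ n) → ∃ λ (ws : Vec ℂ n) →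
      Vanishes λ k → dist (map (at k) f) (from-roots (map (at k) ws))
    complex-factorization []        = [] , λ ε 0<ε → always {λ _ → 0ℚ < ε} λ _ → 0<ε
    complex-factorization f@(_ ∷ _) = stage₁ (complex-root f)
      where
      Result : Set
      Result = ∃ λ ws → Vanishes λ k → dist (map (at k) f) (from-roots (map (at k) ws))
      stage₁ : (∃ λ w → Vanishes λ k → ‖ at k (eval f w) ‖) → Result
      stage₁ (w , fw→0) = stage₂ (complex-factorization (deflateᶜ f w))
        where
        stage₂ : (∃ λ ws → Vanishes λ k → dist (map (at k) (deflateᶜ f w)) (from-roots (map (at k) ws))) → Result
        stage₂ (ws , g→) = w ∷ ws , times-linear-limit f w fw→0 (λ k → from-roots (map (at k) ws)) g→

-- Inequalities between limits of rational sequences.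

module RealLimits where

  open import Data.Rational.Base using (_≤_; _<_; ∣_∣)
  open RationalOrder
  open ComplexRoots using (Eventually; always; ev-map; ev-zip; witness)
  open import Defs using (seq; cauchy)

  open ℚ.+-*-Solver using (solve; con; _:+_; _:*_; _:-_; :-_; _:=_)

  Seq : Set
  Seq = ℕ → ℚ

  record Bounded (x : Seq) : Set where
    constructor bounded-by
    field
      size     : ℚ
      1≤size   : 1ℚ ≤ size
      x≤size   : Eventually λ k → ∣ x k ∣ ≤ size

  -- The statement that the limit is at least 0, in a form closed under sums and products; the bound
  -- is carried for the sake of `nonNeg-*`.
  record NonNeg (x : Seq) : Set where
    constructor nonNeg
    field
      is-bounded : Bounded x
      above      : ∀ ε → 0ℚ < ε → Eventually λ k → ℚ.- ε < x k

  record Null (x : Seq) : Set where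
    constructor null
    field
      within : ∀ ε → 0ℚ < ε → Eventually λ k → ∣ x k ∣ < ε

  open NonNeg public
  open Null public

  ∣x∣<⇒x< : ∀ {x ε} → ∣ x ∣ < ε → x < ε
  ∣x∣<⇒x< {x} x<ε with ℚ.∣p∣≡p∨∣p∣≡-p x
  ... | inj₁ eq = subst (_< _) eq x<ε
  ... | inj₂ eq with 0ℚ ℚ.≤? x
  ...   | yes 0≤x = subst (_< _) (ℚ.0≤p⇒∣p∣≡p 0≤x) x<ε
  ...   | no  0≰x = ℚ.<-trans (ℚ.≰⇒> 0≰x) (ℚ.≤-<-trans (ℚ.0≤∣p∣ x) x<ε)

  ∣x∣<⇒-ε<x : ∀ {x ε} → ∣ x ∣ < ε → ℚ.- ε < x
  ∣x∣<⇒-ε<x {x} {ε} x<ε = subst (ℚ.- ε <_) (solve 1 (λ x → :- :- x := x) refl x)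
    (ℚ.neg-antimono-< (∣x∣<⇒x< (subst (_< ε) (sym (ℚ.∣-p∣≡∣p∣ x)) x<ε)))

  ∣x∣<-intro : ∀ {x ε} → x < ε → ℚ.- ε < x → ∣ x ∣ < ε
  ∣x∣<-intro {x} {ε} x<ε -ε<x with ℚ.∣p∣≡p∨∣p∣≡-p x
  ... | inj₁ eq = subst (_< ε) (sym eq) x<ε
  ... | inj₂ eq = subst₂ ℚ._<_ (sym eq) (solve 1 (λ x → :- :- x := x) refl ε) (ℚ.neg-antimono-< -ε<x)

  1≤1+ : ∀ {y} → 0ℚ ≤ y → 1ℚ ≤ 1ℚ ℚ.+ y
  1≤1+ {y} 0≤y = ≤-from 0≤y (solve 1 (λ y → (con 1ℚ :+ y) :- con 1ℚ := y) refl y)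

  bounded-const : ∀ c → Bounded (λ _ → c)
  bounded-const c = bounded-by (1ℚ ℚ.+ ∣ c ∣) (1≤1+ (ℚ.0≤∣p∣ c)) (always λ _ →
    ≤-from 0≤1 (solve 1 (λ y → (con 1ℚ :+ y) :- y := con 1ℚ) refl (∣ c ∣)))

  bounded-seq : ∀ x → Bounded (seq x)
  bounded-seq x = from (cauchy x 1ℚ 0<1)
    where
    from : (∃ λ N → ∀ m n → N ℕ.≤ m → N ℕ.≤ n → ∣ seq x m ℚ.- seq x n ∣ < 1ℚ) → Bounded (seq x)
    from (N , hN) = bounded-by (1ℚ ℚ.+ ∣ seq x N ∣) (1≤1+ (ℚ.0≤∣p∣ (seq x N)))
      (N , λ k N≤k → ℚ.≤-trans
          (subst (λ t → ∣ t ∣ ≤ ∣ seq x k ℚ.- seq x N ∣ ℚ.+ ∣ seq x N ∣)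
            (solve 2 (λ a b → (a :- b) :+ b := a) refl (seq x k) (seq x N))
            (ℚ.∣p+q∣≤∣p∣+∣q∣ (seq x k ℚ.- seq x N) (seq x N)))
          (ℚ.+-monoˡ-≤ (∣ seq x N ∣) (ℚ.<⇒≤ (hN k N N≤k ℕ.≤-refl))))

  bounded-+ : ∀ {x y} → Bounded x → Bounded y → Bounded (λ k → x k ℚ.+ y k)
  bounded-+ {x} {y} (bounded-by A 1≤A x≤A) (bounded-by B 1≤B y≤B) = bounded-by (A ℚ.+ B)
    (≤-from (0≤+ (≤⇒0≤- 1≤A) (ℚ.≤-trans 0≤1 1≤B))
      (solve 2 (λ a b → (a :+ b) :- con 1ℚ := (a :- con 1ℚ) :+ b) refl A B))
    (ev-zip (λ k a b → ℚ.≤-trans (ℚ.∣p+q∣≤∣p∣+∣q∣ (x k) (y k)) (ℚ.+-mono-≤ a b)) x≤A y≤B)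

  bounded-* : ∀ {x y} → Bounded x → Bounded y → Bounded (λ k → x k ℚ.* y k)
  bounded-* {x} {y} (bounded-by A 1≤A x≤A) (bounded-by B 1≤B y≤B) = bounded-by (A ℚ.* B)
    (*-mono {1ℚ} {A} {1ℚ} {B} 0≤A 0≤1 1≤A 1≤B)
    (ev-zip (λ k a b → ℚ.≤-trans (ℚ.≤-reflexive (ℚ.∣p*q∣≡∣p∣*∣q∣ (x k) (y k))) (*-mono 0≤A (ℚ.0≤∣p∣ (y k)) a b)) x≤A y≤B)
    where 0≤A = ℚ.≤-trans 0≤1 1≤A

  bounded-neg : ∀ {x} → Bounded x → Bounded (λ k → ℚ.- x k)
  bounded-neg {x} (bounded-by A 1≤A x≤A) = bounded-by A 1≤A
    (ev-map (λ k → subst (_≤ A) (sym (ℚ.∣-p∣≡∣p∣ (x k)))) x≤A)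

  bounded-resp : ∀ {x y} → Bounded x → (∀ k → x k ≡ y k) → Bounded y
  bounded-resp (bounded-by A 1≤A x≤A) eq = bounded-by A 1≤A (ev-map (λ k → subst (λ t → ∣ t ∣ ≤ A) (eq k)) x≤A)

  nonNeg-resp : ∀ {x y} → NonNeg x → (∀ k → x k ≡ y k) → NonNeg y
  nonNeg-resp (nonNeg b h) eq = nonNeg (bounded-resp b eq)
    λ ε 0<ε → ev-map (λ k → subst (ℚ.- ε <_) (eq k)) (h ε 0<ε)

  eventually-nonNeg : ∀ {x} → Bounded x → Eventually (λ k → 0ℚ ≤ x k) → NonNeg x
  eventually-nonNeg b h = nonNeg b λ ε 0<ε → ev-map (λ k → ℚ.<-≤-trans (ℚ.neg-antimono-< 0<ε)) h

  nonNeg-const : ∀ {c} → 0ℚ ≤ c → NonNeg (λ _ → c)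
  nonNeg-const {c} 0≤c = eventually-nonNeg (bounded-const c) (always λ _ → 0≤c)

  nonNeg-const⁻¹ : ∀ {c} → NonNeg (λ _ → c) → 0ℚ ≤ c
  nonNeg-const⁻¹ {c} (nonNeg _ h) = ℚ.≮⇒≥ λ c<0 → absurd (witness (h (ℚ.- c) (ℚ.neg-antimono-< c<0)))
    where
    absurd : (∃ λ (k : ℕ) → ℚ.- (ℚ.- c) < c) → ⊥
    absurd (_ , lt) = ℚ.<-irrefl (solve 1 (λ c → :- (:- c) := c) refl c) lt

  -- The end of a positivity certificate: nonnegative quantities are combined into an expression
  -- that the ring solver identifies with a negative constant.
  nonNeg-⊥ : ∀ {x c} → 0ℚ < c → NonNeg x → (∀ k → x k ≡ ℚ.- c) → ⊥
  nonNeg-⊥ {x} {c} 0<c h eq = ℚ.<-irrefl refl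
    (ℚ.<-≤-trans (ℚ.neg-antimono-< 0<c) (nonNeg-const⁻¹ (nonNeg-resp h eq)))

  nonNeg-+ : ∀ {x y} → NonNeg x → NonNeg y → NonNeg (λ k → x k ℚ.+ y k)
  nonNeg-+ {x} {y} (nonNeg a h) (nonNeg b g) = nonNeg (bounded-+ a b) λ ε 0<ε → ev-zip
    (λ k a b → subst (_< x k ℚ.+ y k)
      (solve 1 (λ ε → (:- (con ½ :* ε)) :+ (:- (con ½ :* ε)) := :- ε) refl ε) (ℚ.+-mono-< a b))
    (h (½ ℚ.* ε) (0<half 0<ε)) (g (½ ℚ.* ε) (0<half 0<ε))

  nonNeg-* : ∀ {x y} → NonNeg x → NonNeg y → NonNeg (λ k → x k ℚ.* y k)
  nonNeg-* {x} {y} (nonNeg xb@(bounded-by A 1≤A x≤A) h) (nonNeg yb@(bounded-by B 1≤B y≤B) g) =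
    -- For a, b > -c with c ≤ 1, (a + c)(b + c) ≥ 0 gives a b ≥ -c (a + b + c) > -c (A + B + 2); d
    -- is chosen so that (A + B + 2) d = ε, and c ≤ d.
    nonNeg (bounded-* xb yb) λ ε 0<ε → stage₂ ε (quotient {A ℚ.+ B ℚ.+ 1ℚ ℚ.+ 1ℚ} 0<S 0<ε)
    where
    0≤A = ℚ.≤-trans 0≤1 1≤A
    0≤B = ℚ.≤-trans 0≤1 1≤B
    0<S : 0ℚ < A ℚ.+ B ℚ.+ 1ℚ ℚ.+ 1ℚ
    0<S = 0<+′ (0≤+ (0≤+ 0≤A 0≤B) 0≤1) 0<1
    stage₂ : ∀ ε → (∃ λ d → 0ℚ < d × (A ℚ.+ B ℚ.+ 1ℚ ℚ.+ 1ℚ) ℚ.* d ≡ ε) → Eventually λ k → ℚ.- ε < x k ℚ.* y k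
    stage₂ ε (d , 0<d , Sd≡ε) = stage₃ (smaller 0<d 0<1)
      where
      stage₃ : (∃ λ c → 0ℚ < c × c ≤ d × c ≤ 1ℚ) → Eventually λ k → ℚ.- ε < x k ℚ.* y k
      stage₃ (c , 0<c , c≤d , c≤1) = ev-zip
        (λ k (x> , x≤) (y> , y≤) → product (x k) (y k) x> x≤ y> y≤)
        (ev-zip {λ k → ℚ.- c < x k} (λ k → _,_) (h c 0<c) x≤A)
        (ev-zip {λ k → ℚ.- c < y k} (λ k → _,_) (g c 0<c) y≤B)
        where
        to≤ : ∀ {a b} → ∣ a ∣ ≤ b → 0ℚ ≤ b ℚ.- a
        to≤ {a} {b} a≤b = ≤⇒0≤- (ℚ.≤-trans (ℚ.≮⇒≥ λ a> → ℚ.<-irrefl refl (∣x∣<⇒x< a>)) a≤b)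
        from> : ∀ {a} → ℚ.- c < a → 0ℚ ≤ a ℚ.+ c
        from> {a} lt = subst (0ℚ ≤_) (solve 2 (λ a c → a :- (:- c) := a :+ c) refl a c) (≤⇒0≤- (ℚ.<⇒≤ lt))
        product : ∀ a b → ℚ.- c < a → ∣ a ∣ ≤ A → ℚ.- c < b → ∣ b ∣ ≤ B → ℚ.- ε < a ℚ.* b
        product a b a> a≤ b> b≤ = <-from
          (0<+′ (0≤+ (0≤+ (0≤* (from> a>) (from> b>))
              (0≤* (ℚ.<⇒≤ 0<c) (0≤+ (to≤ a≤) (0≤+ (to≤ b≤) (≤⇒0≤- c≤1)))))
              (0≤* (ℚ.<⇒≤ 0<S) (≤⇒0≤- c≤d))) 0<c)
          (trans (cong (λ e → a ℚ.* b ℚ.- (ℚ.- e)) (sym Sd≡ε))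
            (solve 6 (λ a b c d A B → a :* b :- (:- ((A :+ B :+ con 1ℚ :+ con 1ℚ) :* d))
              := (((a :+ c) :* (b :+ c)) :+ c :* ((A :- a) :+ ((B :- b) :+ (con 1ℚ :- c)))
                :+ (A :+ B :+ con 1ℚ :+ con 1ℚ) :* (d :- c)) :+ c) refl a b c d A B))

  nonNeg-square : ∀ {x} → Bounded x → NonNeg (λ k → x k ℚ.* x k)
  nonNeg-square {x} b = eventually-nonNeg (bounded-* b b) (always λ k → 0≤x² (x k))

  null-resp : ∀ {x y} → Null x → (∀ k → x k ≡ y k) → Null y
  null-resp (null h) eq = null λ ε 0<ε → ev-map (λ k → subst (λ t → ∣ t ∣ < ε) (eq k)) (h ε 0<ε)

  null⇒nonNeg : ∀ {x} → Null x → NonNeg x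
  null⇒nonNeg (null h) = nonNeg (bounded-by 1ℚ ℚ.≤-refl (ev-map (λ k → ℚ.<⇒≤) (h 1ℚ 0<1)))
    λ ε 0<ε → ev-map (λ k → ∣x∣<⇒-ε<x) (h ε 0<ε)

  null-+ : ∀ {x y} → Null x → Null y → Null (λ k → x k ℚ.+ y k)
  null-+ {x} {y} (null h) (null g) = null λ ε 0<ε → ev-zip
    (λ k a b → ℚ.≤-<-trans (ℚ.∣p+q∣≤∣p∣+∣q∣ (x k) (y k)) (sum< (∣ x k ∣) (∣ y k ∣) a b))
    (h (½ ℚ.* ε) (0<half 0<ε)) (g (½ ℚ.* ε) (0<half 0<ε))

  null-*ˡ : ∀ {c x} → Bounded c → Null x → Null (λ k → c k ℚ.* x k)
  null-*ˡ {c} {x} (bounded-by B 1≤B c≤B) (null h) = null λ ε 0<ε → from ε (quotient 0<B 0<ε)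
    where
    0<B = ℚ.<-≤-trans 0<1 1≤B
    from : ∀ ε → (∃ λ d → 0ℚ < d × B ℚ.* d ≡ ε) → Eventually λ k → ∣ c k ℚ.* x k ∣ < ε
    from ε (d , 0<d , Bd≡ε) = ev-zip {λ k → ∣ c k ∣ ≤ B} {λ k → ∣ x k ∣ < d} (λ k c≤B x<d → subst₂ ℚ._<_ (sym (ℚ.∣p*q∣≡∣p∣*∣q∣ (c k) (x k))) Bd≡ε
        (ℚ.≤-<-trans (ℚ.*-monoʳ-≤-nonNeg (∣ x k ∣) {{ℚ.∣-∣-nonNeg (x k)}} c≤B)
          (ℚ.*-monoʳ-<-pos B {{ℚ.positive 0<B}} x<d)))
      c≤B (h d 0<d)

  nonNeg-cancel : ∀ {x y : Seq} {c} → Bounded x → 0ℚ < c → Eventually (λ k → c ≤ y k) →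
    NonNeg (λ k → x k ℚ.* y k) → NonNeg x
  nonNeg-cancel {x} {y} {c} b 0<c y≥c (nonNeg _ h) = nonNeg b λ ε 0<ε → ev-zip {λ k → c ≤ y k}
    (λ k c≤y xy> → ℚ.≰⇒> λ x≤-ε → ℚ.<-irrefl refl (ℚ.<-≤-trans xy> (low ε 0<ε (x k) (y k) c≤y x≤-ε)))
    y≥c (h (ε ℚ.* c) (0<* 0<ε 0<c))
    where
    low : ∀ ε → 0ℚ < ε → ∀ a b → c ≤ b → a ≤ ℚ.- ε → a ℚ.* b ≤ ℚ.- (ε ℚ.* c)
    low ε 0<ε a b c≤b a≤-ε = ≤-from
      (0≤+ (0≤* (≤⇒0≤- a≤-ε) (ℚ.≤-trans (ℚ.<⇒≤ 0<c) c≤b)) (0≤* (ℚ.<⇒≤ 0<ε) (≤⇒0≤- c≤b)))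
      (solve 4 (λ ε a b c → (:- (ε :* c)) :- a :* b := ((:- ε) :- a) :* b :+ ε :* (b :- c)) refl ε a b c)

  -- Comparing one sufficiently late term of the sequence decides the alternative.
  nonNeg-dichotomy : ∀ x → ¬ (∃ λ ε → 0ℚ < ε × Eventually λ k → seq x k ≤ ℚ.- ε) → NonNeg (seq x)
  nonNeg-dichotomy x ¬neg = nonNeg (bounded-seq x) λ ε 0<ε → from ε 0<ε (cauchy x (½ ℚ.* (½ ℚ.* ε)) (0<half (0<half 0<ε)))
    where
    from : ∀ ε → 0ℚ < ε →
      (∃ λ N → ∀ m n → N ℕ.≤ m → N ℕ.≤ n → ∣ seq x m ℚ.- seq x n ∣ < ½ ℚ.* (½ ℚ.* ε)) →
      Eventually λ k → ℚ.- ε < seq x k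
    from ε 0<ε (N , hN) = decide (ℚ.- (½ ℚ.* ε) ℚ.≤? seq x N)
      where
      gap : ℚ
      -- The term at N is compared with -ε/2. With Cauchy tolerance ε/4, later terms lie above -3ε/4
      -- in one case and at most at -ε/4 in the other.
      gap = ½ ℚ.* (½ ℚ.* ε)
      0<gap : 0ℚ < gap
      0<gap = 0<half (0<half 0<ε)
      decide : Dec (ℚ.- (½ ℚ.* ε) ≤ seq x N) → Eventually λ k → ℚ.- ε < seq x k
      decide (yes high) = N , λ k N≤k → <-from
        (0<+ (<⇒0<- (∣x∣<⇒-ε<x (hN k N N≤k ℕ.≤-refl))) (0≤+ (≤⇒0≤- high) (ℚ.<⇒≤ 0<gap)))
        (solve 3 (λ ε a b → b :- (:- ε) := ((b :- a) :- (:- (con ½ :* (con ½ :* ε))))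
          :+ ((a :- (:- (con ½ :* ε))) :+ con ½ :* (con ½ :* ε))) refl ε (seq x N) (seq x k))
      decide (no low) = contradiction (gap , 0<gap , N , λ k N≤k → ≤-from
        (0≤+ (≤⇒0≤- (ℚ.<⇒≤ (∣x∣<⇒x< (hN k N N≤k ℕ.≤-refl)))) (≤⇒0≤- (ℚ.<⇒≤ (ℚ.≰⇒> low))))
        (solve 3 (λ ε a b → :- (con ½ :* (con ½ :* ε)) :- b := (con ½ :* (con ½ :* ε) :- (b :- a))
          :+ ((:- (con ½ :* ε)) :- a)) refl ε (seq x N) (seq x k))) ¬neg

-- Positivity certificates excluding the integer τ.

module Contradictions where

  open import Data.Rational.Base using (_≤_; _<_)
  open import Data.Integer.Base using (+_)
  open RationalOrder
  open ComplexRoots using (Eventually; ev-map)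
  open RealLimits
  
  infixl 6 _+_ _-_
  infixl 7 _*_

  _+_ _-_ _*_ : Seq → Seq → Seq
  x + y = λ k → x k ℚ.+ y k
  x - y = λ k → x k ℚ.- y k
  x * y = λ k → x k ℚ.* y k

  fromℚ : ℚ → Seq
  fromℚ c = λ _ → c

  open ℚ.+-*-Solver using (solve; con; _:+_; _:*_; _:-_; :-_; _:=_)

  [_] : ℕ → Seq
  [ n ] = fromℚ (+ n ℚ./ 1)

  -- A rational upper bound for (√5 - 1)/2 = 0.618.... It is precise enough everywhere except for
  -- the case τ ≤ 2 of `no-negative-conjugate`, where the quadratic inequality for the golden ratio
  -- itself enters.
  ⅝ : ℚ
  ⅝ = + 5 ℚ./ 8

  lower-bound : ∀ {x} c → 0ℚ < c → NonNeg x → Eventually λ k → ½ ℚ.* c ≤ x k ℚ.+ c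
  lower-bound {x} c 0<c h = ev-map (λ k lt → ≤-from (ℚ.<⇒≤ (<⇒0<- lt))
      (solve 2 (λ x c → (x :+ c) :- con ½ :* c := x :- (:- (con ½ :* c))) refl (x k) c))
    (above h (½ ℚ.* c) (0<* (ℚ.positive⁻¹ ½) 0<c))

  -- With p = q α and s = q + α, the hypotheses `upper` and `lower` say
  -- |p τ - s (p - 1)| ≤ p² - 1, factored.
  module _ (q α : Seq) (γ : ℚ) (0<γ : 0ℚ < γ)
    (q>1 : NonNeg (q - fromℚ (1ℚ ℚ.+ γ))) (q<2 : NonNeg (([ 2 ] - fromℚ γ) - q)) where

    private
      p : Seq
      p = q * α
      0≤γ : NonNeg (fromℚ γ)
      0≤γ = nonNeg-const (ℚ.<⇒≤ 0<γ)
      q≤2 : NonNeg ([ 2 ] - q)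
      q≤2 = nonNeg-resp (nonNeg-+ q<2 0≤γ) λ k →
        solve 2 (λ q g → ((con (+ 2 ℚ./ 1) :- g) :- q) :+ g := con (+ 2 ℚ./ 1) :- q) refl (q k) γ
      0≤q : NonNeg q
      0≤q = nonNeg-resp (nonNeg-+ q>1 (nonNeg-const {1ℚ ℚ.+ γ} (0≤+ 0≤1 (ℚ.<⇒≤ 0<γ)))) λ k →
        solve 2 (λ q g → (q :- (con 1ℚ :+ g)) :+ (con 1ℚ :+ g) := q) refl (q k) γ
      nat : ∀ n → NonNeg [ n ]
      nat n = nonNeg-const (ℚ.nonNegative⁻¹ _ {{ℚ.normalize-nonNeg n 1}})

    no-positive-conjugate : ∀ (τ : ℚ) → (τ ≤ 0ℚ ⊎ 1ℚ ≤ τ) → NonNeg α → NonNeg (fromℚ ⅝ - α) →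
      NonNeg ((p * p - [ 1 ]) - fromℚ γ) →
      NonNeg ((p - [ 1 ]) * ((q + [ 1 ]) * (α + [ 1 ])) - p * fromℚ τ) →
      NonNeg (p * fromℚ τ + (p - [ 1 ]) * ((q - [ 1 ]) * (α - [ 1 ]))) → ⊥
    no-positive-conjugate τ τ-gap 0≤α α≤⅝ p²>1 upper lower = cases τ-gap
      where
      0≤p : NonNeg p
      0≤p = nonNeg-* 0≤q 0≤α
      0≤p²-1 : NonNeg (p * p - [ 1 ])
      0≤p²-1 = nonNeg-resp (nonNeg-+ p²>1 0≤γ) λ k →
        solve 2 (λ x g → (x :- g) :+ g := x) refl (p k ℚ.* p k ℚ.- 1ℚ) γ
      1≤p : NonNeg (p - [ 1 ])
      1≤p = nonNeg-cancel {y = p + [ 1 ]} (bounded-+ (is-bounded 0≤p) (bounded-const (ℚ.- 1ℚ))) (ℚ.positive⁻¹ (½ ℚ.* 1ℚ)) (lower-bound {p} 1ℚ 0<1 0≤p)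
        (nonNeg-resp 0≤p²-1 λ k → solve 1 (λ p → p :* p :- con 1ℚ := (p :- con 1ℚ) :* (p :+ con 1ℚ)) refl (p k))
      cases : τ ≤ 0ℚ ⊎ 1ℚ ≤ τ → ⊥
      -- For τ ≤ 0, `lower` makes (p - 1)(q - 1)(α - 1) nonnegative although p, q > 1 and α ≤ 5/8.
      -- The factor p + 1 produces p² - 1, for which the margin γ is known, and 3/8 = 1 - 5/8.
      cases (inj₁ τ≤0) = nonNeg-⊥ (0<* {con⅜} (ℚ.positive⁻¹ con⅜) (0<* 0<γ 0<γ))
        (nonNeg-+
          (nonNeg-* (nonNeg-+ 0≤p (nat 1))
            (nonNeg-+ lower (nonNeg-* 0≤p (nonNeg-const (ℚ.neg-antimono-≤ τ≤0)))))
          (nonNeg-+ (nonNeg-* (nonNeg-* 0≤p²-1 (nonNeg-+ q>1 0≤γ)) α≤⅝)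
            (nonNeg-* (nonNeg-const (ℚ.nonNegative⁻¹ con⅜))
              (nonNeg-+ (nonNeg-* p²>1 (nonNeg-+ q>1 0≤γ)) (nonNeg-* 0≤γ q>1)))))
        λ k → solve 5 (λ q p α g τ →
          (p :+ con 1ℚ) :* ((p :* τ :+ (p :- con 1ℚ) :* ((q :- con 1ℚ) :* (α :- con 1ℚ))) :+ p :* (:- τ))
          :+ (((p :* p :- con 1ℚ) :* ((q :- (con 1ℚ :+ g)) :+ g)) :* (con ⅝ :- α)
          :+ con con⅜ :* (((p :* p :- con 1ℚ) :- g) :* ((q :- (con 1ℚ :+ g)) :+ g) :+ g :* (q :- (con 1ℚ :+ g))))
          := :- (con con⅜ :* (g :* g))) refl (q k) (p k) (α k) γ τ
        where
        con⅜ : ℚ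
        con⅜ = + 3 ℚ./ 8
      -- For τ ≥ 1, `upper` gives p ≤ (p - 1)(q + 1)(α + 1). At the extreme q = 2, α = 5/8, p = 5/4
      -- the right side is 39/32 and the left 40/32, which leaves 1/32. The factor 31/8 is the slope
      -- 3 · 13/8 - 1 in p.
      cases (inj₂ 1≤τ) = nonNeg-⊥ (ℚ.positive⁻¹ (+ 1 ℚ./ 32))
        (nonNeg-+ (nonNeg-+ upper (nonNeg-* 0≤p (nonNeg-const (≤⇒0≤- 1≤τ))))
          (nonNeg-+
            (nonNeg-* 1≤p (nonNeg-+ (nonNeg-* q≤2 (nonNeg-+ 0≤α (nat 1))) (nonNeg-* (nat 3) α≤⅝)))
            (nonNeg-* (nonNeg-const (ℚ.nonNegative⁻¹ (+ 31 ℚ./ 8)))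
              (nonNeg-+ (nonNeg-* q≤2 0≤α) (nonNeg-* (nat 2) α≤⅝)))))
        λ k → solve 3 (λ q α τ → let p = q :* α in
          (((p :- con 1ℚ) :* ((q :+ con 1ℚ) :* (α :+ con 1ℚ)) :- p :* τ) :+ p :* (τ :- con 1ℚ))
          :+ ((p :- con 1ℚ) :* ((con (+ 2 ℚ./ 1) :- q) :* (α :+ con 1ℚ) :+ con (+ 3 ℚ./ 1) :* (con ⅝ :- α))
          :+ con (+ 31 ℚ./ 8) :* ((con (+ 2 ℚ./ 1) :- q) :* α :+ con (+ 2 ℚ./ 1) :* (con ⅝ :- α)))
          := :- con (+ 1 ℚ./ 32)) refl (q k) (α k) τ

    -- This is the quadratic P with p = 1, where p² - 1 has no margin. Multiplying by q removes 1/q: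
    -- σ q = q² + 1, which exceeds 2 q because (q - 1)² > 0, and is below 3 q because q² - 3 q + 1 =
    -- -1 - (q - 1)(2 - q).
    no-quadratic-unit : ∀ (σ : ℚ) → (σ ≤ + 2 ℚ./ 1 ⊎ + 3 ℚ./ 1 ≤ σ) →
      Null (p - [ 1 ]) → Null ((q + α) - fromℚ σ) → ⊥
    no-quadratic-unit σ σ-gap p≈1 s≈σ = cases σ-gap
      where
      qσ≈ : Null (q * fromℚ σ - (q * q + [ 1 ]))
      qσ≈ = null-resp (null-+ p≈1 (null-*ˡ (bounded-neg (is-bounded 0≤q)) s≈σ)) λ k →
        solve 3 (λ q α σ → (q :* α :- con 1ℚ) :+ (:- q) :* ((q :+ α) :- σ) := q :* σ :- (q :* q :+ con 1ℚ))
          refl (q k) (α k) σ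
      -qσ≈ : Null ((q * q + [ 1 ]) - q * fromℚ σ)
      -qσ≈ = null-resp (null-*ˡ (bounded-const (ℚ.- 1ℚ)) qσ≈) λ k →
        solve 2 (λ x y → con (ℚ.- 1ℚ) :* (x :- y) := y :- x) refl (q k ℚ.* σ) (q k ℚ.* q k ℚ.+ 1ℚ)
      cases : σ ≤ + 2 ℚ./ 1 ⊎ + 3 ℚ./ 1 ≤ σ → ⊥
      cases (inj₁ σ≤2) = nonNeg-⊥ (0<* 0<γ 0<γ)
        (nonNeg-+ (null⇒nonNeg qσ≈) (nonNeg-+ (nonNeg-* 0≤q (nonNeg-const (≤⇒0≤- σ≤2)))
          (nonNeg-* q>1 (nonNeg-+ (nonNeg-+ q>1 0≤γ) 0≤γ))))
        λ k → solve 3 (λ q g σ → (q :* σ :- (q :* q :+ con 1ℚ)) :+ (q :* (con (+ 2 ℚ./ 1) :- σ)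
          :+ (q :- (con 1ℚ :+ g)) :* (((q :- (con 1ℚ :+ g)) :+ g) :+ g)) := :- (g :* g)) refl (q k) γ σ
      cases (inj₂ 3≤σ) = nonNeg-⊥ 0<1
        (nonNeg-+ (null⇒nonNeg -qσ≈) (nonNeg-+ (nonNeg-* 0≤q (nonNeg-const (≤⇒0≤- 3≤σ)))
          (nonNeg-* (nonNeg-+ q>1 0≤γ) q≤2)))
        λ k → solve 3 (λ q g σ → ((q :* q :+ con 1ℚ) :- q :* σ) :+ (q :* (σ :- con (+ 3 ℚ./ 1))
          :+ ((q :- (con 1ℚ :+ g)) :+ g) :* (con (+ 2 ℚ./ 1) :- q)) := :- con 1ℚ) refl (q k) γ σ

    -- Here a = -α and r = -p, and the two cases rest on the identities
    -- a ((r + 1)(q + 1)(1 - a) - 2 r) = 2 (1 - a - a²) + (3 - 4 a - a²)(r - 1) + (1 - a)(r - 1)²,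
    -- a (3 r - (r + 1)(q - 1)(1 + a)) = (2 a - r)(2 + a) + (r - 1) a (1 - a) + (1 + a)(r - 1)(2 a - r).
    no-negative-conjugate : ∀ (τ : ℚ) → (τ ≤ + 2 ℚ./ 1 ⊎ + 3 ℚ./ 1 ≤ τ) → NonNeg (λ k → ℚ.- α k) →
      NonNeg (fromℚ ⅝ + α) → NonNeg (([ 1 ] - fromℚ γ) - (α * α - α)) →
      NonNeg (p * p - [ 1 ]) →
      NonNeg ((p - [ 1 ]) * ((q + [ 1 ]) * (α + [ 1 ])) - p * fromℚ τ) →
      NonNeg (p * fromℚ τ + (p - [ 1 ]) * ((q - [ 1 ]) * (α - [ 1 ]))) → ⊥
    no-negative-conjugate τ τ-gap 0≤a a≤⅝ a²+a<1 p²≥1 upper lower = cases τ-gap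
      where
      a r : Seq
      a = λ k → ℚ.- α k
      r = q * a
      0≤r : NonNeg r
      0≤r = nonNeg-* 0≤q 0≤a
      1≤r : NonNeg (r - [ 1 ])
      1≤r = nonNeg-cancel {y = r + [ 1 ]} (bounded-+ (is-bounded 0≤r) (bounded-const (ℚ.- 1ℚ))) (ℚ.positive⁻¹ (½ ℚ.* 1ℚ)) (lower-bound {r} 1ℚ 0<1 0≤r)
        (nonNeg-resp p²≥1 λ k → solve 2 (λ q α → (q :* α) :* (q :* α) :- con 1ℚ
          := (q :* (:- α) :- con 1ℚ) :* (q :* (:- α) :+ con 1ℚ)) refl (q k) (α k))
      cases : τ ≤ + 2 ℚ./ 1 ⊎ + 3 ℚ./ 1 ≤ τ → ⊥
      cases (inj₁ τ≤2) = nonNeg-⊥ (0<* (ℚ.positive⁻¹ (+ 2 ℚ./ 1)) 0<γ)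
        (nonNeg-+ (nonNeg-* 0≤a (nonNeg-+ upper (nonNeg-* 0≤r (nonNeg-const (≤⇒0≤- τ≤2)))))
          (nonNeg-+ (nonNeg-* (nat 2) a²+a<1)
            (nonNeg-+
              (nonNeg-* (nonNeg-+ (nonNeg-+ a²+a<1 0≤γ)
                  (nonNeg-+ (nonNeg-const (ℚ.nonNegative⁻¹ (+ 1 ℚ./ 8))) (nonNeg-* (nat 3) a≤⅝))) 1≤r)
              (nonNeg-* (nonNeg-+ (nonNeg-const (ℚ.nonNegative⁻¹ (+ 3 ℚ./ 8))) a≤⅝) (nonNeg-square (is-bounded 1≤r))))))
        λ k → solve 4 (λ q α g τ → let p = q :* α
                                       r = q :* (:- α)
                                       gap = (con 1ℚ :- g) :- (α :* α :- α) in
          (:- α) :* (((p :- con 1ℚ) :* ((q :+ con 1ℚ) :* (α :+ con 1ℚ)) :- p :* τ) :+ r :* (con (+ 2 ℚ./ 1) :- τ))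
          :+ (con (+ 2 ℚ./ 1) :* gap
          :+ ((((gap :+ g) :+ (con (+ 1 ℚ./ 8) :+ con (+ 3 ℚ./ 1) :* (con ⅝ :+ α))) :* (r :- con 1ℚ))
          :+ (con (+ 3 ℚ./ 8) :+ (con ⅝ :+ α)) :* ((r :- con 1ℚ) :* (r :- con 1ℚ))))
          := :- (con (+ 2 ℚ./ 1) :* g)) refl (q k) (α k) γ τ
      cases (inj₂ 3≤τ) = nonNeg-⊥ (0<* (ℚ.positive⁻¹ (+ 5 ℚ./ 4)) 0<γ)
        (nonNeg-+ (nonNeg-* 0≤a (nonNeg-+ lower (nonNeg-* 0≤r (nonNeg-const (≤⇒0≤- 3≤τ)))))
          (nonNeg-+ (nonNeg-+
              (nonNeg-* (nonNeg-* 0≤a (nonNeg-+ (nat 2) 0≤a)) q<2)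
              (nonNeg-* 0≤γ (nonNeg-* ½≤a (nonNeg-+ 0≤a (nonNeg-const (ℚ.nonNegative⁻¹ (+ 5 ℚ./ 2)))))))
            (nonNeg-+
              (nonNeg-* (nonNeg-* 1≤r 0≤a) (nonNeg-+ (nonNeg-const (ℚ.nonNegative⁻¹ (+ 3 ℚ./ 8))) a≤⅝))
              (nonNeg-* (nonNeg-* (nonNeg-+ (nat 1) 0≤a) 1≤r) (nonNeg-* 0≤a q≤2)))))
        λ k → solve 4 (λ q α g τ → let p = q :* α
                                       r = q :* (:- α)
                                       2q = con (+ 2 ℚ./ 1) in
          (:- α) :* ((p :* τ :+ (p :- con 1ℚ) :* ((q :- con 1ℚ) :* (α :- con 1ℚ))) :+ r :* (τ :- con (+ 3 ℚ./ 1)))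
          :+ (((((:- α) :* (2q :+ (:- α))) :* ((2q :- g) :- q))
              :+ g :* (((con ½ :* (r :- con 1ℚ)) :+ con ½ :* ((:- α) :* (2q :- q))) :* ((:- α) :+ con (+ 5 ℚ./ 2))))
          :+ ((((r :- con 1ℚ) :* (:- α)) :* (con (+ 3 ℚ./ 8) :+ (con ⅝ :+ α)))
          :+ (((con 1ℚ :+ (:- α)) :* (r :- con 1ℚ)) :* ((:- α) :* (2q :- q)))))
          := :- (con (+ 5 ℚ./ 4) :* g)) refl (q k) (α k) γ τ
        where
        -- The sequence equals a - 1/2, so q a ≥ 1 and q ≤ 2 force a ≥ 1/2. Then 2 a - r ≥ γ a
        -- supplies the margin γ a (2 + a) ≥ 5γ/4, as a (2 + a) - 5/4 = (a - 1/2)(a + 5/2).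
        ½≤a : NonNeg (fromℚ ½ * (r - [ 1 ]) + fromℚ ½ * (a * ([ 2 ] - q)))
        ½≤a = nonNeg-+ (nonNeg-* (nonNeg-const (ℚ.nonNegative⁻¹ ½)) 1≤r)
          (nonNeg-* (nonNeg-const (ℚ.nonNegative⁻¹ ½)) (nonNeg-* 0≤a q≤2))

-- Coefficients of a product of linear factors, and Schwarz-Pick.

module RootProducts where

  open import Data.Rational.Base using (_≤_; _<_)
  open RationalOrder
  open Gaussian
  open ApproximateRoot
  open ApproximateFactorization

  open ℚ.+-*-Solver using (solve; con; _:+_; _:*_; _:-_; :-_; _:=_)
  private module G = 𝔾-Solver

  -- The coefficients of x⁰, x¹ and xⁿ⁻¹; the leading coefficient 1 of xⁿ is not stored.
  constant linear subleading : ∀ {n} → Vec 𝔾 n → 𝔾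
  constant []            = 1𝔾
  constant (a ∷ f)       = a
  linear []              = 0𝔾
  linear (a ∷ f)         = constant f
  subleading []          = 0𝔾
  subleading (a ∷ [])    = a
  subleading (a ∷ b ∷ f) = subleading (b ∷ f)

  constant-times-linear : ∀ {n} w (g : Vec 𝔾 n) → constant (times-linear w g) ≡ - (w * constant g)
  constant-times-linear w []      = G.solve 1 (λ w → G.:- w G.:= G.:- (w G.:* G.con 1𝔾)) refl w
  constant-times-linear w (b ∷ g) = refl

  private
    constant-+₀ : ∀ {n} r (f : Vec 𝔾 (suc n)) → constant (r +₀ f) ≡ r + constant f
    constant-+₀ r (a ∷ f) = refl

  linear-times-linear : ∀ {n} w (g : Vec 𝔾 n) → linear (times-linear w g) ≡ constant g - w * linear g
  linear-times-linear w []      = G.solve 1 (λ w → G.con 1𝔾 G.:= G.con 1𝔾 G.:- w G.:* G.con 0𝔾) refl w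
  linear-times-linear w (b ∷ g) = trans (constant-+₀ b (times-linear w g))
    (cong (b +_) (constant-times-linear w g))

  subleading-times-linear : ∀ {n} w (g : Vec 𝔾 n) → subleading (times-linear w g) ≡ subleading g - w
  subleading-times-linear w []          = sym (+-identityˡ (- w))
  subleading-times-linear w (b ∷ [])    = refl
  subleading-times-linear w (b ∷ c ∷ g) = trans (skip b c (times-linear w g)) (subleading-times-linear w (c ∷ g))
    where
    skip : ∀ {n} b c (h : Vec 𝔾 (suc n)) →
      subleading (- (w * b) ∷ (b +₀ (- (w * c) ∷ (c +₀ h)))) ≡ subleading (- (w * c) ∷ (c +₀ h))
    skip b c (d ∷ h) = refl

  constant-close : ∀ {n} (f g : Vec 𝔾 n) → ‖ constant f - constant g ‖ ≤ dist f g
  constant-close []      []      = ℚ.≤-reflexive (‖z-z‖≡0 1𝔾)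
  constant-close (a ∷ f) (b ∷ g) = ≤-from (0≤dist f g)
    (solve 2 (λ x d → (x :+ d) :- x := d) refl (‖ a - b ‖) (dist f g))

  private
    drop-head : ∀ {n} {x} a b (f g : Vec 𝔾 n) → x ≤ dist f g → x ≤ dist (a ∷ f) (b ∷ g)
    drop-head {x = x} a b f g x≤ = ℚ.≤-trans x≤ (≤-from 0≤‖ a - b ‖
      (solve 2 (λ y d → (y :+ d) :- d := y) refl (‖ a - b ‖) (dist f g)))

  linear-close : ∀ {n} (f g : Vec 𝔾 n) → ‖ linear f - linear g ‖ ≤ dist f g
  linear-close []      []      = ℚ.≤-reflexive (‖z-z‖≡0 0𝔾)
  linear-close (a ∷ f) (b ∷ g) = drop-head a b f g (constant-close f g)

  subleading-close : ∀ {n} (f g : Vec 𝔾 n) → ‖ subleading f - subleading g ‖ ≤ dist f g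
  subleading-close []      []      = ℚ.≤-reflexive (‖z-z‖≡0 0𝔾)
  subleading-close (a ∷ [])    (b ∷ [])    = ℚ.≤-reflexive (sym (ℚ.+-identityʳ (‖ a - b ‖)))
  subleading-close (a ∷ c ∷ f) (b ∷ d ∷ g) = drop-head a b (c ∷ f) (d ∷ g) (subleading-close (c ∷ f) (d ∷ g))

  private
    conj-minus : ∀ z w → (z - w) ̄ ≡ z ̄ - w ̄
    conj-minus (a ⊹ b) (c ⊹ d) = cong ((a ℚ.+ ℚ.- c) ⊹_) (ℚ.neg-distrib-+ b (ℚ.- d))

    *-conj : ∀ w → w * w ̄ ≡ real (N w)
    *-conj (a ⊹ b) = cong₂ _⊹_
      (solve 2 (λ a b → a :* a :- b :* (:- b) := a :* a :+ b :* b) refl a b)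
      (solve 2 (λ a b → a :* (:- b) :+ b :* a := con 0ℚ) refl a b)

    -- This is Re (w z c̄), the mixed term in |c t - w z|² for real t.
    cross : 𝔾 → 𝔾 → 𝔾 → ℚ
    cross (x ⊹ y) (a ⊹ b) (e ⊹ f) = (x ℚ.* a ℚ.+ y ℚ.* b) ℚ.* e ℚ.+ (x ℚ.* b ℚ.- y ℚ.* a) ℚ.* f

    N-combination : ∀ t w c z → N (c * real t - w * z) ≡
      t ℚ.* t ℚ.* N c ℚ.+ N w ℚ.* N z ℚ.- (t ℚ.+ t) ℚ.* cross w c z
    N-combination t (x ⊹ y) (a ⊹ b) (e ⊹ f) = solve 7 (λ t x y a b e f →
      let r = (a :* t :- b :* con 0ℚ) :- (x :* e :- y :* f)
          i = (a :* con 0ℚ :+ b :* t) :- (x :* f :+ y :* e)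
      in r :* r :+ i :* i := t :* t :* (a :* a :+ b :* b) :+ (x :* x :+ y :* y) :* (e :* e :+ f :* f)
           :- (t :+ t) :* ((x :* a :+ y :* b) :* e :+ (x :* b :- y :* a) :* f)) refl t x y a b e f

    -- The expression is |s w̄ c + z|².
    cross-square : ∀ s w c z → 0ℚ ≤ s ℚ.* s ℚ.* (N w ℚ.* N c) ℚ.+ (s ℚ.+ s) ℚ.* cross w c z ℚ.+ N z
    cross-square s (x ⊹ y) (a ⊹ b) (e ⊹ f) = subst (0ℚ ≤_)
      (solve 7 (λ s x y a b e f →
        let u = s :* (x :* a :+ y :* b) :+ e
            v = s :* (x :* b :- y :* a) :+ f
        in u :* u :+ v :* v := s :* s :* ((x :* x :+ y :* y) :* (a :* a :+ b :* b))
             :+ (s :+ s) :* ((x :* a :+ y :* b) :* e :+ (x :* b :- y :* a) :* f) :+ (e :* e :+ f :* f))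
        refl s x y a b e f)
      (0≤+ (0≤x² (s ℚ.* (x ℚ.* a ℚ.+ y ℚ.* b) ℚ.+ e)) (0≤x² (s ℚ.* (x ℚ.* b ℚ.- y ℚ.* a) ℚ.+ f)))

    cross-zero : ∀ w c z → z ≡ 0𝔾 → cross w c z ≡ 0ℚ
    cross-zero (x ⊹ y) (a ⊹ b) _ refl = solve 4 (λ x y a b →
      (x :* a :+ y :* b) :* con 0ℚ :+ (x :* b :- y :* a) :* con 0ℚ := con 0ℚ) refl x y a b

    N≤0⇒≡0 : ∀ z → N z ≤ 0ℚ → z ≡ 0𝔾
    N≤0⇒≡0 z N≤0 = ‖z‖≡0⇒z≡0 z (square-cancel-≤ ℚ.≤-refl (ℚ.≤-trans (‖‖²≤2N z)
      (*-mono {2ℚ} {2ℚ} {N z} {0ℚ} (ℚ.nonNegative⁻¹ 2ℚ) (0≤N z) ℚ.≤-refl N≤0)))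

    -- Expanding with t = 1 - |w|² and s = 1 - |c|² reduces the claim to s (1 + |w|² |c|²) + 2 Re (w
    -- z c̄) ≥ 0. For s > 0 this is `cross-square` together with |z|² ≤ s², divided by s; for s = 0
    -- the hypothesis forces z = 0.
    schur-step : ∀ w c z → N w ≤ 1ℚ → N c ≤ 1ℚ → N z ≤ (1ℚ ℚ.- N c) ℚ.* (1ℚ ℚ.- N c) →
      N (c * real (1ℚ ℚ.- N w) - w * z) ≤ (1ℚ ℚ.- N w ℚ.* N c) ℚ.* (1ℚ ℚ.- N w ℚ.* N c)
    schur-step w c z w≤1 c≤1 z≤ = subst (_≤ _) (sym (N-combination t w c z))
      (≤-from (0≤+ (0≤* (0≤N w) (≤⇒0≤- z≤)) (0≤* (≤⇒0≤- w≤1) crossed))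
        (solve 4 (λ W C Z X → let t = con 1ℚ :- W in
          (con 1ℚ :- W :* C) :* (con 1ℚ :- W :* C) :- (t :* t :* C :+ W :* Z :- (t :+ t) :* X)
          := W :* ((con 1ℚ :- C) :* (con 1ℚ :- C) :- Z) :+ t :* ((con 1ℚ :- C) :* (con 1ℚ :+ W :* C) :+ (X :+ X)))
          refl (N w) (N c) (N z) (cross w c z)))
      where
      t s : ℚ
      t = 1ℚ ℚ.- N w
      s = 1ℚ ℚ.- N c
      crossed : 0ℚ ≤ s ℚ.* (1ℚ ℚ.+ N w ℚ.* N c) ℚ.+ (cross w c z ℚ.+ cross w c z)
      crossed = decide (0ℚ ℚ.<? s)
        where
        decide : Dec (0ℚ < s) → 0ℚ ≤ s ℚ.* (1ℚ ℚ.+ N w ℚ.* N c) ℚ.+ (cross w c z ℚ.+ cross w c z)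
        decide (yes 0<s) = ≤-cancelˡ 0<s (≤-from (0≤+ (cross-square s w c z) (≤⇒0≤- z≤))
          (solve 5 (λ s W C Z X → s :* (s :* (con 1ℚ :+ W :* C) :+ (X :+ X)) :- s :* con 0ℚ
            := (s :* s :* (W :* C) :+ (s :+ s) :* X :+ Z) :+ (s :* s :- Z)) refl s (N w) (N c) (N z) (cross w c z)))
        decide (no s≤0) = 0≤+ (0≤* (≤⇒0≤- c≤1) (0≤+ 0≤1 (0≤* (0≤N w) (0≤N c))))
          (ℚ.≤-reflexive (sym (cong₂ ℚ._+_ X≡0 X≡0)))
          where
          s≡0 : s ≡ 0ℚ
          s≡0 = ℚ.≤-antisym (ℚ.≮⇒≥ s≤0) (≤⇒0≤- c≤1)
          X≡0 = cross-zero w c z (N≤0⇒≡0 z (subst (λ s → N z ≤ s ℚ.* s) s≡0 z≤))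

  -- The value at 0 and the derivative at 0 of the Blaschke product with zeros ws
  -- satisfy the Schwarz–Pick inequality |h′(0)| ≤ 1 - |h(0)|².
  schwarz-pick : ∀ {n} {ws : Vec 𝔾 n} → All (λ w → N w ≤ 1ℚ) ws → let g = from-roots ws in
    N (constant g) ≤ 1ℚ ×
    N (linear g - constant g * subleading g ̄) ≤ (1ℚ ℚ.- N (constant g)) ℚ.* (1ℚ ℚ.- N (constant g))
  schwarz-pick []       = ℚ.≤-refl , ℚ.≤-refl
  schwarz-pick {ws = w ∷ ws} (w≤1 ∷ ws≤1) = from (schwarz-pick ws≤1)
    where
    g = from-roots ws
    C E S : 𝔾
    C = constant g
    E = linear g
    S = subleading g
    NC≡ : N (constant (times-linear w g)) ≡ N w ℚ.* N C
    NC≡ = trans (cong N (constant-times-linear w g)) (trans (N-neg (w * C)) (N-* w C))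
    -- For h = g / g* with g*(x) = Π (1 - v̄ x) over the zeros v of g, h′(0) is `linear g` minus
    -- `constant g` times the conjugate of `subleading g`, since that conjugate is (g*)′(0). The
    -- equation is the product rule for h (x - w)/(1 - w̄ x) at 0.
    shape : linear (times-linear w g) - constant (times-linear w g) * subleading (times-linear w g) ̄
      ≡ C * real (1ℚ ℚ.- N w) - w * (E - C * S ̄)
    shape = begin
      linear (times-linear w g) - constant (times-linear w g) * subleading (times-linear w g) ̄
        ≡⟨ cong₂ (λ c s → linear (times-linear w g) - c * s ̄) (constant-times-linear w g) (subleading-times-linear w g) ⟩
      linear (times-linear w g) - - (w * C) * (S - w) ̄
        ≡⟨ cong₂ (λ e s → e - - (w * C) * s) (linear-times-linear w g) (conj-minus S w) ⟩
      (C - w * E) - - (w * C) * (S ̄ - w ̄)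
        ≡⟨ G.solve 5 (λ C E S w v → (C G.:- w G.:* E) G.:- (G.:- (w G.:* C)) G.:* (S G.:- v)
             G.:= C G.:* (G.con 1𝔾 G.:- w G.:* v) G.:- w G.:* (E G.:- C G.:* S)) refl C E (S ̄) w (w ̄) ⟩
      C * (1𝔾 - w * w ̄) - w * (E - C * S ̄)
        ≡⟨ cong (λ v → C * (1𝔾 - v) - w * (E - C * S ̄)) (*-conj w) ⟩
      C * real (1ℚ ℚ.- N w) - w * (E - C * S ̄) ∎
      where open ≡-Reasoning
    from : N C ≤ 1ℚ × N (E - C * S ̄) ≤ (1ℚ ℚ.- N C) ℚ.* (1ℚ ℚ.- N C) →
      N (constant (times-linear w g)) ≤ 1ℚ ×
      N (linear (times-linear w g) - constant (times-linear w g) * subleading (times-linear w g) ̄) ℚ.≤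
        (1ℚ ℚ.- N (constant (times-linear w g))) ℚ.* (1ℚ ℚ.- N (constant (times-linear w g)))
    from (C≤1 , A≤) =
      subst (_≤ 1ℚ) (sym NC≡) (*-mono {N w} {1ℚ} {N C} {1ℚ} 0≤1 (0≤N C) w≤1 C≤1) ,
      subst₂ ℚ._≤_ (cong N (sym shape)) (cong (λ c → (1ℚ ℚ.- c) ℚ.* (1ℚ ℚ.- c)) (sym NC≡))
        (schur-step w C (E - C * S ̄) w≤1 C≤1 A≤)

  N-constant-∷ : ∀ {n} w {ws : Vec 𝔾 n} → All (λ w → N w ≤ 1ℚ) ws →
    N (constant (from-roots (w ∷ ws))) ≤ N w
  N-constant-∷ w {ws} ws≤1 = subst₂ ℚ._≤_ (sym NC≡) (ℚ.*-identityʳ (N w))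
    (*-mono {N w} {N w} {N C} {1ℚ} (0≤N w) (0≤N C) ℚ.≤-refl (proj₁ (schwarz-pick ws≤1)))
    where
    C : 𝔾
    C = constant (from-roots ws)
    NC≡ : N (constant (from-roots (w ∷ ws))) ≡ N w ℚ.* N C
    NC≡ = trans (cong N (trans (constant-times-linear w (from-roots ws))
      (G.solve 2 (λ w c → G.:- (w G.:* c) G.:= (G.:- w) G.:* c) refl w C)))
      (trans (N-* (- w) C) (cong (ℚ._* N C) (N-neg w)))

  schwarz-pick-re : ∀ {n} {ws : Vec 𝔾 n} → All (λ w → N w ≤ 1ℚ) ws → let g = from-roots ws in
    re (linear g - constant g * subleading g ̄) ≤ 1ℚ ℚ.- N (constant g) ×
    ℚ.- re (linear g - constant g * subleading g ̄) ≤ 1ℚ ℚ.- N (constant g)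
  schwarz-pick-re {ws = ws} ws≤1 = from (schwarz-pick ws≤1)
    where
    C A : 𝔾
    C = constant (from-roots ws)
    A = linear (from-roots ws) - C * subleading (from-roots ws) ̄
    from : N C ≤ 1ℚ × N A ≤ (1ℚ ℚ.- N C) ℚ.* (1ℚ ℚ.- N C) →
      re A ≤ 1ℚ ℚ.- N C × ℚ.- re A ≤ 1ℚ ℚ.- N C
    from (C≤1 , A≤) = square-cancel-≤ (≤⇒0≤- C≤1) (ℚ.≤-trans (re²≤N A) A≤)
      , square-cancel-≤ (≤⇒0≤- C≤1) (ℚ.≤-trans (ℚ.≤-reflexive
          (solve 1 (λ a → (:- a) :* (:- a) := a :* a) refl (re A))) (ℚ.≤-trans (re²≤N A) A≤))

-- Gauss's lemma for integer polynomials.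

module GaussLemma where

  open import Data.Integer.Base using (+_)
  open import Data.Integer.Divisibility.Signed
    using (_∣_; divides; ∣ᵤ⇒∣; ∣⇒∣ᵤ; ∣m+n∣m⇒∣n; ∣m⇒∣m*n; *-monoʳ-∣)
  open import Data.List.Relation.Unary.All using ([]; _∷_) renaming (All to AllList)

  -- Shared by ℤ and ℚ, so that products over the two rings can be compared coefficient by
  -- coefficient once denominators are cleared.
  module Coefficients {A : Set} (_+_ _*_ : A → A → A) (0# : A) where

    coeff : List A → ℕ → A
    coeff []      i       = 0#
    coeff (a ∷ f) zero    = a
    coeff (a ∷ f) (suc i) = coeff f i

    shift : (ℕ → A) → ℕ → A
    shift g zero    = 0#
    shift g (suc i) = g i

    -- Coefficients of the product of the polynomial f with the power series g.
    infixl 7 _⋆_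
    _⋆_ : List A → (ℕ → A) → ℕ → A
    []      ⋆ g = λ i → 0#
    (a ∷ f) ⋆ g = λ i → (a * g i) + shift (f ⋆ g) i

  open Coefficients ℤ._+_ ℤ._*_ 0ℤ

  open ℤ.+-*-Solver using (solve; _:+_; _:*_; _:=_; con)

  private
    ⋆-scaleʳ : ∀ f {g h} c → (∀ i → g i ≡ c ℤ.* h i) → ∀ i → (f ⋆ g) i ≡ c ℤ.* (f ⋆ h) i
    shift-⋆-scaleʳ : ∀ f {g h} c → (∀ i → g i ≡ c ℤ.* h i) → ∀ i → shift (f ⋆ g) i ≡ c ℤ.* shift (f ⋆ h) i
    ⋆-scaleʳ []      c eq i = sym (ℤ.*-zeroʳ c)
    ⋆-scaleʳ (a ∷ f) {g} {h} c eq i = trans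
      (cong₂ (λ x y → a ℤ.* x ℤ.+ y) (eq i) (shift-⋆-scaleʳ f c eq i))
      (solve 4 (λ a c x y → a :* (c :* x) :+ c :* y := c :* (a :* x :+ y)) refl a c (h i) (shift (f ⋆ h) i))
    shift-⋆-scaleʳ f c eq zero    = sym (ℤ.*-zeroʳ c)
    shift-⋆-scaleʳ f c eq (suc i) = ⋆-scaleʳ f c eq i

    ⋆-scaleˡ : ∀ f g c i → (List.map (c ℤ.*_) f ⋆ g) i ≡ c ℤ.* (f ⋆ g) i
    shift-⋆-scaleˡ : ∀ f g c i → shift (List.map (c ℤ.*_) f ⋆ g) i ≡ c ℤ.* shift (f ⋆ g) i
    ⋆-scaleˡ []      g c i = sym (ℤ.*-zeroʳ c)
    ⋆-scaleˡ (a ∷ f) g c i = trans (cong (λ t → (c ℤ.* a) ℤ.* g i ℤ.+ t) (shift-⋆-scaleˡ f g c i))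
      (solve 4 (λ a c x y → (c :* a) :* x :+ c :* y := c :* (a :* x :+ y)) refl a c (g i) (shift (f ⋆ g) i))
    shift-⋆-scaleˡ f g c zero    = sym (ℤ.*-zeroʳ c)
    shift-⋆-scaleˡ f g c (suc i) = ⋆-scaleˡ f g c i

    coeff-scale : ∀ c f i → coeff (List.map (c ℤ.*_) f) i ≡ c ℤ.* coeff f i
    coeff-scale c []      i       = sym (ℤ.*-zeroʳ c)
    coeff-scale c (a ∷ f) zero    = refl
    coeff-scale c (a ∷ f) (suc i) = coeff-scale c f i

    ⋆-∷ʳ : ∀ f b g i → (f ⋆ coeff (b ∷ g)) i ≡ b ℤ.* coeff f i ℤ.+ shift (f ⋆ coeff g) i
    ⋆-∷ʳ []      b g zero    = solve 1 (λ b → con 0ℤ := b :* con 0ℤ :+ con 0ℤ) refl b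
    ⋆-∷ʳ []      b g (suc i) = solve 1 (λ b → con 0ℤ := b :* con 0ℤ :+ con 0ℤ) refl b
    ⋆-∷ʳ (a ∷ f) b g zero    = cong (ℤ._+ 0ℤ) (ℤ.*-comm a b)
    ⋆-∷ʳ (a ∷ f) b g (suc i) = trans (cong (λ t → a ℤ.* coeff g i ℤ.+ t) (⋆-∷ʳ f b g i))
      (solve 4 (λ u b x y → u :+ (b :* x :+ y) := b :* x :+ (u :+ y)) refl (a ℤ.* coeff g i) b (coeff f i) (shift (f ⋆ coeff g) i))

    prime-∣* : ∀ {ℓ} → Prime ℓ → ∀ a b → + ℓ ∣ a ℤ.* b → + ℓ ∣ a ⊎ + ℓ ∣ b
    prime-∣* {ℓ} pr a b ℓ∣ab
      with euclidsLemma ℤ.∣ a ∣ ℤ.∣ b ∣ pr (subst (ℓ ℕ.∣_) (ℤ.abs-* a b) (∣⇒∣ᵤ ℓ∣ab))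
    ... | inj₁ ℓ∣a = inj₁ (∣ᵤ⇒∣ ℓ∣a)
    ... | inj₂ ℓ∣b = inj₂ (∣ᵤ⇒∣ ℓ∣b)

  ⋆-comm : ∀ f g i → (f ⋆ coeff g) i ≡ (g ⋆ coeff f) i
  ⋆-comm f []      i = ⋆-[] f i
    where
    ⋆-[] : ∀ f i → (f ⋆ (λ _ → 0ℤ)) i ≡ 0ℤ
    ⋆-[] []      i       = refl
    ⋆-[] (a ∷ f) zero    = trans (ℤ.+-identityʳ (a ℤ.* 0ℤ)) (ℤ.*-zeroʳ a)
    ⋆-[] (a ∷ f) (suc i) = trans (cong₂ ℤ._+_ (ℤ.*-zeroʳ a) (⋆-[] f i)) refl
  ⋆-comm f (b ∷ g) i = trans (⋆-∷ʳ f b g i) (cong (λ t → b ℤ.* coeff f i ℤ.+ t) (shifted i))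
    where
    shifted : ∀ i → shift (f ⋆ coeff g) i ≡ shift (g ⋆ coeff f) i
    shifted zero    = refl
    shifted (suc i) = ⋆-comm f g i

  -- Constant coefficients are removed one at a time: ℓ divides a b, hence a or b. If it divides a,
  -- then a g contributes multiples of ℓ only, so ℓ still divides the product of the tail of f with
  -- g; symmetrically for b.
  gauss : ∀ {ℓ} → Prime ℓ → ∀ f g → (∀ i → + ℓ ∣ (f ⋆ coeff g) i) → AllList (+ ℓ ∣_) f ⊎ AllList (+ ℓ ∣_) g
  gauss pr []      g = λ div → inj₁ []
  gauss {ℓ} pr (a ∷ f) = against
    where
    against : ∀ g → (∀ i → + ℓ ∣ ((a ∷ f) ⋆ coeff g) i) → AllList (+ ℓ ∣_) (a ∷ f) ⊎ AllList (+ ℓ ∣_) g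
    against []      div = inj₂ []
    against (b ∷ g) div = split (prime-∣* pr a b (subst (+ ℓ ∣_) (ℤ.+-identityʳ (a ℤ.* b)) (div 0)))
      where
      Result : Set
      Result = AllList (+ ℓ ∣_) (a ∷ f) ⊎ AllList (+ ℓ ∣_) (b ∷ g)
      consˡ : + ℓ ∣ a → AllList (+ ℓ ∣_) f ⊎ AllList (+ ℓ ∣_) (b ∷ g) → Result
      consˡ ℓ∣a (inj₁ ℓ∣f)  = inj₁ (ℓ∣a ∷ ℓ∣f)
      consˡ ℓ∣a (inj₂ ℓ∣bg) = inj₂ ℓ∣bg
      consʳ : + ℓ ∣ b → AllList (+ ℓ ∣_) (a ∷ f) ⊎ AllList (+ ℓ ∣_) g → Result
      consʳ ℓ∣b (inj₁ ℓ∣af) = inj₁ ℓ∣af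
      consʳ ℓ∣b (inj₂ ℓ∣g)  = inj₂ (ℓ∣b ∷ ℓ∣g)
      split : + ℓ ∣ a ⊎ + ℓ ∣ b → Result
      split (inj₁ ℓ∣a) = consˡ ℓ∣a (gauss pr f (b ∷ g) λ i → ∣m+n∣m⇒∣n (div (suc i)) (∣m⇒∣m*n (coeff g i) ℓ∣a))
      split (inj₂ ℓ∣b) = consʳ ℓ∣b (against g λ i →
        ∣m+n∣m⇒∣n (subst (+ ℓ ∣_) (⋆-∷ʳ (a ∷ f) b g (suc i)) (div (suc i))) (∣m⇒∣m*n (coeff f i) ℓ∣b))

  private
    divide-all : ∀ c {f} → AllList (c ∣_) f → ∃ λ g → f ≡ List.map (c ℤ.*_) g
    divide-all c []       = [] , refl
    divide-all c (divides q eq ∷ c∣f) = let g , f≡ = divide-all c c∣f in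
      q ∷ g , cong₂ _∷_ (trans eq (ℤ.*-comm q c)) f≡

    cancel : ∀ ℓ → .{{ℕ.NonZero ℓ}} → ∀ {x y} → + ℓ ℤ.* x ≡ + ℓ ℤ.* y → x ≡ y
    cancel (suc ℓ) {x} {y} = ℤ.*-cancelˡ-≡ (+ suc ℓ) x y

    smaller-multiple : ∀ {ℓ x} → Prime ℓ → 1 ℕ.≤ x → x ℕ.< ℓ ℕ.* x
    smaller-multiple {ℓ} {suc x} pr _ = subst (suc x ℕ.<_) (ℕ.*-comm (suc x) ℓ)
      (ℕ.m<m*n (suc x) ℓ (ℕ.nonTrivial⇒n>1 ℓ {{prime⇒nonTrivial pr}}))

    positive-factorʳ : ∀ m n → 1 ℕ.≤ m ℕ.* n → 1 ℕ.≤ n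
    positive-factorʳ m zero    p = subst (1 ℕ.≤_) (ℕ.*-zeroʳ m) p
    positive-factorʳ m (suc n) p = s≤s z≤n

  -- Descent on d e, dividing f or g by one prime factor of d at a time.
  leading-divides : ∀ k {d e} f g (h : ℕ → ℤ) n m → d ℕ.* e ℕ.< k → 1 ℕ.≤ d → 1 ℕ.≤ e →
    coeff f n ≡ + d → coeff g m ≡ + e → (∀ i → (f ⋆ coeff g) i ≡ + (d ℕ.* e) ℤ.* h i) →
    ∀ i → + d ∣ coeff f i
  leading-divides zero    f g h n m () _ _ _ _ _
  leading-divides (suc k) {d} {e} f g h n m (s≤s de≤k) 1≤d 1≤e fₙ≡d gₘ≡e fg≡ =
    split (PrimeFactorisation.factors F) (PrimeFactorisation.isFactorisation F) (PrimeFactorisation.factorsPrime F)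
    where
    F : PrimeFactorisation d
    F = factorise d {{ℕ.>-nonZero 1≤d}}
    Result : Set
    Result = ∀ i → + d ∣ coeff f i
    split : ∀ ps → d ≡ ℕ.product ps → AllList Prime ps → Result
    split []       d≡1 _ i = subst (λ d → + d ∣ coeff f i) (sym d≡1) (divides (coeff f i) (sym (ℤ.*-identityʳ (coeff f i))))
    split (ℓ ∷ ps) d≡ℓd′ (pr ∷ _) = conclude (gauss pr f g ℓ∣fg)
      where
      d′ : ℕ
      d′ = ℕ.product ps
      instance
        ℓ≢0 = prime⇒nonZero pr
      1≤d′ : 1 ℕ.≤ d′
      1≤d′ = positive-factorʳ ℓ d′ (subst (1 ℕ.≤_) d≡ℓd′ 1≤d)
      ℓ∣d : + ℓ ∣ + d
      ℓ∣d = divides (+ d′) (trans (cong +_ (trans d≡ℓd′ (ℕ.*-comm ℓ d′))) (ℤ.pos-* d′ ℓ))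
      ℓ∣fg : ∀ i → + ℓ ∣ (f ⋆ coeff g) i
      ℓ∣fg i = subst (+ ℓ ∣_) (sym (trans (fg≡ i) (cong (ℤ._* h i) (ℤ.pos-* d e))))
        (∣m⇒∣m*n (h i) (∣m⇒∣m*n (+ e) ℓ∣d))

      conclude : AllList (+ ℓ ∣_) f ⊎ AllList (+ ℓ ∣_) g → Result
      conclude (inj₁ ℓ∣f) = from (divide-all (+ ℓ) ℓ∣f)
        where
        from : (∃ λ f′ → f ≡ List.map (+ ℓ ℤ.*_) f′) → Result
        from (f′ , f≡) i = subst₂ _∣_
          (trans (sym (ℤ.pos-* ℓ d′)) (cong +_ (sym d≡ℓd′)))
          (trans (sym (coeff-scale (+ ℓ) f′ i)) (cong (λ f → coeff f i) (sym f≡)))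
          (*-monoʳ-∣ (+ ℓ) (leading-divides k f′ g h n m smaller 1≤d′ 1≤e
            (cancel ℓ (trans (sym (coeff-scale (+ ℓ) f′ n)) (trans (cong (λ f → coeff f n) (sym f≡))
              (trans fₙ≡d (trans (cong +_ d≡ℓd′) (ℤ.pos-* ℓ d′))))))
            gₘ≡e
            (λ j → cancel ℓ (trans (sym (⋆-scaleˡ f′ (coeff g) (+ ℓ) j))
              (trans (cong (λ f → (f ⋆ coeff g) j) (sym f≡)) (trans (fg≡ j)
                (trans (cong (ℤ._* h j) (trans (cong (λ d → + (d ℕ.* e)) d≡ℓd′)
                  (trans (cong +_ (ℕ.*-assoc ℓ d′ e)) (ℤ.pos-* ℓ (d′ ℕ.* e))))) (ℤ.*-assoc (+ ℓ) (+ (d′ ℕ.* e)) (h j)))))))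
            i))
          where
          smaller : d′ ℕ.* e ℕ.< k
          smaller = ℕ.<-≤-trans (smaller-multiple pr (ℕ.*-mono-≤ 1≤d′ 1≤e))
            (subst (ℕ._≤ k) (trans (cong (ℕ._* e) d≡ℓd′) (ℕ.*-assoc ℓ d′ e)) de≤k)
      conclude (inj₂ ℓ∣g) = from (divide-all (+ ℓ) ℓ∣g) ℓ∣e
        where
        ℓ∣all : ∀ {g} → AllList (+ ℓ ∣_) g → ∀ i → + ℓ ∣ coeff g i
        ℓ∣all []           i       = divides 0ℤ refl
        ℓ∣all (ℓ∣b ∷ _)    zero    = ℓ∣b
        ℓ∣all (_   ∷ ℓ∣g)  (suc i) = ℓ∣all ℓ∣g i
        ℓ∣e : ℓ ℕ.∣ e
        ℓ∣e = ∣⇒∣ᵤ (subst (+ ℓ ∣_) gₘ≡e (ℓ∣all ℓ∣g m))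
        from : (∃ λ g′ → g ≡ List.map (+ ℓ ℤ.*_) g′) → ℓ ℕ.∣ e → Result
        from (g′ , g≡) (ℕ.divides e′ e≡e′ℓ) = leading-divides k f g′ h n m smaller 1≤d 1≤e′ fₙ≡d
          (cancel ℓ (trans (sym (coeff-scale (+ ℓ) g′ m)) (trans (cong (λ g → coeff g m) (sym g≡))
            (trans gₘ≡e (trans (cong +_ e≡ℓe′) (ℤ.pos-* ℓ e′))))))
          (λ j → cancel ℓ (trans (sym (⋆-scaleʳ f (+ ℓ) (coeff-g≡) j)) (trans (fg≡ j)
            (trans (cong (ℤ._* h j) (trans (cong +_ de≡ℓde′) (ℤ.pos-* ℓ (d ℕ.* e′)))) (ℤ.*-assoc (+ ℓ) (+ (d ℕ.* e′)) (h j))))))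
          where
          coeff-g≡ : ∀ i → coeff g i ≡ + ℓ ℤ.* coeff g′ i
          coeff-g≡ i = trans (cong (λ g → coeff g i) g≡) (coeff-scale (+ ℓ) g′ i)
          e≡ℓe′ : e ≡ ℓ ℕ.* e′
          e≡ℓe′ = trans e≡e′ℓ (ℕ.*-comm e′ ℓ)
          1≤e′ : 1 ℕ.≤ e′
          1≤e′ = positive-factorʳ ℓ e′ (subst (1 ℕ.≤_) e≡ℓe′ 1≤e)
          de≡ℓde′ : d ℕ.* e ≡ ℓ ℕ.* (d ℕ.* e′)
          de≡ℓde′ = trans (cong (d ℕ.*_) e≡ℓe′) (trans (sym (ℕ.*-assoc d ℓ e′))
            (trans (cong (ℕ._* e′) (ℕ.*-comm d ℓ)) (ℕ.*-assoc ℓ d e′)))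
          smaller : d ℕ.* e′ ℕ.< k
          smaller = ℕ.<-≤-trans (smaller-multiple pr (ℕ.*-mono-≤ 1≤d 1≤e′)) (subst (ℕ._≤ k) de≡ℓde′ de≤k)

-- Monic rational factors of monic integer polynomials are integral.

module Integrality where

  open import Data.Rational.Base using (_≤_; _<_; ∣_∣)
  open import Data.Integer.Base using (+_)
  open import Data.Integer.Divisibility.Signed using (_∣_; divides)
  open RationalOrder
  open Gaussian
  open ApproximateRoot using (⟦_⟧)
  open GaussLemma

  open ℚ.+-*-Solver using (solve; con; _:+_; _:*_; _:-_; :-_; _:=_)
  private
    module G = 𝔾-Solver
    module ℤᶜ = Coefficients ℤ._+_ ℤ._*_ 0ℤ
  open Coefficients ℚ._+_ ℚ._*_ 0ℚ

  ι : ℤ → ℚ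
  ι i = i ℚ./ 1

  private
    toℚᵘ-ι : ∀ i → toℚᵘ (ι i) ℚᵘ.≃ ℚᵘ.mkℚᵘ i 0
    toℚᵘ-ι i = ℚ.toℚᵘ-fromℚᵘ (ℚᵘ.mkℚᵘ i 0)

  ι-+ : ∀ i j → ι (i ℤ.+ j) ≡ ι i ℚ.+ ι j
  ι-+ i j = ℚ.toℚᵘ-injective (ℚᵘ.≃-trans (toℚᵘ-ι (i ℤ.+ j)) (ℚᵘ.≃-trans
    (ℚᵘ.*≡* (cong (ℤ._* + 1) (sym (cong₂ ℤ._+_ (ℤ.*-identityʳ i) (ℤ.*-identityʳ j)))))
    (ℚᵘ.≃-sym (ℚᵘ.≃-trans (ℚ.toℚᵘ-homo-+ (ι i) (ι j)) (ℚᵘ.+-cong (toℚᵘ-ι i) (toℚᵘ-ι j))))))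

  ι-* : ∀ i j → ι (i ℤ.* j) ≡ ι i ℚ.* ι j
  ι-* i j = ℚ.toℚᵘ-injective (ℚᵘ.≃-trans (toℚᵘ-ι (i ℤ.* j))
    (ℚᵘ.≃-sym (ℚᵘ.≃-trans (ℚ.toℚᵘ-homo-* (ι i) (ι j)) (ℚᵘ.*-cong (toℚᵘ-ι i) (toℚᵘ-ι j)))))

  ι-neg : ∀ i → ι (ℤ.- i) ≡ ℚ.- ι i
  ι-neg i = ℚ.toℚᵘ-injective (ℚᵘ.≃-trans (toℚᵘ-ι (ℤ.- i))
    (ℚᵘ.≃-sym (ℚᵘ.≃-trans (ℚ.toℚᵘ-homo‿- (ι i)) (ℚᵘ.-‿cong (toℚᵘ-ι i)))))

  ι-injective : ∀ {i j} → ι i ≡ ι j → i ≡ j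
  ι-injective {i} {j} eq = trans (sym (ℤ.*-identityʳ i)) (trans
    (ℚᵘ.drop-*≡* (ℚᵘ.≃-trans (ℚᵘ.≃-sym (toℚᵘ-ι i)) (ℚᵘ.≃-trans (ℚᵘ.≃-reflexive (cong toℚᵘ eq)) (toℚᵘ-ι j))))
    (ℤ.*-identityʳ j))

  ι-mono-≤ : ∀ {i j} → i ℤ.≤ j → ι i ≤ ι j
  ι-mono-≤ {i} {j} i≤j = ℚ.toℚᵘ-cancel-≤ (ℚᵘ.≤-respˡ-≃ (ℚᵘ.≃-sym (toℚᵘ-ι i))
    (ℚᵘ.≤-respʳ-≃ (ℚᵘ.≃-sym (toℚᵘ-ι j)) (ℚᵘ.*≤* (ℤ.*-monoʳ-≤-nonNeg (+ 1) i≤j))))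

  ι-positive : ∀ {d} → 1 ℕ.≤ d → 0ℚ < ι (+ d)
  ι-positive 1≤d = ℚ.<-≤-trans 0<1 (ι-mono-≤ (ℤ.+≤+ 1≤d))

  monic : ∀ {A : Set} → A → ∀ {n} → Vec A n → List A
  monic 1# []      = 1# ∷ []
  monic 1# (a ∷ p) = a ∷ monic 1# p

  private
    p̂ : ∀ {n} → Vec ℚ n → ℕ → ℚ
    p̂ p = coeff (monic 1ℚ p)

  real-* : ∀ a b → real (a ℚ.* b) ≡ real a * real b
  real-* a b = cong₂ _⊹_
    (solve 2 (λ a b → a :* b := a :* b :- con 0ℚ :* con 0ℚ) refl a b)
    (solve 2 (λ a b → con 0ℚ := a :* con 0ℚ :+ con 0ℚ :* b) refl a b)

  -- Unlike in `⟦_⟧`, no leading 1 is implied; remainders of divisions have this form.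
  ⟪_⟫ : ∀ {n} → Vec ℚ n → 𝔾 → 𝔾
  ⟪ [] ⟫    z = 0𝔾
  ⟪ a ∷ v ⟫ z = real a + z * ⟪ v ⟫ z

  private
    top : ∀ {n} → Vec ℚ (suc n) → ℚ
    top (v ∷ [])      = v
    top (_ ∷ v@(_ ∷ _)) = top v

    -- For c the top coefficient of v this is v - c p, whose top coefficient cancels because p is
    -- monic and is therefore dropped.
    reduce : ∀ {n} → ℚ → Vec ℚ (suc n) → Vec ℚ n → Vec ℚ n
    reduce c (v ∷ [])          []      = []
    reduce c (v ∷ vs@(_ ∷ _)) (b ∷ p) = (v ℚ.- c ℚ.* b) ∷ reduce c vs p

    coeff-reduce : ∀ {n} (v : Vec ℚ (suc n)) (p : Vec ℚ n) i →
      coeff (toList v) i ≡ top v ℚ.* p̂ p i ℚ.+ coeff (toList (reduce (top v) v p)) i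
    coeff-reduce (v ∷ []) [] zero = solve 1 (λ v → v := v :* con 1ℚ :+ con 0ℚ) refl v
    coeff-reduce (v ∷ []) [] (suc i) = solve 1 (λ v → con 0ℚ := v :* con 0ℚ :+ con 0ℚ) refl v
    coeff-reduce (v ∷ vs@(_ ∷ _)) (b ∷ p) zero =
      solve 3 (λ v c b → v := c :* b :+ (v :- c :* b)) refl v (top vs) b
    coeff-reduce (v ∷ vs@(_ ∷ _)) (b ∷ p) (suc i) = coeff-reduce vs p i

    ⟪reduce⟫ : ∀ {n} (v : Vec ℚ (suc n)) (p : Vec ℚ n) z →
      ⟪ v ⟫ z ≡ real (top v) * ⟦ map real p ⟧ z + ⟪ reduce (top v) v p ⟫ z
    ⟪reduce⟫ (v ∷ []) [] z = G.solve 2 (λ v z → v G.:+ z G.:* G.con 0𝔾 G.:= v G.:* G.con 1𝔾 G.:+ G.con 0𝔾) refl (real v) z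
    ⟪reduce⟫ (v ∷ vs@(_ ∷ _)) (b ∷ p) z = trans (cong (λ t → real v + z * t) (⟪reduce⟫ vs p z))
      (trans (G.solve 6 (λ v c b z P R → v G.:+ z G.:* (c G.:* P G.:+ R)
        G.:= c G.:* (b G.:+ z G.:* P) G.:+ ((v G.:- c G.:* b) G.:+ z G.:* R))
        refl (real v) (real (top vs)) (real b) z (⟦ map real p ⟧ z) (⟪ reduce (top vs) vs p ⟫ z))
        (cong (λ t → real (top vs) * (real b + z * ⟦ map real p ⟧ z) + ((real v - t) + z * ⟪ reduce (top vs) vs p ⟫ z))
          (sym (real-* (top vs) b))))

    minus : ∀ {n} → Vec ℚ n → Vec ℚ n → Vec ℚ n
    minus = Vec.zipWith ℚ._-_

    coeff-minus : ∀ {n} (f p : Vec ℚ n) i → p̂ f i ≡ p̂ p i ℚ.+ coeff (toList (minus f p)) i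
    coeff-minus []      []      zero    = refl
    coeff-minus []      []      (suc i) = refl
    coeff-minus (a ∷ f) (b ∷ p) zero    = solve 2 (λ a b → a := b :+ (a :- b)) refl a b
    coeff-minus (a ∷ f) (b ∷ p) (suc i) = coeff-minus f p i

    ⟪minus⟫ : ∀ {n} (f p : Vec ℚ n) z → ⟦ map real f ⟧ z ≡ ⟦ map real p ⟧ z + ⟪ minus f p ⟫ z
    ⟪minus⟫ []      []      z = refl
    ⟪minus⟫ (a ∷ f) (b ∷ p) z = trans (cong (λ t → real a + z * t) (⟪minus⟫ f p z))
      (G.solve 5 (λ a b z P R → a G.:+ z G.:* (P G.:+ R) G.:= (b G.:+ z G.:* P) G.:+ ((a G.:- b) G.:+ z G.:* R))
        refl (real a) (real b) z (⟦ map real p ⟧ z) (⟪ minus f p ⟫ z))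

  -- The identity f = quot p + rem is kept in two forms: by coefficients for Gauss's lemma, by
  -- values for showing that the remainder vanishes at a common root of f and p.
  record Division {m n} (f : Vec ℚ (m ℕ.+ n)) (p : Vec ℚ n) : Set where
    field
      quot  : Vec ℚ m
      rem   : Vec ℚ n
      coeffs : ∀ i → p̂ f i ≡ (monic 1ℚ quot ⋆ p̂ p) i ℚ.+ coeff (toList rem) i
      values : ∀ z → ⟦ map real f ⟧ z ≡ ⟦ map real quot ⟧ z * ⟦ map real p ⟧ z + ⟪ rem ⟫ z

  -- Recursion from the low end: f = quot p + rem gives a + x f = (x quot) p + (a + x rem), and
  -- subtracting one multiple of p reduces a + x rem.
  division : ∀ m {n} (f : Vec ℚ (m ℕ.+ n)) (p : Vec ℚ n) → Division {m} f p
  division zero f p = record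
    { quot = []
    ; rem = minus f p
    ; coeffs = λ i → trans (coeff-minus f p i) (cong (ℚ._+ coeff (toList (minus f p)) i) (unit i))
    ; values = λ z → trans (⟪minus⟫ f p z) (cong (_+ ⟪ minus f p ⟫ z) (sym (*-identityˡ (⟦ map real p ⟧ z))))
    }
    where
    unit : ∀ i → p̂ p i ≡ 1ℚ ℚ.* p̂ p i ℚ.+ shift (λ _ → 0ℚ) i
    unit zero    = solve 1 (λ x → x := con 1ℚ :* x :+ con 0ℚ) refl (p̂ p zero)
    unit (suc i) = solve 1 (λ x → x := con 1ℚ :* x :+ con 0ℚ) refl (p̂ p (suc i))
  division (suc m) (a ∷ f) p = record
    { quot = top (a ∷ rem) ∷ quot
    ; rem = reduce (top (a ∷ rem)) (a ∷ rem) p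
    ; coeffs = λ i → trans (split i) (trans (cong (shift (monic 1ℚ quot ⋆ p̂ p) i ℚ.+_) (coeff-reduce (a ∷ rem) p i))
        (solve 3 (λ x y w → x :+ (y :+ w) := (y :+ x) :+ w) refl
          (shift (monic 1ℚ quot ⋆ p̂ p) i) (top (a ∷ rem) ℚ.* p̂ p i) (coeff (toList (reduce (top (a ∷ rem)) (a ∷ rem) p)) i)))
    ; values = λ z → trans (cong (λ t → real a + z * t) (values z))
        (trans (G.solve 5 (λ a z Q P R → a G.:+ z G.:* (Q G.:* P G.:+ R) G.:= z G.:* (Q G.:* P) G.:+ (a G.:+ z G.:* R))
            refl (real a) z (⟦ map real quot ⟧ z) (⟦ map real p ⟧ z) (⟪ rem ⟫ z))
          (trans (cong (λ t → z * (⟦ map real quot ⟧ z * ⟦ map real p ⟧ z) + t) (⟪reduce⟫ (a ∷ rem) p z))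
            (G.solve 5 (λ z Q P c R → z G.:* (Q G.:* P) G.:+ (c G.:* P G.:+ R) G.:= (c G.:+ z G.:* Q) G.:* P G.:+ R)
              refl z (⟦ map real quot ⟧ z) (⟦ map real p ⟧ z) (real (top (a ∷ rem)))
              (⟪ reduce (top (a ∷ rem)) (a ∷ rem) p ⟫ z))))
    }
    where
    open Division (division m f p)
    split : ∀ i → coeff (a ∷ monic 1ℚ f) i ≡ shift (monic 1ℚ quot ⋆ p̂ p) i ℚ.+ coeff (a ∷ toList rem) i
    split zero    = sym (ℚ.+-identityˡ a)
    split (suc i) = coeffs i

  -- Minimality speaks of monic polynomials, so a nonzero remainder is written as its leading
  -- coefficient times a monic polynomial of lower degree.
  normalize-leading : ∀ {n} (v : Vec ℚ n) → (∀ i → coeff (toList v) i ≡ 0ℚ) ⊎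
    (∃ λ m → m ℕ.< n × ∃ λ (w : Vec ℚ m) → ∃ λ c → c ≢ 0ℚ × (∀ z → ⟪ v ⟫ z ≡ real c * ⟦ map real w ⟧ z))
  normalize-leading [] = inj₁ λ _ → refl
  normalize-leading (a ∷ v) with normalize-leading v
  ... | inj₂ (m , m<n , w , c , c≢0 , v≡cw) = inj₂ (suc m , s≤s m<n , (c⁻¹ ℚ.* a) ∷ w , c , c≢0 , λ z →
      trans (cong (λ t → real a + z * t) (v≡cw z)) (trans
        (cong (λ t → t + z * (real c * ⟦ map real w ⟧ z)) (trans (cong real a≡) (real-* c (c⁻¹ ℚ.* a))))
        (G.solve 4 (λ c b z w → c G.:* b G.:+ z G.:* (c G.:* w) G.:= c G.:* (b G.:+ z G.:* w))
          refl (real c) (real (c⁻¹ ℚ.* a)) z (⟦ map real w ⟧ z))))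
    where
    instance
      c≄0 = ℚ.≢-nonZero c≢0
    c⁻¹ : ℚ
    c⁻¹ = ℚ.1/ c
    a≡ : a ≡ c ℚ.* (c⁻¹ ℚ.* a)
    a≡ = sym (trans (sym (ℚ.*-assoc c c⁻¹ a)) (trans (cong (ℚ._* a) (ℚ.*-inverseʳ c)) (ℚ.*-identityˡ a)))
  ... | inj₁ v≡0 with a ℚ.≟ 0ℚ
  ...   | yes a≡0 = inj₁ λ { zero → a≡0 ; (suc i) → v≡0 i }
  ...   | no  a≢0 = inj₂ (0 , s≤s z≤n , [] , a , a≢0 , λ z → trans
      (cong (λ t → real a + z * t) (value-zero v v≡0 z))
      (G.solve 2 (λ a z → a G.:+ z G.:* G.con 0𝔾 G.:= a G.:* G.con 1𝔾) refl (real a) z))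
    where
    value-zero : ∀ {n} (v : Vec ℚ n) → (∀ i → coeff (toList v) i ≡ 0ℚ) → ∀ z → ⟪ v ⟫ z ≡ 0𝔾
    value-zero []      v≡0 z = refl
    value-zero (b ∷ v) v≡0 z = trans (cong₂ (λ s t → real s + z * t) (v≡0 0) (value-zero v (λ i → v≡0 (suc i)) z))
      (G.solve 1 (λ z → G.con 0𝔾 G.:+ z G.:* G.con 0𝔾 G.:= G.con 0𝔾) refl z)

  clear-denominators : ∀ (f : List ℚ) → ∃ λ d → 1 ℕ.≤ d × ∃ λ A → List.map ι A ≡ List.map (ι (+ d) ℚ.*_) f
  clear-denominators [] = 1 , ℕ.≤-refl , [] , refl
  clear-denominators (a@(mkℚ u d-1 _) ∷ f) with clear-denominators f
  ... | d , 1≤d , A , A≡ = suc d-1 ℕ.* d , ℕ.*-mono-≤ (s≤s (z≤n {d-1})) 1≤d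
    , (u ℤ.* + d) ∷ List.map (+ suc d-1 ℤ.*_) A
    , cong₂ _∷_
        (trans (ι-* u (+ d)) (trans (cong (ℚ._* ι (+ d)) (sym clear)) (trans
          (solve 3 (λ k a d → (k :* a) :* d := (k :* d) :* a) refl (ι (+ suc d-1)) a (ι (+ d)))
          (cong (ℚ._* a) (sym ι-product)))))
        (scale A f A≡)
    where
    ι-product : ι (+ (suc d-1 ℕ.* d)) ≡ ι (+ suc d-1) ℚ.* ι (+ d)
    ι-product = trans (cong ι (ℤ.pos-* (suc d-1) d)) (ι-* (+ suc d-1) (+ d))
    clear : ι (+ suc d-1) ℚ.* a ≡ ι u
    clear = ℚ.toℚᵘ-injective (ℚᵘ.≃-trans (ℚ.toℚᵘ-homo-* (ι (+ suc d-1)) a)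
      (ℚᵘ.≃-trans (ℚᵘ.*-cong (toℚᵘ-ι (+ suc d-1)) ℚᵘ.≃-refl) (ℚᵘ.≃-trans
        (ℚᵘ.*≡* (trans (ℤ.*-identityʳ (+ suc d-1 ℤ.* u)) (trans (ℤ.*-comm (+ suc d-1) u)
          (cong (λ e → u ℤ.* + suc e) (sym (ℕ.+-identityʳ d-1))))))
        (ℚᵘ.≃-sym (toℚᵘ-ι u)))))
    scale : ∀ A f → List.map ι A ≡ List.map (ι (+ d) ℚ.*_) f →
      List.map ι (List.map (+ suc d-1 ℤ.*_) A) ≡ List.map (ι (+ (suc d-1 ℕ.* d)) ℚ.*_) f
    scale []      []      _  = refl
    scale (x ∷ A) (b ∷ f) eq = let x≡ , A≡ = List.∷-injective eq in cong₂ _∷_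
      (trans (ι-* (+ suc d-1) x) (trans (cong (ι (+ suc d-1) ℚ.*_) x≡) (trans
        (sym (ℚ.*-assoc (ι (+ suc d-1)) (ι (+ d)) b)) (cong (ℚ._* b) (sym ι-product)))))
      (scale A f A≡)

  private
    coeff-cleared : ∀ {d} A f → List.map ι A ≡ List.map (d ℚ.*_) f → ∀ i → ι (ℤᶜ.coeff A i) ≡ d ℚ.* coeff f i
    coeff-cleared {d} []      []      _  i       = sym (ℚ.*-zeroʳ d)
    coeff-cleared     (x ∷ A) (b ∷ f) eq zero    = proj₁ (List.∷-injective eq)
    coeff-cleared {d} (x ∷ A) (b ∷ f) eq (suc i) = coeff-cleared {d} A f (proj₂ (List.∷-injective eq)) i

    product-cleared : ∀ {d e} B g (a : ℕ → ℤ) b → List.map ι B ≡ List.map (e ℚ.*_) g → (∀ i → ι (a i) ≡ d ℚ.* b i) →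
      ∀ i → ι ((B ℤᶜ.⋆ a) i) ≡ d ℚ.* e ℚ.* (g ⋆ b) i
    product-cleared {d} {e} [] [] a b _ _ i = sym (ℚ.*-zeroʳ (d ℚ.* e))
    product-cleared {d} {e} (x ∷ B) (y ∷ g) a b B≡ a≡ i = begin
      ι (x ℤ.* a i ℤ.+ ℤᶜ.shift (B ℤᶜ.⋆ a) i)
        ≡⟨ trans (ι-+ (x ℤ.* a i) (ℤᶜ.shift (B ℤᶜ.⋆ a) i)) (cong (ℚ._+ ι (ℤᶜ.shift (B ℤᶜ.⋆ a) i)) (ι-* x (a i))) ⟩
      ι x ℚ.* ι (a i) ℚ.+ ι (ℤᶜ.shift (B ℤᶜ.⋆ a) i)
        ≡⟨ cong₂ ℚ._+_ (cong₂ ℚ._*_ (proj₁ (List.∷-injective B≡)) (a≡ i)) (shifted i) ⟩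
      e ℚ.* y ℚ.* (d ℚ.* b i) ℚ.+ d ℚ.* e ℚ.* shift (g ⋆ b) i
        ≡⟨ solve 5 (λ d e y u v → e :* y :* (d :* u) :+ d :* e :* v
             := d :* e :* (y :* u :+ v)) refl d e y (b i) (shift (g ⋆ b) i) ⟩
      d ℚ.* e ℚ.* (y ℚ.* b i ℚ.+ shift (g ⋆ b) i) ∎
      where
      open ≡-Reasoning
      shifted : ∀ i → ι (ℤᶜ.shift (B ℤᶜ.⋆ a) i) ≡ d ℚ.* e ℚ.* shift (g ⋆ b) i
      shifted zero    = sym (ℚ.*-zeroʳ (d ℚ.* e))
      shifted (suc i) = product-cleared {d} {e} B g a b (proj₂ (List.∷-injective B≡)) a≡ i

    coeff-monic-ι : ∀ {n} (f : Vec ℤ n) i → p̂ (map ι f) i ≡ ι (ℤᶜ.coeff (monic (+ 1) f) i)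
    coeff-monic-ι []      zero    = refl
    coeff-monic-ι []      (suc i) = refl
    coeff-monic-ι (a ∷ f) zero    = refl
    coeff-monic-ι (a ∷ f) (suc i) = coeff-monic-ι f i

    leading : ∀ {n} (p : Vec ℚ n) → p̂ p n ≡ 1ℚ
    leading []      = refl
    leading (a ∷ p) = leading p

    from-integral-coeffs : ∀ {n} (p : Vec ℚ n) → (∀ i → ∃ λ x → ι x ≡ p̂ p i) → ∃ λ P → map ι P ≡ p
    from-integral-coeffs []      int = [] , refl
    from-integral-coeffs (a ∷ p) int =
      let x , x≡a = int 0
          P , P≡p = from-integral-coeffs p (λ i → int (suc i))
      in x ∷ P , cong₂ _∷_ x≡a P≡p

  -- Clearing denominators gives integral A = d p and B = e g whose leading coefficients are d and
  -- e, because p and g are monic. From A B = d e f, `leading-divides` shows that d divides A, and p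
  -- = A / d.
  integral-factor : ∀ {m n} (f : Vec ℤ (m ℕ.+ n)) (g : Vec ℚ m) (p : Vec ℚ n) →
    (∀ i → p̂ (map ι f) i ≡ (monic 1ℚ g ⋆ p̂ p) i) → ∃ λ P → map ι P ≡ p
  integral-factor {m} {n} f g p f≡gp = from (clear-denominators (monic 1ℚ p)) (clear-denominators (monic 1ℚ g))
    where
    Cleared : List ℚ → Set
    Cleared f = ∃ λ d → 1 ℕ.≤ d × ∃ λ A → List.map ι A ≡ List.map (ι (+ d) ℚ.*_) f
    h : ℕ → ℤ
    h = ℤᶜ.coeff (monic (+ 1) f)
    from : Cleared (monic 1ℚ p) → Cleared (monic 1ℚ g) → ∃ λ P → map ι P ≡ p
    from (d , 1≤d , A , A≡) (e , 1≤e , B , B≡) = from-integral-coeffs p λ i → divided i (d∣A i)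
      where
      A-coeff : ∀ i → ι (ℤᶜ.coeff A i) ≡ ι (+ d) ℚ.* p̂ p i
      A-coeff = coeff-cleared {ι (+ d)} A (monic 1ℚ p) A≡
      lead : ∀ {d n} A (p : Vec ℚ n) → (∀ i → ι (ℤᶜ.coeff A i) ≡ ι (+ d) ℚ.* p̂ p i) → ℤᶜ.coeff A n ≡ + d
      lead {d} {n} A p A-coeff = ι-injective (trans (A-coeff n) (trans (cong (ι (+ d) ℚ.*_) (leading p)) (ℚ.*-identityʳ (ι (+ d)))))
      product≡ : ∀ i → (A ℤᶜ.⋆ ℤᶜ.coeff B) i ≡ + (d ℕ.* e) ℤ.* h i
      product≡ i = trans (⋆-comm A B i) (ι-injective (begin
        ι ((B ℤᶜ.⋆ ℤᶜ.coeff A) i)                     ≡⟨ product-cleared {ι (+ d)} {ι (+ e)} B (monic 1ℚ g) (ℤᶜ.coeff A) (p̂ p) B≡ A-coeff i ⟩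
        ι (+ d) ℚ.* ι (+ e) ℚ.* (monic 1ℚ g ⋆ p̂ p) i  ≡⟨ cong (ι (+ d) ℚ.* ι (+ e) ℚ.*_) (trans (sym (f≡gp i)) (coeff-monic-ι f i)) ⟩
        ι (+ d) ℚ.* ι (+ e) ℚ.* ι (h i)               ≡⟨ cong (ℚ._* ι (h i)) (trans (sym (ι-* (+ d) (+ e))) (cong ι (sym (ℤ.pos-* d e)))) ⟩
        ι (+ (d ℕ.* e)) ℚ.* ι (h i)                   ≡⟨ sym (ι-* (+ (d ℕ.* e)) (h i)) ⟩
        ι (+ (d ℕ.* e) ℤ.* h i)                       ∎))
        where open ≡-Reasoning
      d∣A = leading-divides (suc (d ℕ.* e)) A B h n m ℕ.≤-refl 1≤d 1≤e
        (lead {d} A p A-coeff) (lead {e} B g (coeff-cleared {ι (+ e)} B (monic 1ℚ g) B≡)) product≡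
      divided : ∀ i → + d ∣ ℤᶜ.coeff A i → ∃ λ x → ι x ≡ p̂ p i
      divided i (divides x A≡xd) = x , ℚ.≤-antisym (≤-cancelˡ 0<d (ℚ.≤-reflexive eq)) (≤-cancelˡ 0<d (ℚ.≤-reflexive (sym eq)))
        where
        0<d = ι-positive 1≤d
        eq : ι (+ d) ℚ.* ι x ≡ ι (+ d) ℚ.* p̂ p i
        eq = trans (ℚ.*-comm (ι (+ d)) (ι x)) (trans (sym (ι-* x (+ d))) (trans (cong ι (sym A≡xd)) (A-coeff i)))

  exact-division : ∀ {m n} (f : Vec ℤ (m ℕ.+ n)) (p : Vec ℚ n) (D : Division {m} (map ι f) p) →
    (∀ i → coeff (toList (Division.rem D)) i ≡ 0ℚ) → ∃ λ P → map ι P ≡ p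
  exact-division f p D rem≡0 = integral-factor f quot p λ i → trans (coeffs i)
    (trans (cong (λ t → (monic 1ℚ quot ⋆ p̂ p) i ℚ.+ t) (rem≡0 i)) (ℚ.+-identityʳ ((monic 1ℚ quot ⋆ p̂ p) i)))
    where open Division D

-- Minimal polynomials and simple roots.

module Conjugates where

  open import Data.Rational.Base using (_≤_; _<_; ∣_∣)
  open import Data.Integer.Base using (+_)
  open RationalOrder
  open Gaussian
  open ApproximateRoot using (⟦_⟧)
  open ApproximateFactorization
  open ComplexRoots
  open Integrality
  open import Defs as D using (seq; ℂ; fromℝ; fromℚ; IsRoot; IsMinimalPolynomial; evalMonic)

  open ℚ.+-*-Solver using (solve; con; _:+_; _:*_; _:-_; :-_; _:=_)
  private module G = 𝔾-Solver

  record Small (u : ℕ → 𝔾) : Set where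
    constructor small
    field
      vanishes : Vanishes λ k → ‖ u k ‖

  record BoundedBelow (u : ℕ → 𝔾) : Set where
    constructor away
    field
      gap     : ℚ
      0<gap   : 0ℚ < gap
      gap≤    : Eventually λ k → gap ≤ ‖ u k ‖

  record BoundedAbove (u : ℕ → 𝔾) : Set where
    constructor within
    field
      size    : ℚ
      1≤size  : 1ℚ ≤ size
      ≤size   : Eventually λ k → ‖ u k ‖ ≤ size

  open Small public

  above-at : ∀ z → BoundedAbove (λ k → at k z)
  above-at z = let B , 1≤B , z≤B = at-bounded z in within B 1≤B z≤B

  above-resp : ∀ {u v} → BoundedAbove u → (∀ k → u k ≡ v k) → BoundedAbove v
  above-resp (within B 1≤B u≤B) eq = within B 1≤B (ev-map (λ k → subst (λ z → ‖ z ‖ ≤ B) (eq k)) u≤B)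

  small-resp : ∀ {u v} → Small u → (∀ k → u k ≡ v k) → Small v
  small-resp (small h) eq = small λ ε 0<ε → ev-map (λ k → subst (λ z → ‖ z ‖ < ε) (eq k)) (h ε 0<ε)

  small-+ : ∀ {u v} → Small u → Small v → Small (λ k → u k + v k)
  small-+ {u} {v} (small h) (small g) = small λ ε 0<ε → ev-zip
    (λ k a b → ℚ.≤-<-trans (‖+‖ (u k) (v k)) (sum< (‖ u k ‖) (‖ v k ‖) a b))
    (h (½ ℚ.* ε) (0<half 0<ε)) (g (½ ℚ.* ε) (0<half 0<ε))

  small-neg : ∀ {u} → Small u → Small (λ k → - u k)
  small-neg {u} (small h) = small λ ε 0<ε → ev-map (λ k → subst (_< ε) (sym (‖-‖ (u k)))) (h ε 0<ε)

  small-* : ∀ {u v} → BoundedAbove u → Small v → Small (λ k → u k * v k)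
  small-* {u} {v} (within B 1≤B u≤B) (small h) = small λ ε 0<ε → from ε (quotient 0<B 0<ε)
    where
    0<B = ℚ.<-≤-trans 0<1 1≤B
    from : ∀ ε → (∃ λ d → 0ℚ < d × B ℚ.* d ≡ ε) → Eventually λ k → ‖ u k * v k ‖ < ε
    from ε (d , 0<d , Bd≡ε) = ev-zip {λ k → ‖ u k ‖ ≤ B} {λ k → ‖ v k ‖ < d}
      (λ k a b → ℚ.≤-<-trans (‖*‖ (u k) (v k)) (subst (‖ u k ‖ ℚ.* ‖ v k ‖ <_) Bd≡ε
        (ℚ.≤-<-trans (ℚ.*-monoʳ-≤-nonNeg (‖ v k ‖) {{ℚ.nonNegative 0≤‖ v k ‖}} a)
          (ℚ.*-monoʳ-<-pos B {{ℚ.positive 0<B}} b))))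
      u≤B (h d 0<d)

  small-cancel : ∀ {u v} → BoundedBelow u → Small (λ k → u k * v k) → Small v
  small-cancel {u} {v} (away c 0<c c≤u) (small h) = small λ ε 0<ε →
    ev-zip {λ k → c ≤ ‖ u k ‖} {λ k → ‖ u k * v k ‖ < ½ ℚ.* (c ℚ.* ε)} (λ k a b →
      ℚ.*-cancelˡ-<-nonNeg c {{ℚ.nonNegative (ℚ.<⇒≤ 0<c)}} (ℚ.≤-<-trans
        (ℚ.≤-trans (ℚ.*-monoʳ-≤-nonNeg (‖ v k ‖) {{ℚ.nonNegative 0≤‖ v k ‖}} a) (‖‖‖‖≤2‖*‖ (u k) (v k)))
        (subst (2ℚ ℚ.* ‖ u k * v k ‖ <_) (solve 1 (λ x → con 2ℚ :* (con ½ :* x) := x) refl (c ℚ.* ε))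
          (ℚ.*-monoʳ-<-pos 2ℚ b))))
      c≤u (h (½ ℚ.* (c ℚ.* ε)) (0<half (0<* 0<c 0<ε)))

  ¬small-1 : ¬ Small (λ _ → 1𝔾)
  ¬small-1 (small h) = ℚ.<-irrefl refl (proj₂ (witness (h 1ℚ 0<1)))

  small-dist : ∀ {n} (f g : ℕ → Vec 𝔾 n) {π : Vec 𝔾 n → 𝔾} → (∀ f g → ‖ π f - π g ‖ ≤ dist f g) →
    Vanishes (λ k → dist (f k) (g k)) → Small (λ k → π (f k) - π (g k))
  small-dist f g close h = small λ ε 0<ε → ev-map (λ k → ℚ.≤-<-trans (close (f k) (g k))) (h ε 0<ε)

  -- Continuity obtained from algebra: f(z) - f(w) = (z - w) g(z), where g = `deflateᶜ f w` has
  -- bounded values at z.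
  eval-close : ∀ {n} (f : Vec ℂ n) z w → Small (λ k → at k z - at k w) →
    Small (λ k → at k (eval f z) - at k (eval f w))
  eval-close []        z w z≈w = small-resp z≈w′ λ k → refl
    where
    z≈w′ : Small (λ k → 1𝔾 - 1𝔾)
    z≈w′ = small λ ε 0<ε → always λ k → 0<ε
  eval-close f@(_ ∷ _) z w z≈w = small-resp
    (small-* (above-at (eval (deflateᶜ f w) z)) z≈w)
    λ k → trans (*-comm (at k (eval (deflateᶜ f w) z)) (at k z - at k w)) (sym (begin
      at k (eval f z) - at k (eval f w)
        ≡⟨ cong₂ _-_ (at-eval f z k) (at-eval f w k) ⟩
      ⟦ map (at k) f ⟧ (at k z) - ⟦ map (at k) f ⟧ (at k w)
        ≡⟨ cong (_- ⟦ map (at k) f ⟧ (at k w)) (⟦deflate⟧ (map (at k) f) (at k w) (at k z)) ⟩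
      (⟦ map (at k) f ⟧ (at k w) + (at k z - at k w) * ⟦ deflate (map (at k) f) (at k w) ⟧ (at k z)) - ⟦ map (at k) f ⟧ (at k w)
        ≡⟨ G.solve 2 (λ a b → (a G.:+ b) G.:- a G.:= b) refl (⟦ map (at k) f ⟧ (at k w))
             ((at k z - at k w) * ⟦ deflate (map (at k) f) (at k w) ⟧ (at k z)) ⟩
      (at k z - at k w) * ⟦ deflate (map (at k) f) (at k w) ⟧ (at k z)
        ≡⟨ cong ((at k z - at k w) *_) (trans (cong (λ g → ⟦ g ⟧ (at k z)) (sym (at-deflateᶜ f w k)))
             (sym (at-eval (deflateᶜ f w) z k))) ⟩
      (at k z - at k w) * at k (eval (deflateᶜ f w) z) ∎))
    where open ≡-Reasoning

  at-eval-deflate : ∀ {n} (f : Vec ℂ (suc n)) w z k →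
    at k (eval f z) ≡ at k (eval f w) + (at k z - at k w) * at k (eval (deflateᶜ f w) z)
  at-eval-deflate f w z k = trans (at-eval f z k) (trans (⟦deflate⟧ (map (at k) f) (at k w) (at k z))
    (cong₂ (λ a b → a + (at k z - at k w) * b) (sym (at-eval f w k))
      (trans (cong (λ g → ⟦ g ⟧ (at k z)) (sym (at-deflateᶜ f w k))) (sym (at-eval (deflateᶜ f w) z k)))))

  constants : ∀ {n} → Vec ℚ n → Vec ℂ n
  constants = map (λ a → fromℝ (fromℚ a))

  at-constants : ∀ {n} (p : Vec ℚ n) k → map (at k) (constants p) ≡ map real p
  at-constants []      k = refl
  at-constants (a ∷ p) k = cong (real a ∷_) (at-constants p k)

  Root : ∀ {n} → Vec ℚ n → ℂ → Set
  Root p z = Small λ k → ⟦ map real p ⟧ (at k z)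

  at-evalMonic : ∀ {n} (p : Vec ℚ n) z k → at k (evalMonic p z) ≡ ⟦ map real p ⟧ (at k z)
  at-evalMonic []      z k = refl
  at-evalMonic (a ∷ p) z k = cong (λ t → real a + at k z * t) (at-evalMonic p z k)

  at-eval-constants : ∀ {n} (p : Vec ℚ n) z k → at k (eval (constants p) z) ≡ ⟦ map real p ⟧ (at k z)
  at-eval-constants p z k = trans (at-eval (constants p) z k) (cong (λ f → ⟦ f ⟧ (at k z)) (at-constants p k))

  ≈⇒small : ∀ z w → z D.≈ᶜ w → Small λ k → at k z - at k w
  ≈⇒small z w (re≈ , im≈) = small λ ε 0<ε → ev-zip
    (λ k a b → sum< (∣ seq (D.re z) k ℚ.- seq (D.re w) k ∣) (∣ seq (D.im z) k ℚ.- seq (D.im w) k ∣) a b)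
    (re≈ (½ ℚ.* ε) (0<half 0<ε)) (im≈ (½ ℚ.* ε) (0<half 0<ε))

  isRoot⇒root : ∀ {n} (p : Vec ℚ n) z → IsRoot p z → Root p z
  isRoot⇒root p z root = small-resp (≈⇒small (evalMonic p z) D.0ℂ root) λ k →
    trans (G.solve 1 (λ x → x G.:- G.con 0𝔾 G.:= x) refl (at k (evalMonic p z))) (at-evalMonic p z k)

  root⇒isRoot : ∀ {n} (p : Vec ℚ n) z → Root p z → IsRoot p z
  root⇒isRoot p z root =
      (λ ε 0<ε → ev-map (λ k lt → ℚ.≤-<-trans (subst (λ t → ∣ t ∣ ≤ ‖ at k (evalMonic p z) ‖)
          (sym (minus-0 (seq (D.re (evalMonic p z)) k))) ∣re∣≤‖ at k (evalMonic p z) ‖) lt) (h ε 0<ε))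
    , (λ ε 0<ε → ev-map (λ k lt → ℚ.≤-<-trans (subst (λ t → ∣ t ∣ ≤ ‖ at k (evalMonic p z) ‖)
          (sym (minus-0 (seq (D.im (evalMonic p z)) k))) ∣im∣≤‖ at k (evalMonic p z) ‖) lt) (h ε 0<ε))
    where
    minus-0 : ∀ x → x ℚ.- 0ℚ ≡ x
    minus-0 = solve 1 (λ x → x :- con 0ℚ := x) refl
    h : Vanishes λ k → ‖ at k (evalMonic p z) ‖
    h = vanishes (small-resp root λ k → sym (at-evalMonic p z k))

  module Minimal {n} (p : Vec ℚ n) (z : ℂ) (minimal : IsMinimalPolynomial p z) where

    no-smaller : ∀ {m} → m ℕ.< n → (f : Vec ℚ m) → ¬ Root f z
    no-smaller m<n f root = proj₂ minimal m<n f (root⇒isRoot f z root)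

    z-root : Root p z
    z-root = isRoot⇒root p z (proj₁ minimal)

    private
      integral-at : ∀ m (f : Vec ℤ (m ℕ.+ n)) → IsRoot (map ι f) z → ∃ λ P → map ι P ≡ p
      integral-at m f root = decide (normalize-leading rem)
        where
        open Division (division m (map ι f) p)
        rem-small : Small λ k → ⟪ rem ⟫ (at k z)
        rem-small = small-resp (small-+ (isRoot⇒root (map ι f) z root)
            (small-neg (small-* (above-resp (above-at (eval (constants quot) z)) (at-eval-constants quot z)) z-root)))
          λ k → trans (cong (_+ - (⟦ map real quot ⟧ (at k z) * ⟦ map real p ⟧ (at k z))) (values (at k z)))
            (G.solve 2 (λ a r → (a G.:+ r) G.:+ G.:- a G.:= r) refl
              (⟦ map real quot ⟧ (at k z) * ⟦ map real p ⟧ (at k z)) (⟪ rem ⟫ (at k z)))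
        decide : _ → ∃ λ P → map ι P ≡ p
        decide (inj₁ rem≡0) = exact-division {m} f p (division m (map ι f) p) rem≡0
        decide (inj₂ (m , m<n , w , c , c≢0 , rem≡cw)) = contradiction
          (small-cancel {u = λ _ → real c}
            (away (∣ c ∣) (ℚ.≰⇒> λ ∣c∣≤0 → c≢0 (ℚ.∣p∣≡0⇒p≡0 c (ℚ.≤-antisym ∣c∣≤0 (ℚ.0≤∣p∣ c))))
              (always λ _ → ℚ.≤-reflexive (sym (‖real‖ c))))
            (small-resp rem-small λ k → rem≡cw (at k z)))
          (no-smaller m<n w)

    -- Dividing f by p leaves a remainder that vanishes at z; by minimality it is zero, so p is a
    -- monic factor of a monic integer polynomial.
    integral : ∀ {d} (f : Vec ℤ d) → IsRoot (map ι f) z → ∃ λ P → map ι P ≡ p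
    integral {d} f root with n ℕ.≤? d
    ... | no  n≰d = contradiction root (proj₂ minimal (ℕ.≰⇒> n≰d) (map ι f))
    ... | yes n≤d = from (d ℕ.∸ n) (ℕ.m∸n+n≡m n≤d) f root
      where
      from : ∀ m {d} → m ℕ.+ n ≡ d → (f : Vec ℤ d) → IsRoot (map ι f) z → ∃ λ P → map ι P ≡ p
      from m refl f root = integral-at m f root

  -- With a = 0 the value at z is z p(z); cancelling z, which is bounded away from 0, makes z a root
  -- of the shorter p.
  constant-nonzero : ∀ {n} {a} (p : Vec ℚ n) z → IsMinimalPolynomial (a ∷ p) z →
    BoundedBelow (λ k → at k z) → a ≢ 0ℚ
  constant-nonzero p z minimal z≢0 refl = no-smaller ℕ.≤-refl p (small-cancel z≢0
    (small-resp z-root λ k → +-identityˡ (at k z * ⟦ map real p ⟧ (at k z))))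
    where open Minimal (0ℚ ∷ p) z minimal

  private
    -- Σ (j + i) aᵢ zⁱ, including the leading term with aₙ = 1.
    weighted : ∀ {n} → ℚ → Vec ℚ n → 𝔾 → 𝔾
    weighted j []      z = real j
    weighted j (a ∷ p) z = real (j ℚ.* a) + z * weighted (j ℚ.+ 1ℚ) p z

    weighted-suc : ∀ {n} j (p : Vec ℚ n) z → weighted (j ℚ.+ 1ℚ) p z ≡ weighted j p z + ⟦ map real p ⟧ z
    weighted-suc j []      z = refl
    weighted-suc j (a ∷ p) z = trans (cong₂ (λ s t → s + z * t)
        (trans (cong real (solve 2 (λ j a → (j :+ con 1ℚ) :* a := j :* a :+ a) refl j a)) refl)
        (weighted-suc (j ℚ.+ 1ℚ) p z))
      (G.solve 5 (λ x a z s t → (x G.:+ a) G.:+ z G.:* (s G.:+ t) G.:= (x G.:+ z G.:* s) G.:+ (a G.:+ z G.:* t))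
        refl (real (j ℚ.* a)) (real a) z (weighted (j ℚ.+ 1ℚ) p z) (⟦ map real p ⟧ z))

    -- Both sides are f′(z) for f = a + x p: the deflated polynomial is the difference quotient of f
    -- at z, and Σ (i + 1) pᵢ zⁱ is the derivative.
    deflate-at-root : ∀ {n} a (p : Vec ℚ n) z → ⟦ deflate (map real (a ∷ p)) z ⟧ z ≡ weighted 1ℚ p z
    deflate-at-root a []      z = refl
    deflate-at-root a (b ∷ p) z = trans (cong (λ t → ⟦ map real (b ∷ p) ⟧ z + z * t) (deflate-at-root b p z))
      (trans (G.solve 4 (λ b z P W → (b G.:+ z G.:* P) G.:+ z G.:* W G.:= b G.:+ z G.:* (W G.:+ P))
          refl (real b) z (⟦ map real p ⟧ z) (weighted 1ℚ p z))
        (cong₂ (λ s t → s + z * t) (cong real (sym (ℚ.*-identityˡ b))) (sym (weighted-suc 1ℚ p z))))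

    -- This is j + n, the leading coefficient of `weighted`. For j = 1 it is the degree of the
    -- original polynomial, by which the derivative is divided to make it monic.
    final-weight : ℚ → ℕ → ℚ
    final-weight j zero    = j
    final-weight j (suc n) = final-weight (j ℚ.+ 1ℚ) n

    0<final-weight : ∀ {j} n → 0ℚ < j → 0ℚ < final-weight j n
    0<final-weight zero    0<j = 0<j
    0<final-weight (suc n) 0<j = 0<final-weight n (0<+ 0<j 0≤1)

    scaled : ∀ {n} → ℚ → ℚ → Vec ℚ n → Vec ℚ n
    scaled c j []      = []
    scaled c j (a ∷ p) = (c ℚ.* (j ℚ.* a)) ∷ scaled c (j ℚ.+ 1ℚ) p

    ⟦scaled⟧ : ∀ {n} c j (p : Vec ℚ n) z → c ℚ.* final-weight j n ≡ 1ℚ →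
      ⟦ map real (scaled c j p) ⟧ z ≡ real c * weighted j p z
    ⟦scaled⟧ c j []      z cj≡1 = trans (cong real (sym cj≡1)) (real-* c j)
    ⟦scaled⟧ c j (a ∷ p) z cj≡1 = trans (cong₂ (λ s t → s + z * t) (real-* c (j ℚ.* a)) (⟦scaled⟧ c (j ℚ.+ 1ℚ) p z cj≡1))
      (G.solve 4 (λ c a z w → c G.:* a G.:+ z G.:* (c G.:* w) G.:= c G.:* (a G.:+ z G.:* w))
        refl (real c) (real (j ℚ.* a)) z (weighted (j ℚ.+ 1ℚ) p z))

  -- The value of the deflated polynomial at z is p′(z), and p′ has smaller degree.
  simple-root : ∀ {n} (p : Vec ℚ (suc n)) z → IsMinimalPolynomial p z →
    ¬ Small (λ k → at k (eval (deflateᶜ (constants p) z) z))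
  simple-root {n} (a ∷ p) z minimal p′z→0 = from (reciprocal (0<final-weight n 0<1))
    where
    open Minimal (a ∷ p) z minimal
    from : (∃ λ c → 0ℚ < c × final-weight 1ℚ n ℚ.* c ≡ 1ℚ) → ⊥
    from (c , 0<c , wc≡1) = no-smaller ℕ.≤-refl (scaled c 1ℚ p)
      (small-resp (small-* {u = λ _ → real c} (above-at (fromℝ (fromℚ c))) p′z→0) λ k →
        trans (cong (real c *_) (trans (at-eval (deflateᶜ (constants (a ∷ p)) z) z k)
          (trans (cong (λ f → ⟦ f ⟧ (at k z)) (trans (at-deflateᶜ (constants (a ∷ p)) z k)
              (cong (λ f → deflate f (at k z)) (at-constants (a ∷ p) k))))
            (deflate-at-root a p (at k z)))))
        (sym (⟦scaled⟧ c 1ℚ p (at k z) (trans (ℚ.*-comm c (final-weight 1ℚ n)) wc≡1))))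

  from-roots-root : ∀ {n} (ws : Vec ℂ n) i k → ⟦ from-roots (map (at k) ws) ⟧ (at k (lookup ws i)) ≡ 0𝔾
  from-roots-root (w ∷ ws) zero    k = trans (⟦times-linear⟧ (at k w) (from-roots (map (at k) ws)) (at k w))
    (trans (cong (_* ⟦ from-roots (map (at k) ws) ⟧ (at k w)) (-‿inverseʳ (at k w))) (zeroˡ (⟦ from-roots (map (at k) ws) ⟧ (at k w))))
  from-roots-root (w ∷ ws) (suc i) k = trans (⟦times-linear⟧ (at k w) (from-roots (map (at k) ws)) (at k (lookup ws i)))
    (trans (cong ((at k (lookup ws i) - at k w) *_) (from-roots-root ws i k)) (zeroʳ (at k (lookup ws i) - at k w)))

  roots-of-factorization : ∀ {n} (f : Vec ℂ n) (ws : Vec ℂ n) →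
    Vanishes (λ k → dist (map (at k) f) (from-roots (map (at k) ws))) → ∀ i → Small λ k → at k (eval f (lookup ws i))
  roots-of-factorization {n} f ws f≈ i = from (above-at w)
    where
    w : ℂ
    w = lookup ws i
    from : BoundedAbove (λ k → at k w) → Small λ k → at k (eval f w)
    from (within B 1≤B w≤B) = small λ ε 0<ε → stage₂ ε (quotient 0<K 0<ε)
      where
      K = power B n
      0<K : 0ℚ < K
      0<K = ℚ.<-≤-trans 0<1 (1≤power 1≤B n)
      stage₂ : ∀ ε → (∃ λ d → 0ℚ < d × K ℚ.* d ≡ ε) → Eventually λ k → ‖ at k (eval f w) ‖ < ε
      stage₂ ε (d , 0<d , Kd≡ε) =
        ev-zip {λ k → ‖ at k w ‖ ≤ B} {λ k → dist (map (at k) f) (from-roots (map (at k) ws)) < d}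
        (λ k w≤B f< → ℚ.≤-<-trans
          (subst (λ v → ‖ v ‖ ≤ K ℚ.* dist (map (at k) f) (from-roots (map (at k) ws)))
            (trans (cong₂ _-_ (sym (at-eval f w k)) (from-roots-root ws i k))
              (G.solve 1 (λ v → v G.:- G.con 0𝔾 G.:= v) refl (at k (eval f w))))
            (⟦⟧-lipschitz (map (at k) f) (from-roots (map (at k) ws)) (at k w) 1≤B w≤B))
          (subst (K ℚ.* dist (map (at k) f) (from-roots (map (at k) ws)) <_) Kd≡ε
            (ℚ.*-monoʳ-<-pos K {{ℚ.positive 0<K}} f<)))
        w≤B (f≈ d 0<d)

-- Rational bounds from moduli, and limits of the coefficients of P.

module PisotConjugates where

  open import Data.Rational.Base using (_≤_; _<_; ∣_∣)
  open import Data.Integer.Base using (+_)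
  open RationalOrder
  open Gaussian
  open ApproximateRoot using (⟦_⟧)
  open ApproximateFactorization
  open ComplexRoots
  open RealLimits
  open RootProducts
  open Contradictions using (⅝)
  open Integrality using (ι)
  open Conjugates
  open import Defs as D using (ℂ; fromℚ; 1ℝ)

  open ℚ.+-*-Solver using (solve; con; _:+_; _:*_; _:-_; :-_; _:=_)
  private module G = 𝔾-Solver

  0≤precision : ∀ n → 0ℚ ≤ D.precision n
  0≤precision n = ℚ.nonNegative⁻¹ (D.precision n) {{ℚ.normalize-nonNeg 1 (suc n)}}

  N-inside : ∀ z → D.∣ z ∣ D.< 1ℝ → ∃ λ γ → 0ℚ < γ × Eventually λ k → N (at k z) ≤ 1ℚ ℚ.- γ
  N-inside z (ε , 0<ε , ∣z∣≤) = ½ ℚ.* ε , 0<half 0<ε , ev-zip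
      (λ k small≤ prec≤ → ℚ.≤-trans (D.sqrtApprox-upper k (N (at k z)))
        (bound-square (D.sqrtApprox k (N (at k z))) (D.precision k) (D.sqrtApprox-nonNeg k (N (at k z))) (0≤precision k) small≤ prec≤))
      ∣z∣≤ (D.precision-small (0<half 0<ε))
    where
    bound-square : ∀ s η → 0ℚ ≤ s → 0ℚ ≤ η → s ℚ.+ ε ≤ 1ℚ → η ≤ ½ ℚ.* ε →
      (s ℚ.+ η) ℚ.* (s ℚ.+ η) ≤ 1ℚ ℚ.- ½ ℚ.* ε
    -- The sum v = s + η satisfies v ≤ 1 - ε/2 and v ≤ 1, hence v² ≤ 1 - ε/2.
    bound-square s η 0≤s 0≤η s≤ η≤ = ℚ.≤-trans
      (*-mono {v} {1ℚ} {v} {1ℚ ℚ.- ½ ℚ.* ε} 0≤1 (0≤+ 0≤s 0≤η)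
        (ℚ.≤-trans v≤ (≤-from (ℚ.<⇒≤ (0<half 0<ε)) (solve 1 (λ h → con 1ℚ :- (con 1ℚ :- h) := h) refl (½ ℚ.* ε)))) v≤)
      (ℚ.≤-reflexive (ℚ.*-identityˡ (1ℚ ℚ.- ½ ℚ.* ε)))
      where
      v : ℚ
      v = s ℚ.+ η
      v≤ : v ≤ 1ℚ ℚ.- ½ ℚ.* ε
      v≤ = ≤-from (0≤+ (≤⇒0≤- s≤) (≤⇒0≤- η≤)) (solve 3 (λ s η e → (con 1ℚ :- con ½ :* e) :- (s :+ η)
        := (con 1ℚ :- (s :+ e)) :+ (con ½ :* e :- η)) refl s η ε)

  -- (√5 - 1)/2 is the positive root of v² + v = 1; these are consequences of v² + v ≤ 1 - γ for v = |z|.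
  record SmallModulus (γ : ℚ) (z : 𝔾) : Set where
    field
      re≤   : re z ≤ ⅝
      -re≤  : ℚ.- re z ≤ ⅝
      re²-re≤ : re z ℚ.* re z ℚ.- re z ≤ 1ℚ ℚ.- γ
      N≤    : N z ≤ ⅝ ℚ.* ⅝

  small-modulus : ∀ z → D.∣ z ∣ D.< ((D.sqrt (fromℚ (+ 5 ℚ./ 1)) D.- 1ℝ) D.* fromℚ ½) →
    ∃ λ γ → 0ℚ < γ × Eventually λ k → SmallModulus γ (at k z)
  small-modulus z (ε , 0<ε , ∣z∣≤) = ½ ℚ.* ε , 0<half 0<ε , ev-zip
      (λ k small≤ prec≤ → from (at k z) (D.sqrtApprox k (N (at k z))) (D.precision k) (D.sqrtApprox k (+ 5 ℚ./ 1))
        (D.sqrtApprox-nonNeg k (N (at k z))) (0≤precision k) (D.sqrtApprox-upper k (N (at k z)))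
        (square≤5 k) (D.sqrtApprox-nonNeg k (+ 5 ℚ./ 1)) small≤ prec≤)
      ∣z∣≤ (D.precision-small (0<half 0<ε))
    where
    5ℚ = + 5 ℚ./ 1
    square≤5 : ∀ k → D.sqrtApprox k 5ℚ ℚ.* D.sqrtApprox k 5ℚ ≤ 5ℚ
    square≤5 k = cases (D.sqrtApprox k 5ℚ) (D.sqrtApprox-lower k 5ℚ)
      where
      cases : ∀ s → s ≡ 0ℚ ⊎ s ℚ.* s ≤ 5ℚ → s ℚ.* s ≤ 5ℚ
      cases _ (inj₁ refl) = ℚ.nonNegative⁻¹ 5ℚ
      cases _ (inj₂ s²≤5) = s²≤5
    from : ∀ z t η s → 0ℚ ≤ t → 0ℚ ≤ η → N z ≤ (t ℚ.+ η) ℚ.* (t ℚ.+ η) → s ℚ.* s ≤ 5ℚ → 0ℚ ≤ s →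
      t ℚ.+ ε ≤ (s ℚ.+ ℚ.- 1ℚ) ℚ.* ½ → η ≤ ½ ℚ.* ε → SmallModulus (½ ℚ.* ε) z
    from (x ⊹ y) t η s 0≤t 0≤η Nz≤ s²≤5 0≤s t≤ η≤ = record
      { re≤ = ℚ.≤-trans x≤v v≤⅝
      ; -re≤ = ℚ.≤-trans -x≤v v≤⅝
      ; re²-re≤ = ℚ.≤-trans (ℚ.+-mono-≤ x²≤v² -x≤v) v²+v≤
      ; N≤ = ℚ.≤-trans Nz≤ (*-mono {v} {⅝} {v} {⅝} (ℚ.nonNegative⁻¹ ⅝) 0≤v v≤⅝ v≤⅝)
      }
      where
      v w : ℚ
      v = t ℚ.+ η
      -- `v` bounds |z| and `s` approximates √5 from below. The hypothesis amounts to 2 v + 1 + ε ≤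
      -- s, and squaring with s² ≤ 5 yields v² + v ≤ 1 - ε/2.
      w = (v ℚ.+ v) ℚ.+ (1ℚ ℚ.+ ε)
      0≤ε = ℚ.<⇒≤ 0<ε
      0≤v : 0ℚ ≤ v
      0≤v = 0≤+ 0≤t 0≤η
      0≤w : 0ℚ ≤ w
      0≤w = 0≤+ (0≤+ 0≤v 0≤v) (0≤+ 0≤1 0≤ε)
      w≤s : w ≤ s
      w≤s = ≤-from (0≤* (ℚ.nonNegative⁻¹ 2ℚ) (0≤+ (≤⇒0≤- t≤) (≤⇒0≤- η≤)))
        (solve 4 (λ t η s e → s :- (((t :+ η) :+ (t :+ η)) :+ (con 1ℚ :+ e))
          := con 2ℚ :* (((s :+ con (ℚ.- 1ℚ)) :* con ½ :- (t :+ e)) :+ (con ½ :* e :- η))) refl t η s ε)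
      v²+v≤ : v ℚ.* v ℚ.+ v ≤ 1ℚ ℚ.- ½ ℚ.* ε
      v²+v≤ = ≤-from (0≤* (ℚ.nonNegative⁻¹ (½ ℚ.* ½)) (0≤+
          (≤⇒0≤- (ℚ.≤-trans (*-mono {w} {s} {w} {s} 0≤s 0≤w w≤s w≤s) s²≤5))
          (0≤* 0≤ε (0≤+ (0≤* (ℚ.nonNegative⁻¹ 4ℚ′) 0≤v) 0≤ε))))
        (solve 2 (λ v e → let w = (v :+ v) :+ (con 1ℚ :+ e) in
          (con 1ℚ :- con ½ :* e) :- (v :* v :+ v)
          := con (½ ℚ.* ½) :* ((con 5ℚ :- w :* w) :+ e :* (con 4ℚ′ :* v :+ e))) refl v ε)
        where 4ℚ′ = + 4 ℚ./ 1
      v≤⅝ : v ≤ ⅝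
      -- 5/8 lies just beyond the golden root: (5/8)² + 5/8 = 1 + 1/64.
      v≤⅝ = ℚ.≮⇒≥ λ ⅝<v → ℚ.<-irrefl refl (ℚ.≤-<-trans v²+v≤ (<-from
        (0<+ (0<+ (0<* (<⇒0<- ⅝<v) (0<+′ 0≤v (ℚ.positive⁻¹ (+ 13 ℚ./ 8)))) (ℚ.nonNegative⁻¹ (+ 1 ℚ./ 64))) (ℚ.<⇒≤ (0<half 0<ε)))
        (solve 2 (λ v h → (v :* v :+ v) :- (con 1ℚ :- h)
          := ((v :- con ⅝) :* (v :+ con (+ 13 ℚ./ 8)) :+ con (+ 1 ℚ./ 64)) :+ h) refl v (½ ℚ.* ε))))
      x²≤v² : x ℚ.* x ≤ v ℚ.* v
      x²≤v² = ℚ.≤-trans (≤-from (0≤x² y) (solve 2 (λ x y → (x :* x :+ y :* y) :- x :* x := y :* y) refl x y)) Nz≤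
      x≤v : x ≤ v
      x≤v = square-cancel-≤ 0≤v x²≤v²
      -x≤v : ℚ.- x ≤ v
      -x≤v = square-cancel-≤ 0≤v (subst (_≤ v ℚ.* v) (solve 1 (λ x → x :* x := (:- x) :* (:- x)) refl x) x²≤v²)

  IntegralAt : ∀ {n} (π : ∀ {n} → Vec 𝔾 n → 𝔾) (P : Vec ℤ n) → Set
  IntegralAt π P = ∃ λ x → π (map real (map ι P)) ≡ real (ι x)

  constant-integral : ∀ {n} (P : Vec ℤ n) → IntegralAt constant P
  constant-integral []      = + 1 , refl
  constant-integral (a ∷ P) = a , refl

  linear-integral : ∀ {n} (P : Vec ℤ n) → IntegralAt linear P
  linear-integral []      = + 0 , refl
  linear-integral (a ∷ P) = constant-integral P

  subleading-integral : ∀ {n} (P : Vec ℤ n) → IntegralAt subleading P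
  subleading-integral []          = + 0 , refl
  subleading-integral (a ∷ [])    = a , refl
  subleading-integral (a ∷ b ∷ P) = subleading-integral (b ∷ P)

  small⇒null-re : ∀ {u} → Small u → Null (λ k → re (u k))
  small⇒null-re {u} h = null λ ε 0<ε → ev-map (λ k → ℚ.≤-<-trans ∣re∣≤‖ u k ‖) (vanishes h ε 0<ε)

  small⇒null-im : ∀ {u} → Small u → Null (λ k → im (u k))
  small⇒null-im {u} h = null λ ε 0<ε → ev-map (λ k → ℚ.≤-<-trans ∣im∣≤‖ u k ‖) (vanishes h ε 0<ε)

  null-neg : ∀ {x} → Null x → Null (λ k → ℚ.- x k)
  null-neg {x} (null h) = null λ ε 0<ε → ev-map (λ k → subst (_< ε) (sym (ℚ.∣-p∣≡∣p∣ (x k)))) (h ε 0<ε)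

  null⇒bounded : ∀ {x} → Null x → Bounded x
  null⇒bounded h = is-bounded (null⇒nonNeg h)

  nonNeg-approx : ∀ {u v : Seq} → Bounded v → Eventually (λ k → 0ℚ ≤ u k) → Null (λ k → u k ℚ.- v k) → NonNeg v
  nonNeg-approx {u} {v} b 0≤u (null h) = nonNeg b λ ε 0<ε → ev-zip {λ k → 0ℚ ≤ u k} {λ k → ∣ u k ℚ.- v k ∣ < ε}
    (λ k 0≤u close → <-from (0<+ (<⇒0<- (∣x∣<⇒x< close)) 0≤u)
      (solve 3 (λ u v e → v :- (:- e) := (e :- (u :- v)) :+ u) refl (u k) (v k) ε))
    0≤u (h ε 0<ε)

  root-of-deflate : ∀ {n} (f : Vec ℂ (suc n)) w z → Small (λ k → at k (eval f w)) → Small (λ k → at k (eval f z)) →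
    BoundedBelow (λ k → at k z - at k w) → Small (λ k → at k (eval (deflateᶜ f w) z))
  root-of-deflate f w z fw fz apart = small-cancel apart
    (small-resp (small-+ fz (small-neg fw)) λ k → trans (cong (_- at k (eval f w)) (at-eval-deflate f w z k))
      (G.solve 2 (λ a b → (a G.:+ b) G.:- a G.:= b) refl (at k (eval f w))
        ((at k z - at k w) * at k (eval (deflateᶜ f w) z))))

  -- p² (1 - |C|²) and p² Re (E - C S̄) in the limit, where C, E and S are the constant,
  -- linear and subleading coefficients left after splitting off the factors x - q and x - a.
  module Vieta (q a : Seq) (q-bounded : Bounded q) (a-bounded : Bounded a) (ν t₁ t : ℚ) (C E S : ℕ → 𝔾)
    (constant-limit   : Small λ k → real ν - - (real (q k) * - (real (a k) * C k)))
    (linear-limit     : Small λ k → real t₁ - (- (real (a k) * C k) - real (q k) * (C k - real (a k) * E k)))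
    (subleading-limit : Small λ k → real t - ((S k - real (a k)) - real (q k))) where

    -- The xᵢ are the defects of Vieta's relations p E = t₁ + s C, p C = ν and S = t + s, the last
    -- two also in their imaginary parts. Substituting these relations into p² (E - C S̄) yields
    -- `M`.
    p s x₁ x₂ x₃ x₄ x₅ X Y M : Seq
    p k = q k ℚ.* a k
    s k = q k ℚ.+ a k
    x₁ k = t₁ ℚ.- (p k ℚ.* re (E k) ℚ.- s k ℚ.* re (C k))
    x₂ k = ν ℚ.- p k ℚ.* re (C k)
    x₃ k = t ℚ.- (re (S k) ℚ.- s k)
    x₄ k = p k ℚ.* im (C k)
    x₅ k = im (S k)
    X k = re (E k - C k * S k ̄)
    Y k = 1ℚ ℚ.- N (C k)
    M k = p k ℚ.* t₁ ℚ.+ s k ℚ.* ν ℚ.- ν ℚ.* p k ℚ.* (t ℚ.+ s k)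

    p-bounded : Bounded p
    p-bounded = bounded-* q-bounded a-bounded
    s-bounded : Bounded s
    s-bounded = bounded-+ q-bounded a-bounded

    x₁→0 : Null x₁
    x₁→0 = null-resp (small⇒null-re linear-limit) λ k → part t₁ (q k) (a k) (C k) (E k)
      where
      part : ∀ t q a C E → re (real t - (- (real a * C) - real q * (C - real a * E))) ≡
        t ℚ.- ((q ℚ.* a) ℚ.* re E ℚ.- (q ℚ.+ a) ℚ.* re C)
      part t q a (c ⊹ d) (e ⊹ f) = solve 7 (λ t q a c d e f → let 0′ = con 0ℚ in
        t :+ :- (:- (a :* c :- 0′ :* d) :+ :- (q :* (c :+ :- (a :* e :- 0′ :* f)) :- 0′ :* (d :+ :- (a :* f :+ 0′ :* e))))
        := t :- ((q :* a) :* e :- (q :+ a) :* c)) refl t q a c d e f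
    constant-components : ∀ ν q a C → real ν - - (real q * - (real a * C)) ≡
      (ν ℚ.- (q ℚ.* a) ℚ.* re C) ⊹ (ℚ.- ((q ℚ.* a) ℚ.* im C))
    constant-components ν q a (c ⊹ d) = cong₂ _⊹_
      (solve 5 (λ ν q a c d → let 0′ = con 0ℚ in
        ν :+ :- (:- (q :* (:- (a :* c :- 0′ :* d)) :- 0′ :* (:- (a :* d :+ 0′ :* c))))
        := ν :- (q :* a) :* c) refl ν q a c d)
      (solve 4 (λ q a c d → let 0′ = con 0ℚ in
        0′ :+ :- (:- (q :* (:- (a :* d :+ 0′ :* c)) :+ 0′ :* (:- (a :* c :- 0′ :* d))))
        := :- ((q :* a) :* d)) refl q a c d)
    x₂→0 : Null x₂
    x₂→0 = null-resp (small⇒null-re constant-limit) λ k → cong re (constant-components ν (q k) (a k) (C k))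
    x₄→0 : Null x₄
    x₄→0 = null-resp (null-neg (small⇒null-im constant-limit)) λ k →
      trans (cong (λ z → ℚ.- im z) (constant-components ν (q k) (a k) (C k)))
        (solve 1 (λ x → :- (:- x) := x) refl (p k ℚ.* im (C k)))
    subleading-components : ∀ t q a S → real t - ((S - real a) - real q) ≡
      (t ℚ.- (re S ℚ.- (q ℚ.+ a))) ⊹ (ℚ.- im S)
    subleading-components t q a (c ⊹ d) = cong₂ _⊹_
      (solve 4 (λ t q a c → t :+ :- ((c :+ :- a) :+ :- q) := t :- (c :- (q :+ a))) refl t q a c)
      (solve 1 (λ d → con 0ℚ :+ :- ((d :+ con 0ℚ) :+ con 0ℚ) := :- d) refl d)
    x₃→0 : Null x₃
    x₃→0 = null-resp (small⇒null-re subleading-limit) λ k → cong re (subleading-components t (q k) (a k) (S k))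
    x₅→0 : Null x₅
    x₅→0 = null-resp (null-neg (small⇒null-im subleading-limit)) λ k →
      trans (cong (λ z → ℚ.- im z) (subleading-components t (q k) (a k) (S k)))
        (solve 1 (λ x → :- (:- x) := x) refl (im (S k)))

    p²Y-limit : Null (λ k → p k ℚ.* p k ℚ.* Y k ℚ.- (p k ℚ.* p k ℚ.- ν ℚ.* ν))
    p²Y-limit = null-resp
      (null-+ (null-*ˡ (bounded-+ (bounded-const (ν ℚ.+ ν)) (bounded-neg (null⇒bounded x₂→0))) x₂→0)
        (null-neg (null-*ˡ (null⇒bounded x₄→0) x₄→0)))
      λ k → part (p k) ν (C k)
      where
      part : ∀ p ν C → (ν ℚ.+ ν ℚ.+ ℚ.- (ν ℚ.- p ℚ.* re C)) ℚ.* (ν ℚ.- p ℚ.* re C) ℚ.+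
          ℚ.- (p ℚ.* im C ℚ.* (p ℚ.* im C)) ≡ p ℚ.* p ℚ.* (1ℚ ℚ.- N C) ℚ.- (p ℚ.* p ℚ.- ν ℚ.* ν)
      part p ν (c ⊹ d) = solve 4 (λ p ν c d →
        (ν :+ ν :+ :- (ν :- p :* c)) :* (ν :- p :* c) :+ :- (p :* d :* (p :* d))
        := p :* p :* (con 1ℚ :- (c :* c :+ d :* d)) :- (p :* p :- ν :* ν)) refl p ν c d

    -- The factor p² avoids dividing by p in C = ν / p. The deviation from `M` is an exact
    -- combination of x₁, ..., x₅ with bounded coefficients.
    p²X-limit : Null (λ k → p k ℚ.* p k ℚ.* X k ℚ.- M k)
    p²X-limit = null-resp
      (null-+ (null-+ (null-*ˡ (bounded-neg p-bounded) x₁→0)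
          (null-*ˡ (bounded-+ (bounded-* p-bounded (bounded-+ (bounded-const t) s-bounded)) (bounded-neg s-bounded)) x₂→0))
        (null-+ (null-*ˡ (bounded-* (bounded-const ν) p-bounded) x₃→0)
          (null-+ (null-neg (null-*ˡ (bounded-* p-bounded (null⇒bounded x₂→0)) x₃→0))
            (null-neg (null-*ˡ (bounded-* p-bounded (null⇒bounded x₄→0)) x₅→0)))))
      λ k → part (p k) (s k) ν t₁ t (C k) (E k) (S k)
      where
      part : ∀ p s ν t₁ t C E S →
        (ℚ.- p ℚ.* (t₁ ℚ.- (p ℚ.* re E ℚ.- s ℚ.* re C)) ℚ.+
          (p ℚ.* (t ℚ.+ s) ℚ.+ ℚ.- s) ℚ.* (ν ℚ.- p ℚ.* re C)) ℚ.+
        (ν ℚ.* p ℚ.* (t ℚ.- (re S ℚ.- s)) ℚ.+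
          (ℚ.- (p ℚ.* (ν ℚ.- p ℚ.* re C) ℚ.* (t ℚ.- (re S ℚ.- s))) ℚ.+
            ℚ.- (p ℚ.* (p ℚ.* im C) ℚ.* im S))) ≡
        p ℚ.* p ℚ.* re (E - C * S ̄) ℚ.- (p ℚ.* t₁ ℚ.+ s ℚ.* ν ℚ.- ν ℚ.* p ℚ.* (t ℚ.+ s))
      part p s ν t₁ t (c ⊹ d) (e ⊹ f) (g ⊹ h) = solve 10 (λ p s ν t₁ t c d e g h →
        (:- p :* (t₁ :- (p :* e :- s :* c)) :+ (p :* (t :+ s) :+ :- s) :* (ν :- p :* c)) :+
        (ν :* p :* (t :- (g :- s)) :+ (:- (p :* (ν :- p :* c) :* (t :- (g :- s))) :+ :- (p :* (p :* d) :* h)))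
        := p :* p :* (e :+ :- (c :* g :- d :* (:- h))) :- (p :* t₁ :+ s :* ν :- ν :* p :* (t :+ s)))
        refl p s ν t₁ t c d e g h

-- No conjugate has modulus below the golden bound.

module SmallConjugates where

  open import Data.Rational.Base using (_≤_; _<_; ∣_∣)
  open import Data.Integer.Base using (+_; -[1+_])
  open RationalOrder
  open Gaussian
  open ApproximateRoot using (⟦_⟧)
  open ApproximateFactorization
  open ComplexRoots
  open RealLimits
  open RootProducts
  open Contradictions using (⅝; no-positive-conjugate; no-quadratic-unit; no-negative-conjugate)
  open Integrality using (ι; ι-+; ι-neg; ι-mono-≤)
  open Conjugates
  open PisotConjugates
  open import Defs as D using (ℝ; seq; ℂ; fromℝ; 1ℝ; _+i_; IsMinimalPolynomial; _IsConjugateOf_)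

  open ℚ.+-*-Solver using (solve; con; _:+_; _:*_; _:-_; :-_; _:=_)
  private module G = 𝔾-Solver

  integer-gap : ∀ n T → ι T ≤ ι n ⊎ ι (ℤ.suc n) ≤ ι T
  integer-gap n T with T ℤ.≤? n
  ... | yes T≤n = inj₁ (ι-mono-≤ T≤n)
  ... | no  T≰n = inj₂ (ι-mono-≤ (ℤ.i<j⇒suc[i]≤j (ℤ.≰⇒> T≰n)))

  ι-square-monotone : ∀ {x} → + 2 ℤ.≤ x → + 4 ℚ./ 1 ≤ ι x ℚ.* ι x
  ι-square-monotone {x} 2≤x = *-mono {+ 2 ℚ./ 1} {ι x} {+ 2 ℚ./ 1} {ι x}
    (ℚ.≤-trans (ℚ.nonNegative⁻¹ (+ 2 ℚ./ 1)) (ι-mono-≤ 2≤x)) (ℚ.nonNegative⁻¹ (+ 2 ℚ./ 1)) (ι-mono-≤ 2≤x) (ι-mono-≤ 2≤x)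

  unit : ∀ ν → ν ≢ + 0 → ι ν ℚ.* ι ν < + 4 ℚ./ 1 → ν ≡ + 1 ⊎ ν ≡ -[1+ 0 ]
  unit (+ 0)             ν≢0 _  = contradiction refl ν≢0
  unit (+ 1)             _   _  = inj₁ refl
  unit (+ suc (suc n))   _   lt = contradiction (ℚ.≤-<-trans (ι-square-monotone {+ suc (suc n)} (ℤ.+≤+ (ℕ.s≤s (ℕ.s≤s ℕ.z≤n)))) lt) (ℚ.<-irrefl refl)
  unit -[1+ 0 ]          _   _  = inj₂ refl
  unit -[1+ suc n ]      _   lt = contradiction (ℚ.≤-<-trans (ι-square-monotone {+ suc (suc n)} (ℤ.+≤+ (ℕ.s≤s (ℕ.s≤s ℕ.z≤n))))
    (subst (_< + 4 ℚ./ 1) (trans (cong₂ ℚ._*_ (ι-neg (+ suc (suc n))) (ι-neg (+ suc (suc n))))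
      (solve 1 (λ x → (:- x) :* (:- x) := x :* x) refl (ι (+ suc (suc n))))) lt)) (ℚ.<-irrefl refl)

  module _ (q : ℝ) (γ : ℚ) (0<γ : 0ℚ < γ)
    (q>1 : NonNeg (λ k → seq q k ℚ.- (1ℚ ℚ.+ γ))) (q<2 : NonNeg (λ k → (+ 2 ℚ./ 1 ℚ.- γ) ℚ.- seq q k))
    (q₁ : Eventually λ k → 1ℚ ≤ seq q k) (q₂ : Eventually λ k → seq q k ≤ + 2 ℚ./ 1)
    (pisot : ∀ z → z IsConjugateOf fromℝ q → ¬ (z D.≈ᶜ fromℝ q) → D.∣ z ∣ D.< 1ℝ)
    (algebraic-integer : D.IsAlgebraicInteger (fromℝ q)) where

    private
      Q̂ : ℂ
      Q̂ = fromℝ q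

      q-away : BoundedBelow λ k → at k Q̂
      q-away = away 1ℚ 0<1 (ev-map (λ k 1≤q → ℚ.≤-trans 1≤q (ℚ.≤-trans (x≤∣x∣ (seq q k)) ∣re∣≤‖ at k Q̂ ‖)) q₁)
        where
        x≤∣x∣ : ∀ x → x ≤ ∣ x ∣
        x≤∣x∣ x = ℚ.≮⇒≥ λ lt → ℚ.<-irrefl refl (∣x∣<⇒x< {x} lt)

    module Polynomial {n} (p : Vec ℚ (suc n)) (minimal : IsMinimalPolynomial p Q̂) where
      open Minimal p Q̂ minimal

      f₀ : Vec ℂ (suc n)
      f₀ = constants p
      f₁ : Vec ℂ n
      f₁ = deflateᶜ f₀ Q̂

      f₀-root : ∀ z → Root p z → Small λ k → at k (eval f₀ z)
      f₀-root z root = small-resp root λ k → sym (at-eval-constants p z k)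

      Q̂-root : Small λ k → at k (eval f₀ Q̂)
      Q̂-root = f₀-root Q̂ z-root

      Inside : ℂ → Set
      Inside w = ∃ λ γ → 0ℚ < γ × Eventually λ k → N (at k w) ≤ 1ℚ ℚ.- γ

      -- A root w of P/(x - q) is a conjugate of q. It is distinct from q, since otherwise P′(q),
      -- the value of that quotient at q, would vanish against `simple-root`; so the Pisot condition
      -- applies to it.
      inside : ∀ w → Small (λ k → at k (eval f₁ w)) → Inside w
      inside w f₁w→0 = N-inside w (pisot w (suc n , p , minimal , root⇒isRoot p w w-root) w≉q)
        where
        w-root : Root p w
        w-root = small-resp (small-+ Q̂-root (small-+ (small-* (above-at w) f₁w→0) (small-neg (small-* (above-at Q̂) f₁w→0))))
          λ k → trans (G.solve 4 (λ c w q f → c G.:+ (w G.:* f G.:+ G.:- (q G.:* f)) G.:= c G.:+ (w G.:- q) G.:* f)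
              refl (at k (eval f₀ Q̂)) (at k w) (at k Q̂) (at k (eval f₁ w)))
            (trans (sym (at-eval-deflate f₀ Q̂ w k)) (at-eval-constants p w k))
        w≉q : ¬ (w D.≈ᶜ Q̂)
        w≉q w≈q = simple-root p Q̂ minimal (small-resp
          (small-+ f₁w→0 (small-neg (eval-close f₁ w Q̂ (≈⇒small w Q̂ w≈q)))) λ k →
          G.solve 2 (λ a b → a G.:+ G.:- (a G.:- b) G.:= b) refl (at k (eval f₁ w)) (at k (eval f₁ Q̂)))

      all-inside : ∀ {m} (ws : Vec ℂ m) → (∀ i → Small λ k → at k (eval f₁ (lookup ws i))) →
        Eventually λ k → All (λ w → N w ≤ 1ℚ) (map (at k) ws)
      all-inside []       _     = always λ k → []
      all-inside (w ∷ ws) roots = ev-zip {λ k → N (at k w) ≤ 1ℚ} (λ k → _∷_)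
        (weaken (inside w (roots zero))) (all-inside ws (λ i → roots (suc i)))
        where
        weaken : Inside w → Eventually λ k → N (at k w) ≤ 1ℚ
        weaken (γ , 0<γ , N≤) = ev-map (λ k le → ℚ.≤-trans le (≤-from (ℚ.<⇒≤ 0<γ)
          (solve 1 (λ g → con 1ℚ :- (con 1ℚ :- g) := g) refl γ))) N≤

      -- Strictness of |p| > 1 needs a further root: its modulus below 1 bounds the whole product
      -- away from 1. In the application the empty product means that P is quadratic.
      constant-inside : ∀ {m} (ws : Vec ℂ m) → (∀ i → Small λ k → at k (eval f₁ (lookup ws i))) →
        let g = λ k → from-roots (map (at k) ws) in
        (∃ λ γ → 0ℚ < γ × Eventually λ k → N (constant (g k)) ≤ 1ℚ ℚ.- γ) ⊎
        (∀ k → constant (g k) ≡ 1𝔾 × subleading (g k) ≡ 0𝔾)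
      constant-inside []       _     = inj₂ λ k → refl , refl
      constant-inside (w ∷ ws) roots = inj₁ (from (inside w (roots zero)))
        where
        from : Inside w → ∃ λ γ → 0ℚ < γ × Eventually λ k → N (constant (from-roots (map (at k) (w ∷ ws)))) ≤ 1ℚ ℚ.- γ
        from (γ , 0<γ , N≤) = γ , 0<γ , ev-zip {λ k → N (at k w) ≤ 1ℚ ℚ.- γ}
          (λ k le all → ℚ.≤-trans (N-constant-∷ (at k w) all) le) N≤ (all-inside ws (λ i → roots (suc i)))

      integral-p : ∃ λ P → map ι P ≡ p
      integral-p = let d , F , root = algebraic-integer in integral F root

      constant≢0 : ∀ {ν} → constant (map real p) ≡ real (ι ν) → ν ≢ + 0
      constant≢0 {ν} eq refl = contradiction (head-zero p eq) (λ { (a , p′ , refl , refl) → constant-nonzero p′ Q̂ minimal q-away refl })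
        where
        head-zero : ∀ {n} (p : Vec ℚ (suc n)) → constant (map real p) ≡ real 0ℚ → ∃ λ a → ∃ λ p′ → p ≡ a ∷ p′ × a ≡ 0ℚ
        head-zero (a ∷ p) eq = a , p , refl , cong re eq

    private
      module _ {m} (p : Vec ℚ (suc (suc m))) (minimal : IsMinimalPolynomial p Q̂) where
        open Polynomial p minimal

        real-conjugate : ∀ (a : ℝ) → Small (λ k → at k (eval f₁ (fromℝ a))) →
          NonNeg (λ k → ⅝ ℚ.- seq a k) → NonNeg (λ k → ⅝ ℚ.+ seq a k) →
          NonNeg (λ k → (1ℚ ℚ.- γ) ℚ.- (seq a k ℚ.* seq a k ℚ.- seq a k)) → ⊥
        real-conjugate a α-root a≤⅝ -a≤⅝ a²-a<1 =
          stage₁ integral-p (complex-factorization (deflateᶜ f₁ α))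
          where
          α : ℂ
          α = fromℝ a
          stage₁ : (∃ λ P → map ι P ≡ p) → (∃ λ ws → Vanishes λ k → dist (map (at k) (deflateᶜ f₁ α)) (from-roots (map (at k) ws))) → ⊥
          stage₁ (P , P≡p) (ws , f₂≈) = stage₂ (constant-integral P) (linear-integral P) (subleading-integral P)
            where
            vs : Vec ℂ (suc m)
            vs = α ∷ ws
            f₁≈ : Vanishes λ k → dist (map (at k) f₁) (from-roots (map (at k) vs))
            f₁≈ = times-linear-limit f₁ α (vanishes α-root) (λ k → from-roots (map (at k) ws)) f₂≈
            f₀≈ : Vanishes λ k → dist (map (at k) f₀) (from-roots (map (at k) (Q̂ ∷ vs)))
            f₀≈ = times-linear-limit f₀ Q̂ (vanishes Q̂-root) (λ k → from-roots (map (at k) vs)) f₁≈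
            ws-inside : Eventually λ k → All (λ w → N w ≤ 1ℚ) (map (at k) ws)
            ws-inside = all-inside ws (λ i → roots-of-factorization f₁ vs f₁≈ (suc i))
            g : ℕ → Vec 𝔾 m
            g k = from-roots (map (at k) ws)
            C E S : ℕ → 𝔾
            C k = constant (g k)
            E k = linear (g k)
            S k = subleading (g k)
            q̂ â : Seq
            q̂ = seq q
            â = seq a

            limit : ∀ {x} {π : ∀ {n} → Vec 𝔾 n → 𝔾} → (∀ {n} (f g : Vec 𝔾 n) → ‖ π f - π g ‖ ≤ dist f g) →
              π (map real (map ι P)) ≡ real x → (h : ℕ → 𝔾) →
              (∀ k → π (from-roots (map (at k) (Q̂ ∷ vs))) ≡ h k) → Small λ k → real x - h k
            limit {π = π} close eq h split = small-resp
              (small-dist (λ k → map (at k) f₀) (λ k → from-roots (map (at k) (Q̂ ∷ vs))) {π} close f₀≈)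
              λ k → cong₂ _-_ (trans (cong π (trans (at-constants p k) (cong (map real) (sym P≡p)))) eq) (split k)

            stage₂ : (∃ λ ν → constant (map real (map ι P)) ≡ real (ι ν)) → (∃ λ t₁ → linear (map real (map ι P)) ≡ real (ι t₁)) →
              (∃ λ t → subleading (map real (map ι P)) ≡ real (ι t)) → ⊥
            stage₂ (ν , ν≡) (t₁ , t₁≡) (t , t≡) = decide (unit ν ν≢0 ν²<4)
              where
              open Vieta q̂ â (bounded-seq q) (bounded-seq a) (ι ν) (ι t₁) (ι t) C E S
                (limit {π = constant} constant-close ν≡ _ λ k → trans (constant-times-linear (at k Q̂) (from-roots (map (at k) vs)))
                  (cong (λ z → - (at k Q̂ * z)) (constant-times-linear (at k α) (g k))))
                (limit {π = linear} linear-close t₁≡ _ λ k → trans (linear-times-linear (at k Q̂) (from-roots (map (at k) vs)))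
                  (cong₂ (λ z w → z - at k Q̂ * w) (constant-times-linear (at k α) (g k)) (linear-times-linear (at k α) (g k))))
                (limit {π = subleading} subleading-close t≡ _ λ k → trans (subleading-times-linear (at k Q̂) (from-roots (map (at k) vs)))
                  (cong (_- at k Q̂) (subleading-times-linear (at k α) (g k))))
                renaming (p to p̂)

              p²-bounded : Bounded (λ k → p̂ k ℚ.* p̂ k ℚ.- ι ν ℚ.* ι ν)
              p²-bounded = bounded-+ (bounded-* p-bounded p-bounded) (bounded-const (ℚ.- (ι ν ℚ.* ι ν)))
              M-bounded : Bounded M
              M-bounded = bounded-+ (bounded-+ (bounded-* p-bounded (bounded-const (ι t₁))) (bounded-* s-bounded (bounded-const (ι ν))))
                (bounded-neg (bounded-* (bounded-* (bounded-const (ι ν)) p-bounded) (bounded-+ (bounded-const (ι t)) s-bounded)))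

              p²≥ν² : NonNeg (λ k → p̂ k ℚ.* p̂ k ℚ.- ι ν ℚ.* ι ν)
              p²≥ν² = nonNeg-approx p²-bounded
                (ev-map (λ k all → 0≤* (0≤x² (p̂ k)) (≤⇒0≤- (proj₁ (schwarz-pick all)))) ws-inside) p²Y-limit

              p²-ν²≥M : NonNeg (λ k → p̂ k ℚ.* p̂ k ℚ.- ι ν ℚ.* ι ν ℚ.- M k)
              p²-ν²≥M = nonNeg-approx (bounded-+ p²-bounded (bounded-neg M-bounded))
                (ev-map (λ k all → 0≤* (0≤x² (p̂ k)) (≤⇒0≤- (proj₁ (schwarz-pick-re all)))) ws-inside)
                (null-resp (null-+ p²Y-limit (null-neg p²X-limit)) λ k →
                  solve 5 (λ P Y X v M → (P :* Y :- v) :+ :- (P :* X :- M) := P :* (Y :- X) :- (v :- M))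
                    refl (p̂ k ℚ.* p̂ k) (Y k) (X k) (p̂ k ℚ.* p̂ k ℚ.- ι ν ℚ.* ι ν) (M k))

              p²-ν²≥-M : NonNeg (λ k → p̂ k ℚ.* p̂ k ℚ.- ι ν ℚ.* ι ν ℚ.+ M k)
              p²-ν²≥-M = nonNeg-approx (bounded-+ p²-bounded M-bounded)
                (ev-map (λ k all → 0≤* (0≤x² (p̂ k)) (≤⇒0≤- (proj₂ (schwarz-pick-re all)))) ws-inside)
                (null-resp (null-+ p²Y-limit p²X-limit) λ k →
                  solve 5 (λ P Y X v M → (P :* Y :- v) :+ (P :* X :- M) := P :* (Y :- :- X) :- (v :+ M))
                    refl (p̂ k ℚ.* p̂ k) (Y k) (X k) (p̂ k ℚ.* p̂ k ℚ.- ι ν ℚ.* ι ν) (M k))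

              ν≢0 : ν ≢ + 0
              ν≢0 = constant≢0 (trans (cong (λ p → constant (map real p)) (sym P≡p)) ν≡)

              2-q : NonNeg (λ k → + 2 ℚ./ 1 ℚ.- q̂ k)
              2-q = nonNeg-resp (nonNeg-+ q<2 (nonNeg-const (ℚ.<⇒≤ 0<γ))) λ k →
                solve 2 (λ q g → ((con (+ 2 ℚ./ 1) :- g) :- q) :+ g := con (+ 2 ℚ./ 1) :- q) refl (q̂ k) γ
              0≤q : NonNeg q̂
              0≤q = eventually-nonNeg (bounded-seq q) (ev-map (λ k → ℚ.≤-trans 0≤1) q₁)

              ν²<4 : ι ν ℚ.* ι ν < + 4 ℚ./ 1
              -- The two factors are 5/4 - p and 5/4 + p, nonnegative since q ≤ 2 and |α| ≤ 5/8;
              -- thus ν² ≤ p² ≤ 25/16.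
              ν²<4 = ℚ.≤-<-trans
                (≤-from (nonNeg-const⁻¹ (nonNeg-resp (nonNeg-+ p²≥ν² (nonNeg-*
                    (nonNeg-+ (nonNeg-* 2-q (nonNeg-const (ℚ.nonNegative⁻¹ ⅝))) (nonNeg-* 0≤q a≤⅝))
                    (nonNeg-+ (nonNeg-* 2-q (nonNeg-const (ℚ.nonNegative⁻¹ ⅝))) (nonNeg-* 0≤q -a≤⅝))))
                  λ k → solve 3 (λ q a n → ((q :* a) :* (q :* a) :- n :* n) :+
                    (((con (+ 2 ℚ./ 1) :- q) :* con ⅝ :+ q :* (con ⅝ :- a)) :* ((con (+ 2 ℚ./ 1) :- q) :* con ⅝ :+ q :* (con ⅝ :+ a)))
                    := con (+ 25 ℚ./ 16) :- n :* n) refl (q̂ k) (â k) (ι ν))) refl)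
                (<-from {+ 25 ℚ./ 16} (ℚ.positive⁻¹ (+ 39 ℚ./ 16)) refl)

              finish : ∀ T → ι ν ≡ 1ℚ ⊎ ι ν ≡ ℚ.- 1ℚ →
                NonNeg (λ k → (p̂ k ℚ.- 1ℚ) ℚ.* ((q̂ k ℚ.+ 1ℚ) ℚ.* (â k ℚ.+ 1ℚ)) ℚ.- p̂ k ℚ.* ι T) →
                NonNeg (λ k → p̂ k ℚ.* ι T ℚ.+ (p̂ k ℚ.- 1ℚ) ℚ.* ((q̂ k ℚ.- 1ℚ) ℚ.* (â k ℚ.- 1ℚ))) → ⊥
              -- The sign of α is undecidable, but refuting α ≤ -ε for every ε > 0 leaves α ≥ 0.
              finish T ν≡±1 upper lower = positive (constant-inside ws roots) (nonNeg-dichotomy a negative)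
                where
                roots : ∀ i → Small λ k → at k (eval f₁ (lookup ws i))
                roots i = roots-of-factorization f₁ vs f₁≈ (suc i)
                ν²≡1 : ι ν ℚ.* ι ν ≡ 1ℚ
                ν²≡1 = square ν≡±1
                  where
                  square : ∀ {x} → x ≡ 1ℚ ⊎ x ≡ ℚ.- 1ℚ → x ℚ.* x ≡ 1ℚ
                  square (inj₁ refl) = refl
                  square (inj₂ refl) = refl
                p²≥1 : NonNeg (λ k → p̂ k ℚ.* p̂ k ℚ.- 1ℚ)
                p²≥1 = nonNeg-resp p²≥ν² λ k → cong (λ n → p̂ k ℚ.* p̂ k ℚ.- n) ν²≡1
                negative : ¬ (∃ λ ε → 0ℚ < ε × Eventually λ k → â k ≤ ℚ.- ε)
                negative (ε , 0<ε , a≤-ε) = no-negative-conjugate q̂ â γ 0<γ q>1 q<2 (ι T) (integer-gap (+ 2) T)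
                  (eventually-nonNeg (bounded-neg (bounded-seq a)) (ev-map (λ k le → ℚ.≤-trans (ℚ.<⇒≤ 0<ε)
                    (subst (_≤ ℚ.- â k) (solve 1 (λ e → :- (:- e) := e) refl ε) (ℚ.neg-antimono-≤ le))) a≤-ε))
                  -a≤⅝ a²-a<1 p²≥1 upper lower
                positive : (∃ λ γ′ → 0ℚ < γ′ × Eventually λ k → N (C k) ≤ 1ℚ ℚ.- γ′) ⊎ (∀ k → C k ≡ 1𝔾 × S k ≡ 0𝔾) →
                  NonNeg â → ⊥
                positive (inj₁ (γ′ , 0<γ′ , C≤)) 0≤a = with-gap (smaller 0<γ 0<γ′)
                  where
                  with-gap : (∃ λ c → 0ℚ < c × c ≤ γ × c ≤ γ′) → ⊥
                  with-gap (c , 0<c , c≤γ , c≤γ′) = no-positive-conjugate q̂ â c 0<c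
                    (nonNeg-resp (nonNeg-+ q>1 (nonNeg-const (≤⇒0≤- c≤γ))) λ k →
                      solve 3 (λ q g c → (q :- (con 1ℚ :+ g)) :+ (g :- c) := q :- (con 1ℚ :+ c)) refl (q̂ k) γ c)
                    (nonNeg-resp (nonNeg-+ q<2 (nonNeg-const (≤⇒0≤- c≤γ))) λ k →
                      solve 3 (λ q g c → ((con (+ 2 ℚ./ 1) :- g) :- q) :+ (g :- c) := (con (+ 2 ℚ./ 1) :- c) :- q) refl (q̂ k) γ c)
                    (ι T) (integer-gap (+ 0) T) 0≤a a≤⅝ p²>1 upper lower
                    where
                    p²>1 : NonNeg (λ k → (p̂ k ℚ.* p̂ k ℚ.- 1ℚ) ℚ.- c)
                    -- From |C|² ≤ 1 - c the limit of p² (1 - |C|²) gives p² - 1 ≥ c p², and p² ≥ 1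
                    -- turns this into p² - 1 ≥ c.
                    p²>1 = nonNeg-resp (nonNeg-+
                        (nonNeg-approx {u = λ k → p̂ k ℚ.* p̂ k ℚ.* (Y k ℚ.- c)} {v = λ k → p̂ k ℚ.* p̂ k ℚ.- ι ν ℚ.* ι ν ℚ.- c ℚ.* (p̂ k ℚ.* p̂ k)}
                          (bounded-+ p²-bounded (bounded-neg (bounded-* (bounded-const c) (bounded-* p-bounded p-bounded))))
                          (ev-map (λ k C≤ → 0≤* (0≤x² (p̂ k)) (≤⇒0≤- (≤-from {c} {Y k} (0≤+ (≤⇒0≤- C≤) (≤⇒0≤- c≤γ′))
                            (solve 3 (λ n g c → (con 1ℚ :- n) :- c := ((con 1ℚ :- g) :- n) :+ (g :- c)) refl (N (C k)) γ′ c)))) C≤)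
                          (null-resp p²Y-limit λ k → solve 4 (λ P Y n c → P :* Y :- (P :- n) := P :* (Y :- c) :- ((P :- n) :- c :* P))
                            refl (p̂ k ℚ.* p̂ k) (Y k) (ι ν ℚ.* ι ν) c))
                        (nonNeg-* (nonNeg-const (ℚ.<⇒≤ 0<c)) p²≥1))
                      λ k → trans (cong (λ n → (p̂ k ℚ.* p̂ k ℚ.- n ℚ.- c ℚ.* (p̂ k ℚ.* p̂ k)) ℚ.+ c ℚ.* (p̂ k ℚ.* p̂ k ℚ.- 1ℚ)) ν²≡1)
                        (solve 2 (λ P c → ((P :- con 1ℚ) :- c :* P) :+ c :* (P :- con 1ℚ) := (P :- con 1ℚ) :- c) refl (p̂ k ℚ.* p̂ k) c)
                positive (inj₂ trivial) 0≤a = with-sign ν≡±1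
                  where
                  p≈ν : Null (λ k → p̂ k ℚ.- ι ν)
                  p≈ν = null-resp (null-neg x₂→0) λ k → trans
                    (cong (λ z → ℚ.- (ι ν ℚ.- p̂ k ℚ.* re z)) (proj₁ (trivial k)))
                    (solve 2 (λ p n → :- (n :- p :* con 1ℚ) := p :- n) refl (p̂ k) (ι ν))
                  s≈-t : Null (λ k → s k ℚ.- ι (ℤ.- t))
                  s≈-t = null-resp x₃→0 λ k → trans
                    (cong (λ z → ι t ℚ.- (re z ℚ.- s k)) (proj₂ (trivial k)))
                    (trans (solve 2 (λ t s → t :- (con 0ℚ :- s) := s :- :- t) refl (ι t) (s k))
                      (cong (λ z → s k ℚ.- z) (sym (ι-neg t))))
                  with-sign : ι ν ≡ 1ℚ ⊎ ι ν ≡ ℚ.- 1ℚ → ⊥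
                  with-sign (inj₁ ν≡1) = no-quadratic-unit q̂ â γ 0<γ q>1 q<2 (ι (ℤ.- t)) (integer-gap (+ 2) (ℤ.- t))
                    (null-resp p≈ν λ k → cong (λ z → p̂ k ℚ.- z) ν≡1) s≈-t
                  with-sign (inj₂ ν≡-1) = nonNeg-⊥ 0<1
                    (nonNeg-+ (nonNeg-* 0≤q 0≤a) (null⇒nonNeg (null-neg p≈ν)))
                    λ k → trans (cong (λ n → p̂ k ℚ.+ ℚ.- (p̂ k ℚ.- n)) ν≡-1)
                      (solve 1 (λ p → p :+ :- (p :- con (ℚ.- 1ℚ)) := :- con 1ℚ) refl (p̂ k))

              difference : ∀ x y → ι (x ℤ.- y) ≡ ι x ℚ.- ι y
              difference x y = trans (ι-+ x (ℤ.- y)) (cong (λ z → ι x ℚ.+ z) (ι-neg y))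

              decide : ν ≡ + 1 ⊎ ν ≡ -[1+ 0 ] → ⊥
              -- By Vieta Σ θ = -t and Σ 1/θ = -t₁/ν, so τ = t₁/ν - t. For ν = 1, `M` is p τ - s (p
              -- - 1).
              decide (inj₁ ν≡1) = finish (t₁ ℤ.- t) (inj₁ (cong ι ν≡1))
                (nonNeg-resp p²-ν²≥M λ k → trans
                  (cong (λ n → p̂ k ℚ.* p̂ k ℚ.- n ℚ.* n ℚ.- (p̂ k ℚ.* ι t₁ ℚ.+ s k ℚ.* n ℚ.- n ℚ.* p̂ k ℚ.* (ι t ℚ.+ s k))) (cong ι ν≡1))
                  (trans (solve 4 (λ q a t₁ t → let p = q :* a ; s = q :+ a ; 1′ = con 1ℚ in
                      p :* p :- 1′ :* 1′ :- (p :* t₁ :+ s :* 1′ :- 1′ :* p :* (t :+ s))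
                      := (p :- 1′) :* ((q :+ 1′) :* (a :+ 1′)) :- p :* (t₁ :- t)) refl (q̂ k) (â k) (ι t₁) (ι t))
                    (cong (λ τ → (p̂ k ℚ.- 1ℚ) ℚ.* ((q̂ k ℚ.+ 1ℚ) ℚ.* (â k ℚ.+ 1ℚ)) ℚ.- p̂ k ℚ.* τ) (sym (difference t₁ t)))))
                (nonNeg-resp p²-ν²≥-M λ k → trans
                  (cong (λ n → p̂ k ℚ.* p̂ k ℚ.- n ℚ.* n ℚ.+ (p̂ k ℚ.* ι t₁ ℚ.+ s k ℚ.* n ℚ.- n ℚ.* p̂ k ℚ.* (ι t ℚ.+ s k))) (cong ι ν≡1))
                  (trans (solve 4 (λ q a t₁ t → let p = q :* a ; s = q :+ a ; 1′ = con 1ℚ in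
                      p :* p :- 1′ :* 1′ :+ (p :* t₁ :+ s :* 1′ :- 1′ :* p :* (t :+ s))
                      := p :* (t₁ :- t) :+ (p :- 1′) :* ((q :- 1′) :* (a :- 1′))) refl (q̂ k) (â k) (ι t₁) (ι t))
                    (cong (λ τ → p̂ k ℚ.* τ ℚ.+ (p̂ k ℚ.- 1ℚ) ℚ.* ((q̂ k ℚ.- 1ℚ) ℚ.* (â k ℚ.- 1ℚ))) (sym (difference t₁ t)))))
              -- For ν = -1, `M` is the negative of p τ - s (p - 1), so the two Schwarz-Pick bounds
              -- exchange roles.
              decide (inj₂ ν≡-1) = finish (ℤ.- t₁ ℤ.- t) (inj₂ (cong ι ν≡-1))
                (nonNeg-resp p²-ν²≥-M λ k → trans
                  (cong (λ n → p̂ k ℚ.* p̂ k ℚ.- n ℚ.* n ℚ.+ (p̂ k ℚ.* ι t₁ ℚ.+ s k ℚ.* n ℚ.- n ℚ.* p̂ k ℚ.* (ι t ℚ.+ s k))) (cong ι ν≡-1))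
                  (trans (solve 4 (λ q a t₁ t → let p = q :* a ; s = q :+ a ; 1′ = con 1ℚ ; -1′ = con (ℚ.- 1ℚ) in
                      p :* p :- -1′ :* -1′ :+ (p :* t₁ :+ s :* -1′ :- -1′ :* p :* (t :+ s))
                      := (p :- 1′) :* ((q :+ 1′) :* (a :+ 1′)) :- p :* (:- t₁ :- t)) refl (q̂ k) (â k) (ι t₁) (ι t))
                    (cong (λ τ → (p̂ k ℚ.- 1ℚ) ℚ.* ((q̂ k ℚ.+ 1ℚ) ℚ.* (â k ℚ.+ 1ℚ)) ℚ.- p̂ k ℚ.* τ) (sym difference′))))
                (nonNeg-resp p²-ν²≥M λ k → trans
                  (cong (λ n → p̂ k ℚ.* p̂ k ℚ.- n ℚ.* n ℚ.- (p̂ k ℚ.* ι t₁ ℚ.+ s k ℚ.* n ℚ.- n ℚ.* p̂ k ℚ.* (ι t ℚ.+ s k))) (cong ι ν≡-1))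
                  (trans (solve 4 (λ q a t₁ t → let p = q :* a ; s = q :+ a ; 1′ = con 1ℚ ; -1′ = con (ℚ.- 1ℚ) in
                      p :* p :- -1′ :* -1′ :- (p :* t₁ :+ s :* -1′ :- -1′ :* p :* (t :+ s))
                      := p :* (:- t₁ :- t) :+ (p :- 1′) :* ((q :- 1′) :* (a :- 1′))) refl (q̂ k) (â k) (ι t₁) (ι t))
                    (cong (λ τ → p̂ k ℚ.* τ ℚ.+ (p̂ k ℚ.- 1ℚ) ℚ.* ((q̂ k ℚ.- 1ℚ) ℚ.* (â k ℚ.- 1ℚ))) (sym difference′))))
                where
                difference′ : ι (ℤ.- t₁ ℤ.- t) ≡ ℚ.- ι t₁ ℚ.- ι t
                difference′ = trans (difference (ℤ.- t₁) t) (cong (ℚ._- ι t) (ι-neg t₁))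

      module _ {m} (p : Vec ℚ (suc (suc (suc m)))) (minimal : IsMinimalPolynomial p Q̂) where
        open Polynomial p minimal

        conjugate-pair : ∀ z w → (∀ k → at k w ≡ at k z ̄) → Small (λ k → at k (eval f₁ z)) →
          Small (λ k → at k (eval (deflateᶜ f₁ z) w)) → Eventually (λ k → N (at k z) ≤ ⅝ ℚ.* ⅝) → ⊥
        conjugate-pair z w w≡z̄ z-root w-root N≤ =
          stage₁ integral-p (complex-factorization (deflateᶜ (deflateᶜ f₁ z) w))
          where
          stage₁ : (∃ λ P → map ι P ≡ p) →
            (∃ λ ws → Vanishes λ k → dist (map (at k) (deflateᶜ (deflateᶜ f₁ z) w)) (from-roots (map (at k) ws))) → ⊥
          stage₁ (P , P≡p) (ws , f₃≈) = stage₂ (constant-integral P)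
            where
            vs : Vec ℂ (suc (suc m))
            vs = z ∷ w ∷ ws
            f₁≈ : Vanishes λ k → dist (map (at k) f₁) (from-roots (map (at k) vs))
            f₁≈ = times-linear-limit f₁ z (vanishes z-root) (λ k → from-roots (map (at k) (w ∷ ws)))
              (times-linear-limit (deflateᶜ f₁ z) w (vanishes w-root) (λ k → from-roots (map (at k) ws)) f₃≈)
            f₀≈ : Vanishes λ k → dist (map (at k) f₀) (from-roots (map (at k) (Q̂ ∷ vs)))
            f₀≈ = times-linear-limit f₀ Q̂ (vanishes Q̂-root) (λ k → from-roots (map (at k) vs)) f₁≈
            ws-inside : Eventually λ k → All (λ w → N w ≤ 1ℚ) (map (at k) ws)
            ws-inside = all-inside ws (λ i → roots-of-factorization f₁ vs f₁≈ (suc (suc i)))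
            C : ℕ → 𝔾
            C k = constant (from-roots (map (at k) ws))

            stage₂ : (∃ λ ν → constant (map real (map ι P)) ≡ real (ι ν)) → ⊥
            -- One late index suffices: there q |z|² ≤ 2 (5/8)² = 25/32, the approximation error of
            -- ν is below 1/8, and 3/32 remains to separate |ν| from 1.
            stage₂ (ν , ν≡) = stage₃ (witness (ev-zip {λ k → ∣ x k ∣ < + 1 ℚ./ 8}
                {λ k → (1ℚ ≤ seq q k × seq q k ≤ + 2 ℚ./ 1) × N (at k z) ≤ ⅝ ℚ.* ⅝ × N (C k) ≤ 1ℚ} (λ k → _,_)
                (Null.within x→0 (+ 1 ℚ./ 8) (ℚ.positive⁻¹ (+ 1 ℚ./ 8)))
                (ev-zip {λ k → 1ℚ ≤ seq q k × seq q k ≤ + 2 ℚ./ 1} {λ k → N (at k z) ≤ ⅝ ℚ.* ⅝ × N (C k) ≤ 1ℚ} (λ k → _,_)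
                  (ev-zip {λ k → 1ℚ ≤ seq q k} {λ k → seq q k ≤ + 2 ℚ./ 1} (λ k → _,_) q₁ q₂)
                  (ev-zip {λ k → N (at k z) ≤ ⅝ ℚ.* ⅝} {λ k → N (C k) ≤ 1ℚ} (λ k → _,_) N≤
                    (ev-map (λ k all → proj₁ (schwarz-pick all)) ws-inside)))))
              where
              x : Seq
              x k = ι ν ℚ.+ seq q k ℚ.* N (at k z) ℚ.* re (C k)
              product : ∀ ν q z C → re (real ν - - (real q * - (z * - (z ̄ * C)))) ≡ ν ℚ.+ q ℚ.* N z ℚ.* re C
              product ν q (a ⊹ b) (c ⊹ d) = solve 6 (λ ν q a b c d →
                let u = :- (a :* c :- (:- b) :* d)
                    v = :- (a :* d :+ (:- b) :* c)
                in ν :+ :- (:- (q :* (:- (a :* u :- b :* v)) :- con 0ℚ :* (:- (a :* v :+ b :* u))))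
                := ν :+ q :* (a :* a :+ b :* b) :* c) refl ν q a b c d
              x→0 : Null x
              x→0 = null-resp (small⇒null-re (small-dist (λ k → map (at k) f₀)
                  (λ k → from-roots (map (at k) (Q̂ ∷ vs))) {constant} constant-close f₀≈))
                λ k → trans (cong₂ (λ c d → re (c - d))
                    (trans (cong constant (trans (at-constants p k) (cong (map real) (sym P≡p)))) ν≡)
                    (trans (constant-times-linear (at k Q̂) (from-roots (map (at k) vs)))
                      (cong (λ c → - (at k Q̂ * c)) (trans (constant-times-linear (at k z) (from-roots (map (at k) (w ∷ ws))))
                        (cong (λ c → - (at k z * c)) (trans (constant-times-linear (at k w) (from-roots (map (at k) ws)))
                          (cong (λ v → - (v * C k)) (w≡z̄ k))))))))
                  (product (ι ν) (seq q k) (at k z) (C k))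

              stage₃ : (∃ λ k → ∣ x k ∣ < + 1 ℚ./ 8 × (1ℚ ≤ seq q k × seq q k ≤ + 2 ℚ./ 1) × N (at k z) ≤ ⅝ ℚ.* ⅝ × N (C k) ≤ 1ℚ) → ⊥
              stage₃ (k , x< , (1≤q , q≤2) , Nz≤ , NC≤1) =
                impossible (unit ν (constant≢0 (trans (cong (λ p → constant (map real p)) (sym P≡p)) ν≡)) ν²<4)
                where
                u c : ℚ
                u = seq q k ℚ.* N (at k z)
                c = re (C k)
                0≤q = ℚ.≤-trans 0≤1 1≤q
                0≤u : 0ℚ ≤ u
                0≤u = 0≤* 0≤q (0≤N (at k z))
                u≤ : u ≤ + 25 ℚ./ 32
                u≤ = ℚ.≤-trans (*-mono {seq q k} {+ 2 ℚ./ 1} {N (at k z)} {⅝ ℚ.* ⅝} (ℚ.nonNegative⁻¹ (+ 2 ℚ./ 1)) (0≤N (at k z)) q≤2 Nz≤) (ℚ.≤-reflexive refl)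
                c≤1 : c ≤ 1ℚ
                c≤1 = square-cancel-≤ 0≤1 (ℚ.≤-trans (re²≤N (C k)) NC≤1)
                -c≤1 : ℚ.- c ≤ 1ℚ
                -c≤1 = square-cancel-≤ 0≤1 (ℚ.≤-trans
                  (ℚ.≤-reflexive (solve 1 (λ c → (:- c) :* (:- c) := c :* c) refl c)) (ℚ.≤-trans (re²≤N (C k)) NC≤1))
                -1<ν : ℚ.- 1ℚ < ι ν
                -1<ν = <-from (0<+ (<⇒0<- (∣x∣<⇒-ε<x x<)) (0≤+ (0≤* 0≤u (≤⇒0≤- c≤1)) (0≤+ (≤⇒0≤- u≤) (ℚ.nonNegative⁻¹ (+ 3 ℚ./ 32)))))
                  (solve 3 (λ n u c → n :- con (ℚ.- 1ℚ) := ((n :+ u :* c) :- :- con (+ 1 ℚ./ 8)) :+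
                    (u :* (con 1ℚ :- c) :+ ((con (+ 25 ℚ./ 32) :- u) :+ con (+ 3 ℚ./ 32)))) refl (ι ν) u c)
                ν<1 : ι ν < 1ℚ
                ν<1 = <-from (0<+ (<⇒0<- (∣x∣<⇒x< x<)) (0≤+ (0≤* 0≤u (≤⇒0≤- -c≤1)) (0≤+ (≤⇒0≤- u≤) (ℚ.nonNegative⁻¹ (+ 3 ℚ./ 32)))))
                  (solve 3 (λ n u c → con 1ℚ :- n := (con (+ 1 ℚ./ 8) :- (n :+ u :* c)) :+
                    (u :* (con 1ℚ :- :- c) :+ ((con (+ 25 ℚ./ 32) :- u) :+ con (+ 3 ℚ./ 32)))) refl (ι ν) u c)
                ν²<4 : ι ν ℚ.* ι ν < + 4 ℚ./ 1
                ν²<4 = <-from (0<+ (0<* (<⇒0<- -1<ν) (<⇒0<- ν<1)) (ℚ.nonNegative⁻¹ (+ 3 ℚ./ 1)))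
                  (solve 1 (λ n → con (+ 4 ℚ./ 1) :- n :* n := (n :- con (ℚ.- 1ℚ)) :* (con 1ℚ :- n) :+ con (+ 3 ℚ./ 1)) refl (ι ν))
                impossible : ν ≡ + 1 ⊎ ν ≡ -[1+ 0 ] → ⊥
                impossible (inj₁ ν≡1)  = ℚ.<-irrefl (cong ι ν≡1) ν<1
                impossible (inj₂ ν≡-1) = ℚ.<-irrefl (sym (cong ι ν≡-1)) -1<ν

      conjᶜ : ℂ → ℂ
      conjᶜ z = D.re z +i (D.- D.im z)

      ⟦⟧-conj : ∀ {n} (p : Vec ℚ n) z → ⟦ map real p ⟧ (z ̄) ≡ ⟦ map real p ⟧ z ̄
      ⟦⟧-conj []      z = refl
      ⟦⟧-conj (a ∷ p) z = trans (cong (λ w → real a + z ̄ * w) (⟦⟧-conj p z)) (part z (⟦ map real p ⟧ z))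
        where
        part : ∀ z w → real a + z ̄ * w ̄ ≡ (real a + z * w) ̄
        part (x ⊹ y) (u ⊹ v) = cong₂ _⊹_
          (solve 5 (λ a x y u v → a :+ (x :* u :- (:- y) :* (:- v)) := a :+ (x :* u :- y :* v)) refl a x y u v)
          (solve 4 (λ x y u v → con 0ℚ :+ (x :* (:- v) :+ (:- y) :* u) := :- (con 0ℚ :+ (x :* v :+ y :* u))) refl x y u v)

      root-conj : ∀ {n} (p : Vec ℚ n) z → Root p z → Root p (conjᶜ z)
      root-conj p z (small h) = small λ ε 0<ε → ev-map (λ k → subst (_< ε)
        (trans (sym (‖̄‖ (⟦ map real p ⟧ (at k z)))) (cong ‖_‖ (sym (⟦⟧-conj p (at k z)))))) (h ε 0<ε)

    -- Whether z is real cannot be decided. An imaginary part bounded away from 0 makes z and its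
    -- conjugate two separate roots and is refuted; therefore the imaginary part is both at least
    -- and at most 0, and z may be replaced by its real part.
    no-small-conjugate : ∀ {n} (p : Vec ℚ n) → IsMinimalPolynomial p Q̂ → ∀ z → Root p z →
      Eventually (λ k → SmallModulus γ (at k z)) → ⊥
    no-small-conjugate []                  _       z root _     = ¬small-1 root
    no-small-conjugate {suc n} p@(_ ∷ _) minimal z root z-small = no-im (nonNeg-dichotomy y no-neg) (nonNeg-dichotomy (D.- y) no-pos)
      where
      open Polynomial p minimal
      x y : ℝ
      x = D.re z
      y = D.im z
      apart : ∀ w → D.re w ≡ x → BoundedBelow (λ k → at k w - at k Q̂)
      -- q ≥ 1 and Re w ≤ 5/8 leave a distance of 3/8, so q can be divided out before w.
      apart w refl = away (+ 3 ℚ./ 8) (ℚ.positive⁻¹ (+ 3 ℚ./ 8)) (ev-zip {λ k → 1ℚ ≤ seq q k} {λ k → SmallModulus γ (at k z)}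
        (λ k 1≤q small → ℚ.≤-trans (ℚ.≤-trans
          (≤-from (0≤+ (≤⇒0≤- 1≤q) (≤⇒0≤- (SmallModulus.re≤ small)))
            (solve 2 (λ q x → (:- (x :+ :- q)) :- con (+ 3 ℚ./ 8) := (q :- con 1ℚ) :+ (con ⅝ :- x)) refl (seq q k) (seq x k)))
          (-x≤∣x∣ (seq x k ℚ.+ ℚ.- seq q k))) ∣re∣≤‖ at k w - at k Q̂ ‖)
        q₁ z-small)
        where
        -x≤∣x∣ : ∀ x → ℚ.- x ≤ ∣ x ∣
        -x≤∣x∣ x = subst (ℚ.- x ≤_) (ℚ.∣-p∣≡∣p∣ x) (ℚ.≮⇒≥ λ lt → ℚ.<-irrefl refl (∣x∣<⇒x< {ℚ.- x} lt))
      f₁-root : ∀ w → D.re w ≡ x → Root p w → Small λ k → at k (eval f₁ w)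
      f₁-root w re≡ root = root-of-deflate f₀ Q̂ w Q̂-root (f₀-root w root) (apart w re≡)

      im-apart : ∀ ε → 0ℚ < ε → Eventually (λ k → ε ≤ ∣ seq y k ∣) → BoundedBelow (λ k → at k (conjᶜ z) - at k z)
      im-apart ε 0<ε ε≤ = away ε 0<ε (ev-map (λ k le → ℚ.≤-trans (ℚ.≤-trans le (double (seq y k))) ∣im∣≤‖ at k (conjᶜ z) - at k z ‖) ε≤)
        where
        double : ∀ y → ∣ y ∣ ≤ ∣ ℚ.- y ℚ.+ ℚ.- y ∣
        double y = subst (∣ y ∣ ≤_) (trans (sym (ℚ.∣p*q∣≡∣p∣*∣q∣ (ℚ.- 2ℚ) y))
            (cong ∣_∣ (solve 1 (λ y → con (ℚ.- 2ℚ) :* y := :- y :+ :- y) refl y)))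
          (≤-from {∣ y ∣} {2ℚ ℚ.* ∣ y ∣} (ℚ.0≤∣p∣ y) (solve 1 (λ a → con 2ℚ :* a :- a := a) refl (∣ y ∣)))

      -- In degrees one and two the roots q, z and z̄ are too many: after the divisions the constant
      -- polynomial 1 would have to vanish.
      by-degree : ∀ {n} (p : Vec ℚ (suc n)) (minimal : IsMinimalPolynomial p Q̂) →
        Small (λ k → at k (eval (Polynomial.f₁ p minimal) z)) → Small (λ k → at k (eval (Polynomial.f₁ p minimal) (conjᶜ z))) →
        (∃ λ ε → 0ℚ < ε × Eventually λ k → ε ≤ ∣ seq y k ∣) → ⊥
      by-degree {zero}        (_ ∷ [])    _       r _ _ = ¬small-1 r
      by-degree {suc zero}    p@(_ ∷ _ ∷ []) minimal r r̄ (ε , 0<ε , ε≤) = ¬small-1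
        (root-of-deflate (Polynomial.f₁ p minimal) z (conjᶜ z) r r̄ (im-apart ε 0<ε ε≤))
      by-degree {suc (suc m)} p           minimal r r̄ (ε , 0<ε , ε≤) = conjugate-pair p minimal z (conjᶜ z) (λ k → refl) r
        (root-of-deflate (Polynomial.f₁ p minimal) z (conjᶜ z) r r̄ (im-apart ε 0<ε ε≤))
        (ev-map (λ k → SmallModulus.N≤) z-small)

      complex-case : (∃ λ ε → 0ℚ < ε × Eventually λ k → ε ≤ ∣ seq y k ∣) → ⊥
      complex-case = by-degree p minimal (f₁-root z refl root) (f₁-root (conjᶜ z) refl (root-conj p z root))

      ≤∣∣ : ∀ {ε v} → v ≤ ℚ.- ε → ε ≤ ∣ v ∣
      ≤∣∣ {ε} {v} v≤-ε = ℚ.≮⇒≥ λ lt → ℚ.<-irrefl refl (ℚ.<-≤-trans (∣x∣<⇒-ε<x lt) v≤-ε)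
      no-neg : ¬ (∃ λ ε → 0ℚ < ε × Eventually λ k → seq y k ≤ ℚ.- ε)
      no-neg (ε , 0<ε , le) = complex-case (ε , 0<ε , ev-map (λ k → ≤∣∣) le)
      no-pos : ¬ (∃ λ ε → 0ℚ < ε × Eventually λ k → ℚ.- seq y k ≤ ℚ.- ε)
      no-pos (ε , 0<ε , le) = complex-case (ε , 0<ε , ev-map (λ k v≤ → subst (ε ≤_) (ℚ.∣-p∣≡∣p∣ (seq y k)) (≤∣∣ v≤)) le)

      real-case : ∀ {n} (p : Vec ℚ (suc n)) (minimal : IsMinimalPolynomial p Q̂) →
        Small (λ k → at k (eval (Polynomial.f₁ p minimal) (fromℝ x))) → ⊥
      real-case {zero}  (_ ∷ []) _ r = ¬small-1 r
      real-case {suc n} p minimal r = real-conjugate p minimal x r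
        (eventually-nonNeg (bounded-+ (bounded-const ⅝) (bounded-neg (bounded-seq x)))
          (ev-map (λ k sm → ≤⇒0≤- (SmallModulus.re≤ sm)) z-small))
        (eventually-nonNeg (bounded-+ (bounded-const ⅝) (bounded-seq x))
          (ev-map (λ k sm → subst (0ℚ ≤_) (solve 1 (λ x → con ⅝ :- :- x := con ⅝ :+ x) refl (seq x k))
            (≤⇒0≤- (SmallModulus.-re≤ sm))) z-small))
        (eventually-nonNeg (bounded-+ (bounded-const (1ℚ ℚ.- γ))
            (bounded-neg (bounded-+ (bounded-* (bounded-seq x) (bounded-seq x)) (bounded-neg (bounded-seq x)))))
          (ev-map (λ k sm → ≤⇒0≤- (SmallModulus.re²-re≤ sm)) z-small))

      no-im : NonNeg (seq y) → NonNeg (λ k → ℚ.- seq y k) → ⊥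
      no-im 0≤y y≤0 = real-case p minimal (small-resp
        (small-+ (f₁-root z refl root) (small-neg (eval-close f₁ z (fromℝ x) z≈x)))
        λ k → G.solve 2 (λ a b → a G.:+ G.:- (a G.:- b) G.:= b) refl (at k (eval f₁ z)) (at k (eval f₁ (fromℝ x))))
        where
        z≈x : Small λ k → at k z - at k (fromℝ x)
        z≈x = small λ ε 0<ε → ev-zip (λ k lo hi → subst (_< ε)
            (trans (sym (ℚ.+-identityˡ (∣ seq y k ∣))) (cong₂ (λ u v → ∣ u ∣ ℚ.+ ∣ v ∣)
              (sym (ℚ.+-inverseʳ (seq x k))) (sym (ℚ.+-identityʳ (seq y k)))))
            (∣x∣<-intro (subst₂ ℚ._<_ (solve 1 (λ y → :- (:- y) := y) refl (seq y k))
              (solve 1 (λ e → :- (:- e) := e) refl ε) (ℚ.neg-antimono-< hi)) lo))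
          (NonNeg.above 0≤y ε 0<ε) (NonNeg.above y≤0 ε 0<ε)

-- Choice of the margin and conclusion.

open import Defs
open import Data.Integer.Base using (+_)
open import Data.Rational.Base using (½; _/_)

private
  module Conclusion where

    open RationalOrder
    open ComplexRoots
    open RealLimits
    open Conjugates using (isRoot⇒root)
    open PisotConjugates using (SmallModulus; small-modulus)
    open SmallConjugates using (no-small-conjugate)
    open ℚ.+-*-Solver using (solve; _:+_; _:-_; :-_; _:=_; con)

    r : ℚ
    r = + 1933 / 1000

    main : ∀ (q : ℝ) → IsPisot q → 1ℝ < q → q ≤ fromℚ r → ∀ (q′ : ℂ) → q′ IsConjugateOf fromℝ q →
      ¬ (∣ q′ ∣ < (sqrt (fromℚ (+ 5 / 1)) - 1ℝ) * fromℚ ½)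
    main q (_ , algebraic-integer , pisot) (ε , 0<ε , 1+ε≤q) q≤r q′ (n , p , minimal , root) small =
      stage₁ (small-modulus q′ small)
      where
      r-q : NonNeg (λ k → r ℚ.- seq q k)
      r-q = nonNeg-dichotomy (fromℚ r - q) λ (δ , 0<δ , N , h) → q≤r (δ , 0<δ , N , λ k N≤k →
        ≤-from (≤⇒0≤- (h k N≤k)) (solve 3 (λ r q d → q :- (r :+ d) := (:- d) :- (r :- q)) refl r (seq q k) δ))
      1≤q : Eventually λ k → 1ℚ ℚ.≤ seq q k
      1≤q = ev-map (λ k → ℚ.≤-trans (≤-from (ℚ.<⇒≤ 0<ε) (solve 1 (λ e → (con 1ℚ :+ e) :- con 1ℚ := e) refl ε))) 1+ε≤q
      q≤2 : Eventually λ k → seq q k ℚ.≤ + 2 / 1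
      -- The tolerance 67/1000 is 2 - 1.933, the room below the bound 2 on which all estimates rest.
      q≤2 = ev-map (λ k lt → ≤-from (ℚ.<⇒≤ (<⇒0<- lt))
          (solve 1 (λ q → con (+ 2 / 1) :- q := (con r :- q) :- :- con (+ 67 / 1000)) refl (seq q k)))
        (NonNeg.above r-q (+ 67 / 1000) (ℚ.positive⁻¹ (+ 67 / 1000)))

      weaken : ∀ {γ δ z} → γ ℚ.≤ δ → SmallModulus δ z → SmallModulus γ z
      weaken {γ} {δ} γ≤δ sm = record
        { re≤ = re≤ ; -re≤ = -re≤ ; N≤ = N≤
        ; re²-re≤ = ℚ.≤-trans re²-re≤ (ℚ.+-monoʳ-≤ 1ℚ (ℚ.neg-antimono-≤ γ≤δ))
        }
        where open SmallModulus sm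

      stage₁ : (∃ λ δ → 0ℚ ℚ.< δ × Eventually λ k → SmallModulus δ (at k q′)) → ⊥
      -- A single γ below ε, 67/1000 and δ serves as the margin in 1 < q, in q < 2 and in |q′| < (√5
      -- - 1)/2.
      stage₁ (δ , 0<δ , small) = stage₂ (smaller 0<ε (ℚ.positive⁻¹ (+ 67 / 1000)))
        where
        stage₂ : (∃ λ β → 0ℚ ℚ.< β × β ℚ.≤ ε × β ℚ.≤ + 67 / 1000) → ⊥
        stage₂ (β , 0<β , β≤ε , β≤) = stage₃ (smaller 0<β 0<δ)
          where
          stage₃ : (∃ λ γ → 0ℚ ℚ.< γ × γ ℚ.≤ β × γ ℚ.≤ δ) → ⊥
          stage₃ (γ , 0<γ , γ≤β , γ≤δ) = no-small-conjugate q γ 0<γ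
            (eventually-nonNeg (bounded-+ (bounded-seq q) (bounded-const (ℚ.- (1ℚ ℚ.+ γ)))) (ev-map (λ k le → ≤⇒0≤-
              (ℚ.≤-trans (ℚ.+-monoʳ-≤ 1ℚ (ℚ.≤-trans γ≤β β≤ε)) le)) 1+ε≤q))
            (nonNeg-resp (nonNeg-+ r-q (nonNeg-const (≤⇒0≤- (ℚ.≤-trans γ≤β β≤)))) λ k →
              solve 2 (λ q g → (con r :- q) :+ (con (+ 67 / 1000) :- g) := (con (+ 2 / 1) :- g) :- q) refl (seq q k) γ)
            1≤q q≤2 pisot algebraic-integer p minimal q′ (isRoot⇒root p q′ root)
            (ev-map (λ k → weaken γ≤δ) small)

theorem5p1 : ∀ (q : ℝ) → IsPisot q → 1ℝ < q → q ≤ fromℚ (+ 1933 / 1000) →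
    ∀ (q′ : ℂ) → q′ IsConjugateOf fromℝ q →
    (sqrt (fromℚ (+ 5 / 1)) - 1ℝ) * fromℚ ½ ≤ ∣ q′ ∣
theorem5p1 = Conclusion.main
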